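{- Let $n>1$ be an odd integer and $d$ a positive integer with $\gcd(n,d)=1$. Let $r$ be an integer with $n-(n-1)d/2\leq r\leq n$ and $n\equiv r\pmod d$. For integers $k\geq 0$ define $$c_q(k)=(-1)^k\frac{(1+q^{2dk+r})(q^{2r};q^{2d})^2_k}{(1+q^r)(q^{2d};q^{2d})^2_k}q^{dk^2+k(d-r)}.$$ Then, modulo $\Phi_n(-q)^2\Phi_n(q)^2$, $$\sum_{k=0}^{n-1}\sum_{j=0}^{k}c_q(j)c_q(k-j)\equiv \frac{[n]^2_{q^2}}{[r]^2_{q^2}}q^{\frac{2(n-r)(n+r-d)}{d}}\bigg(\sum_{k=0}^{\frac{n-r}{d}}\frac{(q^{2r},q^r;q^{2d})_k}{(q^{2d},q^{2d+r};q^{2d})_k}q^{2k(d-r)}\bigg)^2.$$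
   Context: Here $q$ is an indeterminate. The $q$-shifted factorial is $(a;q)_0=1$, $(a;q)_m=(1-a)(1-aq)\cdots(1-aq^{m-1})$ for $m\geq1$, and $(a_1,\dots,a_s;q)_m=(a_1;q)_m\cdots(a_s;q)_m$. The $q$-integer is $[m]_q=(1-q^m)/(1-q)$, so $[m]_{q^2}=(1-q^{2m})/(1-q^2)$. $\Phi_n(q)$ denotes the $n$-th cyclotomic polynomial in $q$. A congruence between rational functions in $q$ modulo a polynomial $P(q)$ means that the numerator of the difference (in reduced form) is divisible by $P(q)$ while its denominator is coprime to $P(q)$. -}

module Defs where

open import Data.Nat as ℕ using (ℕ; zero; suc)
open import Data.Nat.Divisibility using (_∣?_)
open import Data.Integer as ℤ using (ℤ; +_; -[1+_]; 0ℤ; 1ℤ; -1ℤ)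
open import Data.List using (List; []; _∷_; map; filter; upTo; drop; foldr)
open import Data.List.Relation.Unary.All using (All)
open import Data.Product using (_×_; _,_; proj₁; proj₂; ∃)
open import Relation.Binary.PropositionalEquality using (_≡_)
open import Relation.Nullary using (¬_)

-- Polynomials over ℤ in q: coefficient lists, lowest degree first.

Poly : Set
Poly = List ℤ

infixl 6 _+ₚ_ _-ₚ_
infixl 7 _*ₚ_ _·ₚ_

_+ₚ_ : Poly → Poly → Poly
[] +ₚ q = q
(a ∷ p) +ₚ [] = a ∷ p
(a ∷ p) +ₚ (b ∷ q) = (a ℤ.+ b) ∷ (p +ₚ q)

_·ₚ_ : ℤ → Poly → Poly
c ·ₚ p = map (c ℤ.*_) p

-ₚ_ : Poly → Poly
-ₚ p = map ℤ.-_ p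

_-ₚ_ : Poly → Poly → Poly
p -ₚ q = p +ₚ (-ₚ q)

_*ₚ_ : Poly → Poly → Poly
[] *ₚ q = []
(a ∷ p) *ₚ q = (a ·ₚ q) +ₚ (0ℤ ∷ (p *ₚ q))

constₚ : ℤ → Poly
constₚ c = c ∷ []

monoₚ : ℕ → Poly
monoₚ zero = 1ℤ ∷ []
monoₚ (suc m) = 0ℤ ∷ monoₚ m

prodₚ : List Poly → Poly
prodₚ = foldr _*ₚ_ (constₚ 1ℤ)

IsZero : Poly → Set
IsZero p = All (_≡ 0ℤ) p

_≈ₚ_ : Poly → Poly → Set
p ≈ₚ q = IsZero (p -ₚ q)

negVar : Poly → Poly
negVar [] = []
negVar (a ∷ p) = a ∷ -ₚ (negVar p)

-- Cyclotomic polynomials, via  q^n - 1 = ∏_{d ∣ n} Φ_d(q).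
-- Φ_n = (q^n - 1) / ∏_{d ∣ n, d < n} Φ_d, the exact quotient computed
-- as a truncated power-series quotient (the divisor has constant term ±1).

head0 : Poly → ℤ
head0 [] = 0ℤ
head0 (a ∷ _) = a

tail0 : Poly → Poly
tail0 [] = []
tail0 (_ ∷ p) = p

-- first N coefficients of the power series a / b, assuming b(0) = ±1
seriesDiv : ℕ → Poly → Poly → Poly
seriesDiv zero a b = []
seriesDiv (suc N) a b =
  let c = head0 b ℤ.* head0 a in c ∷ seriesDiv N (tail0 (a -ₚ c ·ₚ b)) b

properDivisors : ℕ → List ℕ
properDivisors n = filter (λ d → d ∣? n) (drop 1 (upTo n))

cycloF : ℕ → ℕ → Poly
cycloF zero n = constₚ 1ℤ
cycloF (suc f) n =
  seriesDiv (suc n) (monoₚ n -ₚ constₚ 1ℤ)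
                    (prodₚ (map (cycloF f) (properDivisors n)))

Φ : ℕ → Poly
Φ n = cycloF n n

Frac : Set
Frac = Poly × Poly

num den : Frac → Poly
num = proj₁
den = proj₂

infixl 6 _+f_ _-f_
infixl 7 _*f_ _/f_

_+f_ : Frac → Frac → Frac
(a , b) +f (c , d) = (a *ₚ d +ₚ c *ₚ b) , (b *ₚ d)

_-f_ : Frac → Frac → Frac
(a , b) -f (c , d) = (a *ₚ d -ₚ c *ₚ b) , (b *ₚ d)

_*f_ : Frac → Frac → Frac
(a , b) *f (c , d) = (a *ₚ c) , (b *ₚ d)

_/f_ : Frac → Frac → Frac
(a , b) /f (c , d) = (a *ₚ d) , (b *ₚ c)

constf : ℤ → Frac
constf c = constₚ c , constₚ 1ℤ

1f : Frac
1f = constf 1ℤ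

sq : Frac → Frac
sq x = x *f x

qpow : ℤ → Frac
qpow (+ m) = monoₚ m , constₚ 1ℤ
qpow -[1+ m ] = constₚ 1ℤ , monoₚ (suc m)

signf : ℕ → Frac
signf zero = 1f
signf (suc k) = constf -1ℤ *f signf k

sumf : ℕ → (ℕ → Frac) → Frac
sumf zero f = constf 0ℤ
sumf (suc N) f = sumf N f +f f N

qpoch : ℤ → ℕ → ℕ → Frac
qpoch e s zero = 1f
qpoch e s (suc k) = qpoch e s k *f (1f -f qpow (e ℤ.+ + (s ℕ.* k)))

qint2 : ℤ → Frac
qint2 m = (1f -f qpow (+ 2 ℤ.* m)) /f (1f -f qpow (+ 2))

-- Congruence of rational functions modulo a polynomial P:
-- both are genuine fractions (nonzero denominators) and the difference
-- equals P·U/V with V coprime to P in ℚ[q] (Bezout: a V + b P = c ≠ 0).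
-- This is equivalent to: in reduced form the difference has numerator
-- divisible by P and denominator coprime to P.

CoprimeP : Poly → Poly → Set
CoprimeP V P = ∃ λ a → ∃ λ b → ∃ λ c → ¬ (c ≡ 0ℤ) × ((a *ₚ V +ₚ b *ₚ P) ≈ₚ constₚ c)

_≡f_[mod_] : Frac → Frac → Poly → Set
X ≡f Y [mod P ] =
  ¬ IsZero (den X) × ¬ IsZero (den Y) ×
  ∃ λ U → ∃ λ V → CoprimeP V P ×
    (((num X *ₚ den Y -ₚ num Y *ₚ den X) *ₚ V) ≈ₚ (P *ₚ U *ₚ den X *ₚ den Y))

cq : ℕ → ℤ → ℕ → Frac
cq d r k =
  signf k
  *f (((1f +f qpow (+ (2 ℕ.* d ℕ.* k) ℤ.+ r)) *f sq (qpoch (+ 2 ℤ.* r) (2 ℕ.* d) k))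
      /f ((1f +f qpow r) *f sq (qpoch (+ (2 ℕ.* d)) (2 ℕ.* d) k)))
  *f qpow (+ (d ℕ.* k ℕ.* k) ℤ.+ + k ℤ.* (+ d ℤ.- r))

lhs : ℕ → ℕ → ℤ → Frac
lhs n d r = sumf n (λ k → sumf (suc k) (λ j → cq d r j *f cq d r (k ℕ.∸ j)))

rterm : ℕ → ℤ → ℕ → Frac
rterm d r k =
  (qpoch (+ 2 ℤ.* r) (2 ℕ.* d) k *f qpoch r (2 ℕ.* d) k)
  /f (qpoch (+ (2 ℕ.* d)) (2 ℕ.* d) k *f qpoch (+ (2 ℕ.* d) ℤ.+ r) (2 ℕ.* d) k)
  *f qpow (+ (2 ℕ.* k) ℤ.* (+ d ℤ.- r))

-- right-hand side; (n - r)/d and 2(n-r)(n+r-d)/d are exact divisions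
rhs : (n d : ℕ) .{{_ : ℕ.NonZero d}} → ℤ → Frac
rhs n d r =
  (sq (qint2 (+ n)) /f sq (qint2 r))
  *f qpow ((+ 2 ℤ.* (+ n ℤ.- r) ℤ.* (+ n ℤ.+ r ℤ.- + d)) ℤ./ℕ d)
  *f sq (sumf (suc ℤ.∣ (+ n ℤ.- r) ℤ./ℕ d ∣) (rterm d r))

modulus : ℕ → Poly
modulus n = negVar (Φ n) *ₚ negVar (Φ n) *ₚ Φ n *ₚ Φ n

{-# OPTIONS --safe #-}
-- Put u = q^r, a = u², Q = q^(2d), m = (n - r)/d and x = q^(2n) = a Q^m; then 2m < n.  In the ring of rational
-- functions with denominator coprime to P = Φₙ(q)² Φₙ(-q)² we have P ∣ (1 - x)², and 1 - q^(2i) is a unit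
-- unless n ∣ i.
--
-- If m > 0, the term c(k) contains (1 - x)² for m < k < n, so the left-hand side is congruent to (∑_{k≤m} c(k))².
-- Modulo (1 - x)² one may replace (a;Q)ₖ² by (ax;Q)ₖ (a/x;Q)ₖ and (Q;Q)ₖ² by (Qx;Q)ₖ (Q/x;Q)ₖ; since
-- a/x = Q^(-m), the sum then terminates, and a limiting case of Watson's transformation, which holds exactly in
-- ℚ(q), turns it into ± a^m Q^(m(m-1)/2) (1 - x)/(1 - a) times a similar perturbation of the sum on the right.
-- The transformation follows by expanding the right-hand terms by a WZ-summable series and applying
-- q-Chu–Vandermonde to the inner sum.  The possible pole 1 - q^(r + 2dk) = 1 - q^n is cancelled by 1 - x.
--
-- If m = 0, i.e. r = n, the right-hand side is 1, c(j) c(k) ≡ 0 for j, k > 0, and c(k) + c(n - k) ≡ 0.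
module Submission where

open import Defs using (properDivisors)
open import Level using (0ℓ)
open import Algebra.Bundles using (CommutativeRing)
import Algebra.Solver.Ring
import Algebra.Solver.Ring.AlmostCommutativeRing as ACR
open import Data.Nat as ℕ using (ℕ; zero; suc; z≤n; s≤s; _<_; _∸_)
import Data.Nat.Properties as ℕₚ
open import Data.Nat.Coprimality using (Coprime; coprime-divisor)
open import Data.Nat.Divisibility as ∣ using (_∣_; _∣?_; divides)
open import Data.Nat.GCD using (gcd; gcd[m,n]∣m; gcd[m,n]∣n; gcd-GCD; gcd[m,n]≢0; module Bézout)
open import Data.Nat.Induction using (<-rec)
open import Data.Integer as ℤ using (ℤ; +_; -[1+_]; 0ℤ; 1ℤ; -1ℤ)
open import Data.Integer.Divisibility as ℤ∣ using ()
import Data.Integer.Divisibility.Signed as ∣ₛ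
import Data.Integer.DivMod as ℤ÷
import Data.Integer.Properties as ℤₚ
import Data.Integer.Solver
open import Data.List using (List; []; _∷_; map; length; foldr; _++_; applyUpTo)
open import Data.List.Properties using (map-cong-local)
open import Data.List.Membership.Propositional using (_∈_)
open import Data.List.Membership.Propositional.Properties
  using (∈-filter⁺; ∈-filter⁻; ∈-applyUpTo⁺; ∈-applyUpTo⁻; ∈-∃++; ∈-++⁺ˡ; ∈-++⁺ʳ; ∈-++⁻)
open import Data.List.Relation.Unary.All as All using (All; []; _∷_)
open import Data.List.Relation.Unary.AllPairs using (AllPairs; []; _∷_)
open import Data.List.Relation.Unary.Any using (here; there)
open import Data.List.Relation.Unary.Unique.Propositional using (Unique)
import Data.List.Relation.Unary.Unique.Propositional.Properties as Unique
open import Data.Maybe using (Maybe; just; nothing)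
open import Data.Product using (_×_; _,_; proj₁; proj₂; ∃-syntax)
open import Data.Sum using (inj₁; inj₂)
open import Function using (case_of_)
open import Relation.Nullary using (¬_; yes; no; contradiction; Dec)
open import Relation.Binary.PropositionalEquality as ≡ using (_≡_; _≢_; cong; cong₂)
import Relation.Binary.Reasoning.Setoid

-- The two perturbing parameters `x` and `1/x` have product 1, so each factor moves only to second
-- order in `1 - x`; in the q-series argument the modulus therefore enters only through
-- `P ∣ (1 - x)²` and through coprimality. The transformation is an instance of Bailey's lemma: `t`
-- encodes a Bailey pair relative to `a`, the WZ recurrence sums it, and q-Chu-Vandermonde gives the
-- conjugate pair. The case `m = 0` stands apart because then `a = x`: neither `1 - a` nor `1 + u`
-- is a unit, and pairing `k` with `n - k` has to supply a missing factor `1 + u`. On the polynomial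
-- side the obstacle is that coprimality is known only over ℚ, while `Φ` is computed by power series
-- division over ℤ. Nonzero integer constants are carried through the Bézout identities and
-- cancelled only at the end, where the constant term ±1 of the divisor makes the division exact.

module ℤ-Solver = Data.Integer.Solver.+-*-Solver

-- Algebra in an arbitrary commutative ring

module RingKit (R : CommutativeRing 0ℓ 0ℓ) where
  open CommutativeRing R public renaming (Carrier to C; zero to *-zero)
  open import Algebra.Properties.Ring ring public using (-‿distribˡ-*; -‿distribʳ-*; -0#≈0#; -‿+-comm; -‿involutive)
  open import Algebra.Properties.Semiring.Mult.TCOptimised semiring using (1+×; ×-homo-+; ×1-homo-*) renaming (_×_ to _·_)
  module ≈-Reasoning = Relation.Binary.Reasoning.Setoid setoid
  open ≈-Reasoning

  -- Integer coefficients give the ring solver decidable cancellation although equality in `C` need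
  -- not be decidable. With the optimised multiple, `1ℤ` goes to `1#` definitionally, so `con 1ℤ`
  -- matches the goals as written.
  ⟦_⟧ℤ : ℤ → C
  ⟦ + n ⟧ℤ = n · 1#
  ⟦ -[1+ n ] ⟧ℤ = - (suc n · 1#)

  neg-homo : ∀ i → ⟦ ℤ.- i ⟧ℤ ≈ - ⟦ i ⟧ℤ
  neg-homo (+ zero) = sym -0#≈0#
  neg-homo (+ suc n) = refl
  neg-homo -[1+ n ] = sym (-‿involutive _)

  cancel-1 : ∀ x y → (1# + x) - (1# + y) ≈ x - y
  cancel-1 x y = begin
    (1# + x) - (1# + y)        ≈⟨ +-congˡ (-‿+-comm 1# y) ⟨
    (1# + x) + (- 1# + - y)    ≈⟨ +-congʳ (+-comm 1# x) ⟩
    (x + 1#) + (- 1# + - y)    ≈⟨ +-assoc x 1# _ ⟩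
    x + (1# + (- 1# + - y))    ≈⟨ +-congˡ (+-assoc 1# _ _) ⟨
    x + ((1# - 1#) + - y)      ≈⟨ +-congˡ (+-congʳ (-‿inverseʳ 1#)) ⟩
    x + (0# + - y)             ≈⟨ +-congˡ (+-identityˡ _) ⟩
    x - y                      ∎

  ⊖-homo : ∀ m n → ⟦ m ℤ.⊖ n ⟧ℤ ≈ m · 1# - n · 1#
  ⊖-homo zero zero = sym (-‿inverseʳ 0#)
  ⊖-homo (suc m) zero = sym (trans (+-congˡ -0#≈0#) (+-identityʳ _))
  ⊖-homo zero (suc n) = sym (+-identityˡ _)
  ⊖-homo (suc m) (suc n) = begin
    ⟦ suc m ℤ.⊖ suc n ⟧ℤ            ≡⟨ ≡.cong ⟦_⟧ℤ (ℤₚ.[1+m]⊖[1+n]≡m⊖n m n) ⟩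
    ⟦ m ℤ.⊖ n ⟧ℤ                    ≈⟨ ⊖-homo m n ⟩
    m · 1# - n · 1#                 ≈⟨ cancel-1 _ _ ⟨
    (1# + m · 1#) - (1# + n · 1#)   ≈⟨ +-cong (1+× m 1#) (-‿cong (1+× n 1#)) ⟨
    suc m · 1# - suc n · 1#         ∎

  +-homo : ∀ i j → ⟦ i ℤ.+ j ⟧ℤ ≈ ⟦ i ⟧ℤ + ⟦ j ⟧ℤ
  +-homo (+ m) (+ n) = ×-homo-+ 1# m n
  +-homo (+ m) -[1+ n ] = ⊖-homo m (suc n)
  +-homo -[1+ m ] (+ n) = trans (⊖-homo n (suc m)) (+-comm _ _)
  +-homo -[1+ m ] -[1+ n ] = begin
    - (suc (suc (m ℕ.+ n)) · 1#)        ≡⟨ ≡.cong (λ k → - (suc k · 1#)) (ℕₚ.+-suc m n) ⟨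
    - ((suc m ℕ.+ suc n) · 1#)          ≈⟨ -‿cong (×-homo-+ 1# (suc m) (suc n)) ⟩
    - (suc m · 1# + suc n · 1#)         ≈⟨ -‿+-comm _ _ ⟨
    - (suc m · 1#) + - (suc n · 1#)     ∎

  private
    pos-* : ∀ m n → ⟦ + m ℤ.* + n ⟧ℤ ≈ (m · 1#) * (n · 1#)
    pos-* m n = trans (reflexive (≡.cong ⟦_⟧ℤ (≡.sym (ℤₚ.pos-* m n)))) (×1-homo-* m n)

  *-homo : ∀ i j → ⟦ i ℤ.* j ⟧ℤ ≈ ⟦ i ⟧ℤ * ⟦ j ⟧ℤ
  *-homo (+ m) (+ n) = pos-* m n
  *-homo (+ m) -[1+ n ] = begin
    ⟦ + m ℤ.* -[1+ n ] ⟧ℤ             ≡⟨ ≡.cong ⟦_⟧ℤ (ℤₚ.neg-distribʳ-* (+ m) (+ suc n)) ⟨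
    ⟦ ℤ.- (+ m ℤ.* + suc n) ⟧ℤ        ≈⟨ neg-homo (+ m ℤ.* + suc n) ⟩
    - ⟦ + m ℤ.* + suc n ⟧ℤ            ≈⟨ -‿cong (pos-* m (suc n)) ⟩
    - ((m · 1#) * (suc n · 1#))       ≈⟨ -‿distribʳ-* _ _ ⟩
    (m · 1#) * - (suc n · 1#)         ∎
  *-homo -[1+ m ] (+ n) = begin
    ⟦ -[1+ m ] ℤ.* + n ⟧ℤ             ≡⟨ ≡.cong ⟦_⟧ℤ (ℤₚ.neg-distribˡ-* (+ suc m) (+ n)) ⟨
    ⟦ ℤ.- (+ suc m ℤ.* + n) ⟧ℤ        ≈⟨ neg-homo (+ suc m ℤ.* + n) ⟩
    - ⟦ + suc m ℤ.* + n ⟧ℤ            ≈⟨ -‿cong (pos-* (suc m) n) ⟩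
    - ((suc m · 1#) * (n · 1#))       ≈⟨ -‿distribˡ-* _ _ ⟩
    - (suc m · 1#) * (n · 1#)         ∎
  *-homo -[1+ m ] -[1+ n ] = begin
    ⟦ -[1+ m ] ℤ.* -[1+ n ] ⟧ℤ           ≈⟨ pos-* (suc m) (suc n) ⟩
    (suc m · 1#) * (suc n · 1#)          ≈⟨ -‿involutive _ ⟨
    - - ((suc m · 1#) * (suc n · 1#))    ≈⟨ -‿cong (-‿distribˡ-* _ _) ⟩
    - (- (suc m · 1#) * (suc n · 1#))    ≈⟨ -‿distribʳ-* _ _ ⟩
    - (suc m · 1#) * - (suc n · 1#)      ∎

  private
    acr = ACR.fromCommutativeRing R

    morphism : ℤ.+-*-rawRing ACR.-Raw-AlmostCommutative⟶ acr
    morphism = record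
      { ⟦_⟧ = ⟦_⟧ℤ ; +-homo = +-homo ; *-homo = *-homo ; -‿homo = neg-homo
      ; 0-homo = refl ; 1-homo = refl }

    _coeff≟_ : ∀ i j → Maybe (⟦ i ⟧ℤ ≈ ⟦ j ⟧ℤ)
    i coeff≟ j with i ℤ.≟ j
    ... | yes i≡j = just (reflexive (≡.cong ⟦_⟧ℤ i≡j))
    ... | no _ = nothing

  open Algebra.Solver.Ring ℤ.+-*-rawRing acr morphism _coeff≟_ public
    using (solve; _:=_; _:+_; _:*_; _:-_; :-_; con)

-- Linear combinations of hypotheses, finite sums and powers

module Sums (R : CommutativeRing 0ℓ 0ℓ) where
  open RingKit R
  open ≈-Reasoning

  private
    vanish : ∀ {p q} c → p ≈ q → c * (p - q) ≈ 0#
    vanish c p≈q = trans (*-congˡ (trans (+-congʳ p≈q) (-‿inverseʳ _))) (zeroʳ c)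

  -- L ≈ R follows from hypotheses pᵢ ≈ qᵢ by exhibiting L = R + Σ cᵢ (pᵢ - qᵢ) as a ring identity.
  lc₁ : ∀ {l r p q} c → p ≈ q → l ≈ r + c * (p - q) → l ≈ r
  lc₁ c h e = trans e (trans (+-congˡ (vanish c h)) (+-identityʳ _))

  lc₂ : ∀ {l r p q p′ q′} c c′ → p ≈ q → p′ ≈ q′ → l ≈ r + c * (p - q) + c′ * (p′ - q′) → l ≈ r
  lc₂ c c′ h h′ e = lc₁ c h (lc₁ c′ h′ e)

  lc₃ : ∀ {l r p q p′ q′ p″ q″} c c′ c″ → p ≈ q → p′ ≈ q′ → p″ ≈ q″ →
        l ≈ r + c * (p - q) + c′ * (p′ - q′) + c″ * (p″ - q″) → l ≈ r
  lc₃ c c′ c″ h h′ h″ e = lc₂ c c′ h h′ (lc₁ c″ h″ e)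

  ∑ : ℕ → (ℕ → C) → C
  ∑ zero f = 0#
  ∑ (suc n) f = ∑ n f + f n

  ∑-cong : ∀ n {f g} → (∀ i → i < n → f i ≈ g i) → ∑ n f ≈ ∑ n g
  ∑-cong zero h = refl
  ∑-cong (suc n) h = +-cong (∑-cong n (λ i i<n → h i (ℕₚ.m≤n⇒m≤1+n i<n))) (h n ℕₚ.≤-refl)

  ∑-+ : ∀ n f g → ∑ n (λ i → f i + g i) ≈ ∑ n f + ∑ n g
  ∑-+ zero f g = sym (+-identityˡ 0#)
  ∑-+ (suc n) f g = trans (+-congʳ (∑-+ n f g))
    (solve 4 (λ a b c d → a :+ b :+ (c :+ d) := a :+ c :+ (b :+ d)) refl _ _ _ _)

  ∑-*ˡ : ∀ n c f → ∑ n (λ i → c * f i) ≈ c * ∑ n f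
  ∑-*ˡ zero c f = sym (zeroʳ c)
  ∑-*ˡ (suc n) c f = trans (+-congʳ (∑-*ˡ n c f)) (sym (distribˡ c _ _))

  ∑-lin : ∀ n c d f g → ∑ n (λ i → c * f i - d * g i) ≈ c * ∑ n f - d * ∑ n g
  ∑-lin zero c d f g = solve 2 (λ c d → con 0ℤ := c :* con 0ℤ :- d :* con 0ℤ) refl c d
  ∑-lin (suc n) c d f g = trans (+-congʳ (∑-lin n c d f g))
    (solve 6 (λ c d a b x y → c :* a :- d :* b :+ (c :* x :- d :* y) := c :* (a :+ x) :- d :* (b :+ y))
      refl c d _ _ _ _)

  ∑-head : ∀ n f → ∑ (suc n) f ≈ f 0 + ∑ n (λ i → f (suc i))
  ∑-head zero f = +-comm _ _
  ∑-head (suc n) f = trans (+-congʳ (∑-head n f)) (+-assoc _ _ _)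

  -- Passing from `n` to `suc n` adds the antidiagonal `j + i = n` on the left and one entry to
  -- every row on the right.
  ∑-triangle : ∀ n (f : ℕ → ℕ → C) →
    ∑ n (λ k → ∑ (suc k) (λ j → f j (k ∸ j))) ≈ ∑ n (λ j → ∑ (n ∸ j) (f j))
  ∑-triangle zero f = refl
  ∑-triangle (suc n) f = begin
    ∑ n (λ k → ∑ (suc k) (λ j → f j (k ∸ j))) + (∑ n (λ j → f j (n ∸ j)) + f n (n ∸ n))
      ≈⟨ +-congʳ (∑-triangle n f) ⟩
    ∑ n (λ j → ∑ (n ∸ j) (f j)) + (∑ n (λ j → f j (n ∸ j)) + f n (n ∸ n))
      ≈⟨ +-assoc _ _ _ ⟨
    ∑ n (λ j → ∑ (n ∸ j) (f j)) + ∑ n (λ j → f j (n ∸ j)) + f n (n ∸ n)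
      ≈⟨ +-cong (∑-+ n _ _) (diag n) ⟨
    ∑ n (λ j → ∑ (suc (n ∸ j)) (f j)) + ∑ (suc n ∸ n) (f n)
      ≈⟨ +-congʳ (∑-cong n (λ j j<n → reflexive (≡.cong (λ k → ∑ k (f j)) (ℕₚ.+-∸-assoc 1 (ℕₚ.<⇒≤ j<n))))) ⟨
    ∑ n (λ j → ∑ (suc n ∸ j) (f j)) + ∑ (suc n ∸ n) (f n) ∎
    where
    diag : ∀ k → ∑ (suc k ∸ k) (f n) ≈ f n (k ∸ k)
    diag zero = +-identityˡ _
    diag (suc k) = diag k

  pw : C → ℕ → C
  pw x zero = 1#
  pw x (suc k) = pw x k * x

  pw-cong : ∀ k {x y} → x ≈ y → pw x k ≈ pw y k
  pw-cong zero h = refl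
  pw-cong (suc k) h = *-cong (pw-cong k h) h

  pw-+ : ∀ x k i → pw x (k ℕ.+ i) ≈ pw x k * pw x i
  pw-+ x zero i = sym (*-identityˡ _)
  pw-+ x (suc k) i = trans (*-congʳ (pw-+ x k i)) (solve 3 (λ a b c → a :* b :* c := a :* c :* b) refl _ _ x)

  pw-* : ∀ x y k → pw (x * y) k ≈ pw x k * pw y k
  pw-* x y zero = sym (*-identityˡ _)
  pw-* x y (suc k) = trans (*-congʳ (pw-* x y k))
    (solve 4 (λ a b c d → a :* b :* (c :* d) := a :* c :* (b :* d)) refl _ _ x y)

-- Shifted factorials and the q-Chu-Vandermonde sum

module QSeries (R : CommutativeRing 0ℓ 0ℓ) (Q : CommutativeRing.Carrier R) where
  open RingKit R
  open Sums R
  open ≈-Reasoning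

  poch : C → ℕ → C
  poch a zero = 1#
  poch a (suc k) = poch a k * (1# - a * pw Q k)

  poch-cong : ∀ k {a b} → a ≈ b → poch a k ≈ poch b k
  poch-cong zero h = refl
  poch-cong (suc k) h = *-cong (poch-cong k h) (+-congˡ (-‿cong (*-congʳ h)))

  poch-+ : ∀ a k i → poch a (k ℕ.+ i) ≈ poch a k * poch (a * pw Q k) i
  poch-+ a k zero = trans (reflexive (≡.cong (poch a) (ℕₚ.+-identityʳ k))) (sym (*-identityʳ _))
  poch-+ a k (suc i) = begin
    poch a (k ℕ.+ suc i) ≡⟨ ≡.cong (poch a) (ℕₚ.+-suc k i) ⟩
    poch a (k ℕ.+ i) * (1# - a * pw Q (k ℕ.+ i)) ≈⟨ *-cong (poch-+ a k i) (+-congˡ (-‿cong (*-congˡ (pw-+ Q k i)))) ⟩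
    poch a k * poch (a * pw Q k) i * (1# - a * (pw Q k * pw Q i))
      ≈⟨ solve 5 (λ p q a k i → p :* q :* (con 1ℤ :- a :* (k :* i)) := p :* (q :* (con 1ℤ :- a :* k :* i))) refl _ _ a _ _ ⟩
    poch a k * (poch (a * pw Q k) i * (1# - a * pw Q k * pw Q i)) ∎

  poch-head : ∀ a k → poch a (suc k) ≈ (1# - a) * poch (a * Q) k
  poch-head a zero = solve 1 (λ a → con 1ℤ :* (con 1ℤ :- a :* con 1ℤ) := (con 1ℤ :- a) :* con 1ℤ) refl a
  poch-head a (suc k) = trans (*-congʳ (poch-head a k))
    (solve 4 (λ a p q k → (con 1ℤ :- a) :* p :* (con 1ℤ :- a :* (k :* q)) := (con 1ℤ :- a) :* (p :* (con 1ℤ :- a :* q :* k))) refl a _ Q _)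

  -- σ n i is the coefficient of zⁱ in (z; Q)ₙ.
  σ : ℕ → ℕ → C
  σ n zero = 1#
  σ zero (suc i) = 0#
  σ (suc n) (suc i) = σ n (suc i) - pw Q n * σ n i

  σ-zero : ∀ n i → n < i → σ n i ≈ 0#
  σ-zero zero (suc i) _ = refl
  σ-zero (suc n) (suc i) (s≤s n<i) = trans
    (+-cong (σ-zero n (suc i) (ℕₚ.m≤n⇒m≤1+n n<i)) (-‿cong (*-congˡ (σ-zero n i n<i))))
    (solve 1 (λ x → con 0ℤ :- x :* con 0ℤ := con 0ℤ) refl _)

  -- A form of the q-Chu–Vandermonde sum; the induction on n uses it at b and at b Q.
  chuVandermonde : ∀ n e b →
    ∑ (suc n) (λ i → σ n i * pw e i * poch b i * poch (b * e * pw Q i) (n ∸ i)) ≈ poch e n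
  chuVandermonde zero e b = solve 0 (con 0ℤ :+ con 1ℤ :* con 1ℤ :* con 1ℤ :* con 1ℤ := con 1ℤ) refl
  chuVandermonde (suc n) e b = begin
    ∑ (suc (suc n)) (T (suc n) (suc n) b) ≈⟨ ∑-head (suc n) _ ⟩
    T (suc n) (suc n) b 0 + ∑ (suc n) (λ i → T (suc n) (suc n) b (suc i))
      ≈⟨ +-congˡ (trans (∑-cong (suc n) (λ i _ → pascal i)) (∑-lin (suc n) 1# (pw Q n * e * (1# - b)) _ _)) ⟩
    T n (suc n) b 0 + (1# * ∑ (suc n) (λ i → T n (suc n) b (suc i)) - pw Q n * e * (1# - b) * ∑ (suc n) (T n n (b * Q)))
      ≈⟨ solve 4 (λ a b c d → a :+ (con 1ℤ :* b :- c :* d) := (a :+ b) :- c :* d) refl _ _ _ _ ⟩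
    T n (suc n) b 0 + ∑ (suc n) (λ i → T n (suc n) b (suc i)) - pw Q n * e * (1# - b) * ∑ (suc n) (T n n (b * Q))
      ≈⟨ +-cong (trans (sym (∑-head (suc n) (T n (suc n) b))) full) (-‿cong (*-congˡ (chuVandermonde n e (b * Q)))) ⟩
    (1# - b * e * pw Q n) * poch e n - pw Q n * e * (1# - b) * poch e n
      ≈⟨ solve 4 (λ b e q p → (con 1ℤ :- b :* e :* q) :* p :- q :* e :* (con 1ℤ :- b) :* p := p :* (con 1ℤ :- e :* q)) refl b e _ _ ⟩
    poch e n * (1# - e * pw Q n) ∎
    where
    -- The index of `σ` and the length `N` of the last factorial are separate arguments because
    -- Pascal's rule lowers the first and leaves the second.
    T : ℕ → ℕ → C → ℕ → C
    T n N b i = σ n i * pw e i * poch b i * poch (b * e * pw Q i) (N ∸ i)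
    pascal : ∀ i → T (suc n) (suc n) b (suc i) ≈ 1# * T n (suc n) b (suc i) - pw Q n * e * (1# - b) * T n n (b * Q) i
    pascal i = trans
      (*-cong (*-congˡ (poch-head b i)) shift)
      (trans (solve 8 (λ s q t p e b d z → (s :- q :* t) :* (p :* e) :* ((con 1ℤ :- b) :* d) :* z :=
                  con 1ℤ :* (s :* (p :* e) :* ((con 1ℤ :- b) :* d) :* z) :- q :* e :* (con 1ℤ :- b) :* (t :* p :* d :* z)) refl _ _ _ _ e b _ _)
        (+-congʳ (*-congˡ (sym (*-cong (*-congˡ (poch-head b i)) shift)))))
      where
      shift : poch (b * e * (pw Q i * Q)) (n ∸ i) ≈ poch (b * Q * e * pw Q i) (n ∸ i)
      shift = poch-cong (n ∸ i) (solve 4 (λ b e p q → b :* e :* (p :* q) := b :* q :* e :* p) refl b e _ Q)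
    -- Lengthening the last factorial by one multiplies every term by the same factor `1 - b e Q^n`,
    -- and the extra term dies with `σ n (suc n)`.
    full : ∑ (suc (suc n)) (T n (suc n) b) ≈ (1# - b * e * pw Q n) * poch e n
    full = begin
      ∑ (suc n) (T n (suc n) b) + T n (suc n) b (suc n)
        ≈⟨ +-cong (∑-cong (suc n) last) (*-congʳ (*-congʳ (*-congʳ (σ-zero n (suc n) ℕₚ.≤-refl)))) ⟩
      ∑ (suc n) (λ i → (1# - b * e * pw Q n) * T n n b i) + 0# * _ * _ * _
        ≈⟨ +-cong (∑-*ˡ (suc n) _ _) (solve 3 (λ x y z → con 0ℤ :* x :* y :* z := con 0ℤ) refl _ _ _) ⟩
      (1# - b * e * pw Q n) * ∑ (suc n) (T n n b) + 0# ≈⟨ +-identityʳ _ ⟩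
      (1# - b * e * pw Q n) * ∑ (suc n) (T n n b) ≈⟨ *-congˡ (chuVandermonde n e b) ⟩
      (1# - b * e * pw Q n) * poch e n ∎
      where
      last : ∀ i → i < suc n → T n (suc n) b i ≈ (1# - b * e * pw Q n) * T n n b i
      last i (s≤s i≤n) = begin
        σ n i * pw e i * poch b i * poch (b * e * pw Q i) (suc n ∸ i)
          ≡⟨ ≡.cong (λ k → σ n i * pw e i * poch b i * poch (b * e * pw Q i) k) (ℕₚ.+-∸-assoc 1 i≤n) ⟩
        σ n i * pw e i * poch b i * (poch (b * e * pw Q i) (n ∸ i) * (1# - b * e * pw Q i * pw Q (n ∸ i)))
          ≈⟨ *-congˡ (*-congˡ (+-congˡ (-‿cong (trans (*-assoc _ _ _) (*-congˡ (trans (sym (pw-+ Q i (n ∸ i))) (reflexive (≡.cong (pw Q) (ℕₚ.m+[n∸m]≡n i≤n))))))))) ⟩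
        σ n i * pw e i * poch b i * (poch (b * e * pw Q i) (n ∸ i) * (1# - b * e * pw Q n))
          ≈⟨ solve 3 (λ s p r → s :* (p :* r) := r :* (s :* p)) refl _ _ _ ⟩
        (1# - b * e * pw Q n) * T n n b i ∎

  -- This is `Q^(n i) (Q^(-n); Q)ᵢ`, written without negative powers of `Q`.
  π : ℕ → ℕ → C
  π n zero = 1#
  π n (suc i) = π n i * (pw Q n - pw Q i)

  private
    π-zero : ∀ i → π 0 (suc i) ≈ 0#
    π-zero zero = solve 0 (con 1ℤ :* (con 1ℤ :- con 1ℤ) := con 0ℤ) refl
    π-zero (suc i) = trans (*-congʳ (π-zero i)) (zeroˡ _)

    π-suc : ∀ n i → π (suc n) (suc i) ≈ (pw Q (suc n) - 1#) * pw Q i * π n i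
    π-suc n zero = solve 1 (λ q → con 1ℤ :* (q :- con 1ℤ) := (q :- con 1ℤ) :* con 1ℤ :* con 1ℤ) refl _
    π-suc n (suc i) = trans (*-congʳ (π-suc n i))
      (solve 4 (λ p q s n → (n :* q :- con 1ℤ) :* p :* s :* (n :* q :- p :* q) := (n :* q :- con 1ℤ) :* (p :* q) :* (s :* (n :- p))) refl _ Q _ _)

  -- Identifies `σ n i` with `(-1)^i Q^(i(i-1)/2)` times a Gaussian binomial coefficient without
  -- dividing: both sides obey the Pascal recursion.
  σ-π : ∀ n i → σ n i * poch Q i ≈ π n i
  σ-π zero zero = *-identityˡ _
  σ-π (suc n) zero = *-identityˡ _
  σ-π zero (suc i) = trans (zeroˡ _) (sym (π-zero i))
  σ-π (suc n) (suc i) = trans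
    (lc₂ 1# (- (pw Q n * (1# - Q * pw Q i))) (σ-π n (suc i)) (σ-π n i)
      (solve 7 (λ s t c n q i w → (s :- n :* t) :* (c :* (con 1ℤ :- q :* i)) :=
          (n :* q :- con 1ℤ) :* i :* w :+ con 1ℤ :* (s :* (c :* (con 1ℤ :- q :* i)) :- w :* (n :- i))
            :+ (:- (n :* (con 1ℤ :- q :* i))) :* (t :* c :- w)) refl _ _ _ _ Q _ _))
    (sym (π-suc n i))

  π-+ : ∀ k n i → π (k ℕ.+ n) (k ℕ.+ i) ≈ π (k ℕ.+ n) k * pw (pw Q k) i * π n i
  π-+ k n zero = trans (reflexive (≡.cong (π (k ℕ.+ n)) (ℕₚ.+-identityʳ k)))
    (solve 1 (λ p → p := p :* con 1ℤ :* con 1ℤ) refl _)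
  π-+ k n (suc i) = begin
    π (k ℕ.+ n) (k ℕ.+ suc i) ≡⟨ ≡.cong (π (k ℕ.+ n)) (ℕₚ.+-suc k i) ⟩
    π (k ℕ.+ n) (k ℕ.+ i) * (pw Q (k ℕ.+ n) - pw Q (k ℕ.+ i)) ≈⟨ *-cong (π-+ k n i) (+-cong (pw-+ Q k n) (-‿cong (pw-+ Q k i))) ⟩
    π (k ℕ.+ n) k * pw (pw Q k) i * π n i * (pw Q k * pw Q n - pw Q k * pw Q i)
      ≈⟨ solve 6 (λ a b c k n i → a :* b :* c :* (k :* n :- k :* i) := a :* (b :* k) :* (c :* (n :- i))) refl _ _ _ _ _ _ ⟩
    π (k ℕ.+ n) k * (pw (pw Q k) i * pw Q k) * (π n i * (pw Q n - pw Q i)) ∎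

  -- `ω v k = (-1)^k Q^(k(k+1)/2) v^k`, the sign and power of `q` in `c(k)`.
  ω : C → ℕ → C
  ω v zero = 1#
  ω v (suc k) = - (ω v k * (pw Q k * Q) * v)

  -- The limiting Watson transformation, by way of a Bailey pair

  module Transformation (u : C) (iQ iA : ℕ → C)
    (iQ-0 : iQ 0 ≈ 1#) (iQ-suc : ∀ i → iQ i ≈ iQ (suc i) * (1# - Q * pw Q i))
    (iA-0 : iA 0 ≈ 1#) (iA-suc : ∀ i → iA i ≈ iA (suc i) * (1# - u * u * pw Q i)) where

    -- `φ k = (-1)^k Q^(k(k-1)/2) u^k`.
    φ : ℕ → C
    φ zero = 1#
    φ (suc k) = - (φ k * pw Q k * u)

    -- Summand of a Bailey pair relative to `a = u²`: `iA (suc (j + k))` stands for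
    -- `1 / ((1 - a) (a Q; Q)ⱼ₊ₖ)`. Reciprocal factorials enter as sequences with a recurrence,
    -- which keeps all identities polynomial.
    t : ℕ → ℕ → C
    t j k = φ k * (1# + u * pw Q k) * iQ (j ∸ k) * iA (suc (j ℕ.+ k))

    private
      t-eval : ∀ j k i → j ≡ k ℕ.+ i → t j k ≈ φ k * (1# + u * pw Q k) * iQ i * iA (suc (j ℕ.+ k))
      t-eval j k i ≡.refl = reflexive (≡.cong (λ l → φ k * (1# + u * pw Q k) * iQ l * iA (suc (j ℕ.+ k))) (ℕₚ.m+n∸m≡n k i))

      -- The first-order recurrence in j of ∑ₖ t j k, telescoped (WZ method).
      telescope : ∀ j k i → j ≡ k ℕ.+ i →
        ∑ (suc k) (λ l → (1# - u * pw Q (suc j)) * (1# - Q * pw Q j) * (1# - u * u * pw Q j) * t (suc j) l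
                          - (1# - u * pw Q j) * t j l)
        ≈ u * φ k * pw Q j * (1# - Q * pw Q k) * (1# - u * u * pw Q k) * iQ i * iA (suc (suc (j ℕ.+ k)))
      telescope j zero .j ≡.refl = trans
        (+-congˡ (+-cong (*-congˡ (t-eval (suc j) 0 (suc j) ≡.refl)) (-‿cong (*-congˡ (t-eval j 0 j ≡.refl)))))
        (trans (+-congˡ (+-cong (*-congˡ (*-congˡ (reflexive (≡.cong (λ i → iA (suc (suc i))) eq)))) (-‿cong (*-congˡ (*-congˡ (trans (reflexive (≡.cong (λ i → iA (suc i)) eq)) (iA-suc (suc j))))))))
        (trans
        (lc₁ (- ((1# - u * (pw Q j * Q)) * (1# - u * u * pw Q j) * (1# + u) * iA (suc (suc j)))) (iQ-suc j)
          (solve 6 (λ u q j x y z → let o = con 1ℤ in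
             con 0ℤ :+ ((o :- u :* (j :* q)) :* (o :- q :* j) :* (o :- u :* u :* j) :* (o :* (o :+ u :* o) :* y :* z) :-
                 (o :- u :* j) :* (o :* (o :+ u :* o) :* x :* (z :* (o :- u :* u :* (j :* q)))))
             := u :* o :* j :* (o :- q :* o) :* (o :- u :* u :* o) :* x :* z
                :+ (:- ((o :- u :* (j :* q)) :* (o :- u :* u :* j) :* (o :+ u) :* z)) :* (x :- y :* (o :- q :* j)))
             refl u Q (pw Q j) (iQ j) (iQ (suc j)) (iA (suc (suc j)))))
        (*-congˡ (reflexive (≡.cong (λ i → iA (suc (suc i))) (≡.sym eq))))))
        where
        eq : j ℕ.+ 0 ≡ j
        eq = ℕₚ.+-identityʳ j
      telescope j (suc k) i ≡.refl = begin
        ∑ (suc k) _ + (c₁ * t (suc j) (suc k) - c₂ * t j (suc k))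
          ≈⟨ +-cong (telescope j k (suc i) (≡.sym (ℕₚ.+-suc k i)))
               (+-cong (*-congˡ (t-eval (suc j) (suc k) (suc i) (≡.cong suc (≡.sym (ℕₚ.+-suc k i))))) (-‿cong (*-congˡ (t-eval j (suc k) i ≡.refl)))) ⟩
        u * φ k * pw Q j * (1# - Q * pw Q k) * (1# - u * u * pw Q k) * iQ (suc i) * iA (suc (suc (j ℕ.+ k)))
          + (c₁ * (φ (suc k) * (1# + u * pw Q (suc k)) * iQ (suc i) * iA (suc (suc (j ℕ.+ suc k))))
             - c₂ * (φ (suc k) * (1# + u * pw Q (suc k)) * iQ i * iA (suc (j ℕ.+ suc k))))
          ≈⟨ +-cong (*-congˡ (reflexive (≡.cong (λ l → iA (suc l)) (≡.sym (ℕₚ.+-suc j k))))) refl ⟩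
        u * φ k * pw Q j * (1# - Q * pw Q k) * (1# - u * u * pw Q k) * iQ (suc i) * iA (suc (j ℕ.+ suc k))
          + (c₁ * (φ (suc k) * (1# + u * pw Q (suc k)) * iQ (suc i) * iA (suc (suc (j ℕ.+ suc k))))
             - c₂ * (φ (suc k) * (1# + u * pw Q (suc k)) * iQ i * iA (suc (j ℕ.+ suc k))))
          ≈⟨ certificate u Q (pw Q k) (pw Q i) (pw Q j) (pw Q (suc (j ℕ.+ suc k))) (φ k) (iQ i) (iQ (suc i)) (iA (suc (j ℕ.+ suc k))) (iA (suc (suc (j ℕ.+ suc k))))
               J≈ L≈ (iQ-suc i) (iA-suc (suc (j ℕ.+ suc k))) ⟩
        u * φ (suc k) * pw Q j * (1# - Q * pw Q (suc k)) * (1# - u * u * pw Q (suc k)) * iQ i * iA (suc (suc (j ℕ.+ suc k))) ∎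
        where
        c₁ = (1# - u * pw Q (suc j)) * (1# - Q * pw Q j) * (1# - u * u * pw Q j)
        c₂ = 1# - u * pw Q j
        J≈ : pw Q j ≈ pw Q k * Q * pw Q i
        J≈ = pw-+ Q (suc k) i
        L≈ : pw Q (suc (j ℕ.+ suc k)) ≈ pw Q k * Q * pw Q i * (pw Q k * Q) * Q
        L≈ = *-congʳ (trans (pw-+ Q j (suc k)) (*-congʳ J≈))
        -- Stated for arbitrary elements so that, once `J`, `L`, `x` and `v` are substituted, the
        -- solver sees only the seven atoms `u`, `Q`, `K`, `M`, `f`, `y`, `z`.
        certificate : ∀ u Q K M J L f x y v z → J ≈ K * Q * M → L ≈ K * Q * M * (K * Q) * Q →
          x ≈ y * (1# - Q * M) → v ≈ z * (1# - u * u * L) →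
          u * f * J * (1# - Q * K) * (1# - u * u * K) * y * v
          + ((1# - u * (J * Q)) * (1# - Q * J) * (1# - u * u * J) * (- (f * K * u) * (1# + u * (K * Q)) * y * z)
             - (1# - u * J) * (- (f * K * u) * (1# + u * (K * Q)) * x * v))
          ≈ u * (- (f * K * u)) * J * (1# - Q * (K * Q)) * (1# - u * u * (K * Q)) * x * z
        certificate u Q K M J L f x y v z J≈ L≈ x≈ v≈ = trans
          (+-cong (*-cong (*-congʳ (*-congʳ (*-congʳ (*-congˡ J≈)))) v≈′)
             (+-cong (*-congʳ (*-cong (*-cong (+-congˡ (-‿cong (*-congˡ (*-congʳ J≈)))) (+-congˡ (-‿cong (*-congˡ J≈)))) (+-congˡ (-‿cong (*-congˡ J≈)))))
                (-‿cong (*-cong (+-congˡ (-‿cong (*-congˡ J≈))) (*-cong (*-congˡ x≈) v≈′)))))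
          (trans (solve 7 (λ u q k m f y z → let o = con 1ℤ ; j = k :* q :* m ; l = k :* q :* m :* (k :* q) :* q ; v = z :* (o :- u :* u :* l) ; x = y :* (o :- q :* m) in
             u :* f :* j :* (o :- q :* k) :* (o :- u :* u :* k) :* y :* v
             :+ ((o :- u :* (j :* q)) :* (o :- q :* j) :* (o :- u :* u :* j) :* ((:- (f :* k :* u)) :* (o :+ u :* (k :* q)) :* y :* z)
               :- (o :- u :* j) :* ((:- (f :* k :* u)) :* (o :+ u :* (k :* q)) :* x :* v))
             := u :* (:- (f :* k :* u)) :* j :* (o :- q :* (k :* q)) :* (o :- u :* u :* (k :* q)) :* x :* z) refl u Q K M f y z)
          (*-congʳ (*-cong (*-congʳ (*-congʳ (*-congˡ (sym J≈)))) (sym x≈))))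
          where
          v≈′ : v ≈ z * (1# - u * u * (K * Q * M * (K * Q) * Q))
          v≈′ = trans v≈ (*-congˡ (+-congˡ (-‿cong (*-congˡ L≈))))

    iQ-inverse : ∀ i → iQ i * poch Q i ≈ 1#
    iQ-inverse zero = trans (*-identityʳ _) iQ-0
    iQ-inverse (suc i) = trans (solve 3 (λ a b c → a :* (b :* c) := a :* c :* b) refl _ _ _)
      (trans (*-congʳ (sym (iQ-suc i))) (iQ-inverse i))

    iA-inverse : ∀ i → iA i * poch (u * u) i ≈ 1#
    iA-inverse zero = trans (*-identityʳ _) iA-0
    iA-inverse (suc i) = trans (solve 3 (λ a b c → a :* (b :* c) := a :* c :* b) refl _ _ _)
      (trans (*-congʳ (sym (iA-suc i))) (iA-inverse i))

    iA-+ : ∀ p i → iA p ≈ iA (p ℕ.+ i) * poch (u * u * pw Q p) i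
    iA-+ p zero = trans (reflexive (≡.cong iA (≡.sym (ℕₚ.+-identityʳ p)))) (sym (*-identityʳ _))
    iA-+ p (suc i) = begin
      iA p ≈⟨ iA-+ p i ⟩
      iA (p ℕ.+ i) * poch (u * u * pw Q p) i ≈⟨ *-congʳ (iA-suc (p ℕ.+ i)) ⟩
      iA (suc (p ℕ.+ i)) * (1# - u * u * pw Q (p ℕ.+ i)) * poch (u * u * pw Q p) i
        ≈⟨ *-congʳ (*-cong (reflexive (≡.cong iA (≡.sym (ℕₚ.+-suc p i)))) (+-congˡ (-‿cong (*-congˡ (pw-+ Q p i))))) ⟩
      iA (p ℕ.+ suc i) * (1# - u * u * (pw Q p * pw Q i)) * poch (u * u * pw Q p) i
        ≈⟨ solve 5 (λ x a p i y → x :* (con 1ℤ :- a :* (p :* i)) :* y := x :* (y :* (con 1ℤ :- a :* p :* i))) refl _ _ _ _ _ ⟩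
      iA (p ℕ.+ suc i) * (poch (u * u * pw Q p) i * (1# - u * u * pw Q p * pw Q i)) ∎

    private
      cancel : ∀ {p q s x y} → p * q ≈ s → s ≈ 1# → p * x ≈ p * y → x ≈ y
      cancel {p} {q} {s} {x} {y} pq s1 h = lc₂ (y - x) q (trans pq s1) h
        (solve 4 (λ p q x y → x := y :+ (y :- x) :* (p :* q :- con 1ℤ) :+ q :* (p :* x :- p :* y)) refl p q x y)

    -- Closed form of the Bailey pair. At `k = j` the telescoped remainder cancels against the new
    -- top term `t (suc j) (suc j)`, which leaves a first-order recurrence in `j` that the
    -- right-hand side also satisfies.
    ∑t : ∀ j → (1# - u * pw Q j) * ∑ (suc j) (t j) ≈ iQ j * iA j
    ∑t zero = trans (*-congˡ (+-congˡ (*-congʳ (*-congˡ iQ-0)))) (trans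
      (lc₁ (- 1#) (iA-suc 0)
        (solve 3 (λ u x y → let o = con 1ℤ in (o :- u :* o) :* (con 0ℤ :+ o :* (o :+ u :* o) :* o :* y) :=
           o :* x :+ (:- o) :* (x :- y :* (o :- u :* u :* o))) refl u _ _))
      (*-congʳ (sym iQ-0)))
    ∑t (suc j) = cancel unit (trans (*-cong (iQ-inverse (suc j)) (iA-inverse (suc j))) (*-identityˡ _)) (begin
      (1# - Q * J) * (1# - u * u * J) * ((1# - u * (J * Q)) * (X + t (suc j) (suc j)))
        ≈⟨ *-congˡ (*-congˡ (+-congˡ (t-eval (suc j) (suc j) 0 (≡.cong suc (≡.sym (ℕₚ.+-identityʳ j)))))) ⟩
      (1# - Q * J) * (1# - u * u * J) * ((1# - u * (J * Q)) * (X + - (φ j * J * u) * (1# + u * (J * Q)) * iQ 0 * iA (suc (suc (j ℕ.+ suc j)))))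
        -- The third relation trades `iA (2j+2)` for `(1 - u Q^(j+1)) (1 + u Q^(j+1)) iA (2j+3)`;
        -- this is what makes the boundary terms cancel.
        ≈⟨ lc₃ 1# 1# (u * φ j * J * (1# - Q * J) * (1# - u * u * J) * iQ 0)
             (trans (sym (∑-lin (suc j) c₁ (1# - u * J) (t (suc j)) (t j))) (telescope j j 0 (≡.sym (ℕₚ.+-identityʳ j))))
             (∑t j)
             (trans (iA-suc (suc (suc (j ℕ.+ j)))) (*-cong (reflexive (≡.cong (λ l → iA (suc (suc l))) (≡.sym (ℕₚ.+-suc j j)))) (+-congˡ (-‿cong (*-congˡ (*-congʳ (*-congʳ (pw-+ Q j j))))))))
             (solve 10 (λ u q j f x y iq ia v z → let o = con 1ℤ in
               (o :- q :* j) :* (o :- u :* u :* j) :* ((o :- u :* (j :* q)) :* (x :+ (:- (f :* j :* u)) :* (o :+ u :* (j :* q)) :* iq :* z))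
               := ia :+ o :* ((o :- u :* (j :* q)) :* (o :- q :* j) :* (o :- u :* u :* j) :* x :- (o :- u :* j) :* y
                               :- u :* f :* j :* (o :- q :* j) :* (o :- u :* u :* j) :* iq :* v)
                     :+ o :* ((o :- u :* j) :* y :- ia)
                     :+ u :* f :* j :* (o :- q :* j) :* (o :- u :* u :* j) :* iq :* (v :- z :* (o :- u :* u :* (j :* j :* q :* q))))
               refl u Q J (φ j) X (∑ (suc j) (t j)) (iQ 0) (iQ j * iA j) (iA (suc (suc (j ℕ.+ j)))) (iA (suc (suc (j ℕ.+ suc j))))) ⟩
      iQ j * iA j ≈⟨ *-cong (iQ-suc j) (iA-suc j) ⟩
      iQ (suc j) * (1# - Q * J) * (iA (suc j) * (1# - u * u * J))
        ≈⟨ solve 4 (λ a b c d → a :* b :* (c :* d) := b :* d :* (a :* c)) refl _ _ _ _ ⟩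
      (1# - Q * J) * (1# - u * u * J) * (iQ (suc j) * iA (suc j)) ∎)
      where
      J = pw Q j
      X = ∑ (suc j) (t (suc j))
      c₁ = (1# - u * (J * Q)) * (1# - Q * J) * (1# - u * u * J)
      unit : (1# - Q * J) * (1# - u * u * J) * (iQ (suc j) * poch Q j * (iA (suc j) * poch (u * u) j))
             ≈ iQ (suc j) * poch Q (suc j) * (iA (suc j) * poch (u * u) (suc j))
      unit = solve 6 (λ a b c d e f → a :* b :* (c :* d :* (e :* f)) := c :* (d :* a) :* (e :* (f :* b))) refl _ _ _ _ _ _

    module AtLevel (m : ℕ) (v x y : C) (iX iY : ℕ → C)
      (uv : u * v ≈ 1#) (x≈ : x ≈ u * u * pw Q m) (xy : x * y ≈ 1#)
      (iX-inverse : ∀ k → k ℕ.≤ m → iX k * poch (Q * x) k ≈ 1#) (iY-inverse : ∀ k → k ℕ.≤ m → iY k * poch (Q * y) k ≈ 1#) where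

      a = u * u

      -- The weights of the conjugate Bailey pair. The form with `π` suits q-Chu-Vandermonde;
      -- `E-eval` gives the form with `(a y; Q)ⱼ` that occurs in the perturbed sum.
      E : ℕ → C
      E j = poch (a * x) j * π m j * pw (Q * y) j

      α : ℕ → C
      α k = ω v k * (1# + u * pw Q k) * (poch (a * x) k * poch (a * y) k) * (iX k * iY k)

      private
        -- This is `a y = Q^(-m)`, the relation that stops the perturbed sum at `m`.
        Qᵐy : pw Q m * y ≈ v * v
        Qᵐy = lc₃ (- (pw Q m * y) * (u * v + 1#)) (- (v * v * y)) (v * v) uv x≈ xy
          (solve 5 (λ u v x y q → let o = con 1ℤ in
             q :* y := v :* v :+ (:- (q :* y)) :* (u :* v :+ o) :* (u :* v :- o) :+ (:- (v :* v :* y)) :* (x :- u :* u :* q)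
               :+ v :* v :* (x :* y :- o)) refl u v x y (pw Q m))

        π-y : ∀ k → π m k * pw y k ≈ pw (v * v) k * poch (a * y) k
        π-y zero = refl
        π-y (suc k) = lc₃ ((pw Q m - pw Q k) * y) (pw (v * v) k * poch (a * y) k)
            (pw (v * v) k * poch (a * y) k * (y * pw Q k * (u * v + 1#))) (π-y k) Qᵐy uv
          (solve 9 (λ u v y m k p z r s → let o = con 1ℤ in
              p :* (m :- k) :* (z :* y) := r :* (v :* v) :* (s :* (o :- u :* u :* y :* k)) :+ (m :- k) :* y :* (p :* z :- r :* s)
                :+ r :* s :* (m :* y :- v :* v) :+ r :* s :* (y :* k :* (u :* v :+ o)) :* (u :* v :- o))
            refl u v y (pw Q m) (pw Q k) (π m k) (pw y k) (pw (v * v) k) (poch (a * y) k))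

      E-eval : ∀ j → E j ≈ poch (a * x) j * poch (a * y) j * pw (Q * (v * v)) j
      E-eval j = trans (*-congˡ (pw-* Q y j)) (trans
        (lc₁ (poch (a * x) j * pw Q j) (π-y j)
          (solve 6 (λ p π q y v r → p :* π :* (q :* y) := p :* r :* (q :* v) :+ p :* q :* (π :* y :- v :* r)) refl _ _ _ _ _ _))
        (*-congˡ (sym (pw-* Q (v * v) j))))

      private
        -- The conjugate Bailey pair. With the factors depending on `k` alone pulled out, the sum is
        -- q-Chu-Vandermonde at `b = a x Q^k` and `e = Q y Q^k`; the last factorial fits because
        -- `x y = 1` gives `b e = a Q^(2k+1)`.
        inner : ∀ k n → m ≡ k ℕ.+ n →
          ∑ (suc n) (λ i → E (k ℕ.+ i) * (iQ i * iA (suc (k ℕ.+ i ℕ.+ k)))) ≈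
          poch (a * x) k * π m k * pw (Q * y) k * iA (suc (m ℕ.+ k)) * poch (Q * y * pw Q k) n
        inner k n eq = trans (∑-cong (suc n) term)
          (trans (∑-*ˡ (suc n) _ _) (*-congˡ (chuVandermonde n (Q * y * pw Q k) (a * x * pw Q k))))
          where
          K = pw Q k
          π-split : ∀ i → π m (k ℕ.+ i) ≈ π m k * pw K i * π n i
          π-split i = ≡.subst (λ l → π l (k ℕ.+ i) ≈ π l k * pw K i * π n i) (≡.sym eq) (π-+ k n i)
          index : ∀ i → i ℕ.≤ n → suc (k ℕ.+ i ℕ.+ k) ℕ.+ (n ∸ i) ≡ suc (m ℕ.+ k)
          index i i≤n = ≡.cong suc (≡.trans (ℕₚ.+-assoc (k ℕ.+ i) k (n ∸ i)) (≡.trans (≡.cong (k ℕ.+ i ℕ.+_) (ℕₚ.+-comm k (n ∸ i)))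
            (≡.trans (≡.sym (ℕₚ.+-assoc (k ℕ.+ i) (n ∸ i) k)) (≡.cong (ℕ._+ k)
              (≡.trans (ℕₚ.+-assoc k i (n ∸ i)) (≡.trans (≡.cong (k ℕ.+_) (ℕₚ.m+[n∸m]≡n i≤n)) (≡.sym eq)))))))
          term : ∀ i → i < suc n → E (k ℕ.+ i) * (iQ i * iA (suc (k ℕ.+ i ℕ.+ k))) ≈
            poch (a * x) k * π m k * pw (Q * y) k * iA (suc (m ℕ.+ k)) *
              (σ n i * pw (Q * y * K) i * poch (a * x * K) i * poch (a * x * K * (Q * y * K) * pw Q i) (n ∸ i))
          term i (s≤s i≤n) = begin
            E (k ℕ.+ i) * (iQ i * iA p)
              ≈⟨ *-cong (*-cong (*-cong (poch-+ (a * x) k i) (π-split i)) (pw-+ (Q * y) k i))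
                   (*-congˡ (trans (iA-+ p (n ∸ i)) (*-congʳ (reflexive (≡.cong iA (index i i≤n)))))) ⟩
            poch (a * x) k * poch (a * x * K) i * (π m k * pw K i * π n i) * (pw (Q * y) k * pw (Q * y) i)
              * (iQ i * (iA (suc (m ℕ.+ k)) * poch (a * pw Q p) (n ∸ i)))
              ≈⟨ *-cong (*-congʳ (*-congˡ (*-congˡ (sym (σ-π n i))))) (*-congˡ (*-congˡ (poch-cong (n ∸ i) arg))) ⟩
            poch (a * x) k * poch (a * x * K) i * (π m k * pw K i * (σ n i * poch Q i)) * (pw (Q * y) k * pw (Q * y) i)
              * (iQ i * (iA (suc (m ℕ.+ k)) * poch (a * x * K * (Q * y * K) * pw Q i) (n ∸ i)))
              ≈⟨ lc₁ (poch (a * x) k * poch (a * x * K) i * (π m k * pw K i * σ n i) * (pw (Q * y) k * pw (Q * y) i) * (iA (suc (m ℕ.+ k)) * poch (a * x * K * (Q * y * K) * pw Q i) (n ∸ i))) (iQ-inverse i)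
                (solve 11 (λ p r π k s q y z iq ia w → p :* r :* (π :* k :* (s :* q)) :* (y :* z) :* (iq :* (ia :* w)) :=
                   p :* π :* y :* ia :* (s :* (z :* k) :* r :* w) :+ p :* r :* (π :* k :* s) :* (y :* z) :* (ia :* w) :* (iq :* q :- con 1ℤ))
                  refl _ _ _ _ _ _ _ _ _ _ _) ⟩
            poch (a * x) k * π m k * pw (Q * y) k * iA (suc (m ℕ.+ k)) *
              (σ n i * (pw (Q * y) i * pw K i) * poch (a * x * K) i * poch (a * x * K * (Q * y * K) * pw Q i) (n ∸ i))
              ≈⟨ *-congˡ (*-congʳ (*-congʳ (*-congˡ (pw-* (Q * y) K i)))) ⟨
            _ ∎
            where
            p = suc (k ℕ.+ i ℕ.+ k)
            arg : a * pw Q p ≈ a * x * K * (Q * y * K) * pw Q i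
            arg = trans (*-congˡ (*-congʳ (trans (pw-+ Q (k ℕ.+ i) k) (*-congʳ (pw-+ Q k i)))))
              (lc₁ (- (a * K * K * Q * pw Q i)) xy
                (solve 6 (λ a x y k q i → a :* (k :* i :* k :* q) := a :* x :* k :* (q :* y :* k) :* i :+ (:- (a :* k :* k :* q :* i)) :* (x :* y :- con 1ℤ))
                  refl a x y K Q (pw Q i)))

        ω-φ : ∀ k → φ k * pw Q k * pw (v * v) k ≈ ω v k
        ω-φ zero = solve 0 (con 1ℤ :* con 1ℤ :* con 1ℤ := con 1ℤ) refl
        ω-φ (suc k) = lc₂ (- (pw Q k * Q * v)) (- (φ k * pw Q k * pw Q k * Q * pw (v * v) k * v)) (ω-φ k) uv
          (solve 7 (λ f k q u v r w → (:- (f :* k :* u)) :* (k :* q) :* (r :* (v :* v)) := (:- (w :* (k :* q) :* v))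
             :+ (:- (k :* q :* v)) :* (f :* k :* r :- w) :+ (:- (f :* k :* k :* q :* r :* v)) :* (u :* v :- con 1ℤ)) refl _ _ Q u v _ _)

      -- Bailey's interchange: on the triangle `k ≤ j ≤ m` the sum over `j` is taken first, where
      -- `inner` evaluates each column.
      transformation : ∑ (suc m) (λ j → E j * ∑ (suc j) (t j)) ≈ poch (Q * y) m * iA (suc m) * ∑ (suc m) α
      transformation = begin
        ∑ (suc m) (λ j → E j * ∑ (suc j) (t j)) ≈⟨ ∑-cong (suc m) (λ j _ → trans (sym (∑-*ˡ (suc j) _ _)) (∑-cong (suc j) (re j))) ⟩
        ∑ (suc m) (λ j → ∑ (suc j) (λ k → g k (j ∸ k))) ≈⟨ ∑-triangle (suc m) g ⟩
        ∑ (suc m) (λ k → ∑ (suc m ∸ k) (g k)) ≈⟨ ∑-cong (suc m) column ⟩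
        ∑ (suc m) (λ k → poch (Q * y) m * iA (suc m) * α k) ≈⟨ ∑-*ˡ (suc m) _ _ ⟩
        poch (Q * y) m * iA (suc m) * ∑ (suc m) α ∎
        where
        g : ℕ → ℕ → C
        g k i = E (k ℕ.+ i) * (φ k * (1# + u * pw Q k) * iQ i * iA (suc (k ℕ.+ i ℕ.+ k)))
        re : ∀ j k → k < suc j → E j * t j k ≈ g k (j ∸ k)
        re j k (s≤s k≤j) = reflexive (≡.cong (λ l → E l * (φ k * (1# + u * pw Q k) * iQ (j ∸ k) * iA (suc (l ℕ.+ k)))) (≡.sym (ℕₚ.m+[n∸m]≡n k≤j)))
        column : ∀ k → k < suc m → ∑ (suc m ∸ k) (g k) ≈ poch (Q * y) m * iA (suc m) * α k
        column k (s≤s k≤m) = begin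
          ∑ (suc m ∸ k) (g k) ≡⟨ ≡.cong (λ l → ∑ l (g k)) (ℕₚ.+-∸-assoc 1 k≤m) ⟩
          ∑ (suc n) (g k) ≈⟨ ∑-cong (suc n) (λ i _ → solve 4 (λ e f x y → e :* (f :* x :* y) := f :* (e :* (x :* y))) refl _ _ _ _) ⟩
          ∑ (suc n) (λ i → φ k * (1# + u * pw Q k) * (E (k ℕ.+ i) * (iQ i * iA (suc (k ℕ.+ i ℕ.+ k))))) ≈⟨ ∑-*ˡ (suc n) _ _ ⟩
          φ k * (1# + u * pw Q k) * ∑ (suc n) (λ i → E (k ℕ.+ i) * (iQ i * iA (suc (k ℕ.+ i ℕ.+ k)))) ≈⟨ *-congˡ (inner k n (≡.sym (ℕₚ.m+[n∸m]≡n k≤m))) ⟩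
          φ k * (1# + u * pw Q k) * (poch (a * x) k * π m k * pw (Q * y) k * iA (suc (m ℕ.+ k)) * poch (Q * y * pw Q k) n)
            ≈⟨ *-congˡ (*-cong (*-cong (E-eval k) iA-tail) poch-tail) ⟩
          φ k * (1# + u * pw Q k) * (poch (a * x) k * poch (a * y) k * pw (Q * (v * v)) k * (iA (suc m) * iX k) * (iY k * poch (Q * y) m))
            ≈⟨ *-congˡ (*-congʳ (*-congʳ (*-congˡ (pw-* Q (v * v) k)))) ⟩
          φ k * (1# + u * pw Q k) * (poch (a * x) k * poch (a * y) k * (pw Q k * pw (v * v) k) * (iA (suc m) * iX k) * (iY k * poch (Q * y) m))
            ≈⟨ lc₁ ((1# + u * pw Q k) * (poch (a * x) k * poch (a * y) k * (iA (suc m) * iX k) * (iY k * poch (Q * y) m))) (ω-φ k)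
                (solve 11 (λ f l p r q v ia ix iy z w → f :* l :* (p :* r :* (q :* v) :* (ia :* ix) :* (iy :* z)) :=
                   z :* ia :* (w :* l :* (p :* r) :* (ix :* iy)) :+ l :* (p :* r :* (ia :* ix) :* (iy :* z)) :* (f :* q :* v :- w)) refl _ _ _ _ _ _ _ _ _ _ _) ⟩
          poch (Q * y) m * iA (suc m) * α k ∎
          where
          n = m ∸ k
          solveFor : ∀ {p q r i} → p ≈ q * r → i * r ≈ 1# → q ≈ i * p
          solveFor {p} {q} {r} {i} h h′ = lc₂ (- i) (- q) h h′
            (solve 4 (λ p q r i → q := i :* p :+ (:- i) :* (p :- q :* r) :+ (:- q) :* (i :* r :- con 1ℤ)) refl p q r i)
          poch-tail : poch (Q * y * pw Q k) n ≈ iY k * poch (Q * y) m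
          poch-tail = solveFor (trans (reflexive (≡.cong (poch (Q * y)) (≡.sym (ℕₚ.m+[n∸m]≡n k≤m)))) (trans (poch-+ (Q * y) k n) (*-comm _ _))) (iY-inverse k k≤m)
          -- Since `a Q^(m+1) = Q x`, the factorial `(a; Q)` of length `m + 1 + k` splits as the one
          -- of length `m + 1` times `(Q x; Q)ₖ`.
          iA-tail : iA (suc (m ℕ.+ k)) ≈ iA (suc m) * iX k
          iA-tail = trans (solveFor (trans (iA-+ (suc m) k) (*-congˡ (poch-cong k arg))) (iX-inverse k k≤m)) (*-comm _ _)
            where
            arg : a * (pw Q m * Q) ≈ Q * x
            arg = lc₁ (- Q) x≈ (solve 4 (λ a m q x → a :* (m :* q) := q :* x :+ (:- q) :* (x :- a :* m)) refl a _ Q x)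

  -- γ m = (-1)ᵐ aᵐ Q^(m(m-1)/2)
  γ : C → ℕ → C
  γ a zero = 1#
  γ a (suc m) = - (γ a m * (a * pw Q m))

  -- With `z = Q^(-m) / a`, the factor `1 - Q^(i+1) z` is `-1 / (a Q^(m-1-i))` times
  -- `1 - a Q^(m-1-i)`, so the product is reversed and `γ` clears the monomials.
  poch-reverse : ∀ a m z → a * z * pw Q m ≈ 1# → poch (Q * z) m * γ a m ≈ poch a m
  poch-reverse a zero z h = *-identityˡ _
  poch-reverse a (suc m) z h = trans
    (*-congʳ (trans (poch-head (Q * z) m) (*-congˡ (poch-cong m (*-assoc Q z Q)))))
    (lc₂ (- (1# - Q * z) * (a * pw Q m)) (poch a m) (poch-reverse a m (z * Q) (trans (solve 4 (λ a z q m → a :* (z :* q) :* m := a :* z :* (m :* q)) refl a z Q _) h)) h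
      (solve 7 (λ a z q m p g r → (con 1ℤ :- q :* z) :* p :* (:- (g :* (a :* m))) := r :* (con 1ℤ :- a :* m)
          :+ (:- (con 1ℤ :- q :* z)) :* (a :* m) :* (p :* g :- r) :+ r :* (a :* z :* (m :* q) :- con 1ℤ)) refl a z Q _ _ _ _))

-- The congruence in a ring with a distinguished subring and ideal

record IsSubring (R : CommutativeRing 0ℓ 0ℓ) (L : CommutativeRing.Carrier R → Set) : Set where
  open CommutativeRing R
  field
    L-resp : ∀ {x y} → x ≈ y → L x → L y
    L-+ : ∀ {x y} → L x → L y → L (x + y)
    L-* : ∀ {x y} → L x → L y → L (x * y)
    L-neg : ∀ {x} → L x → L (- x)
    L-1 : L 1#

-- Absorption is asked for multipliers in `L` only: `I` is to be an ideal of the subring, whereas in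
-- the ambient field it would be trivial.
record IsIdeal (R : CommutativeRing 0ℓ 0ℓ) (L I : CommutativeRing.Carrier R → Set) : Set where
  open CommutativeRing R
  field
    I-resp : ∀ {x y} → x ≈ y → I x → I y
    I-+ : ∀ {x y} → I x → I y → I (x + y)
    I-* : ∀ {x y} → L x → I y → I (x * y)
    I-0 : I 0#

module Modulo (R : CommutativeRing 0ℓ 0ℓ) {L I : CommutativeRing.Carrier R → Set}
  (isSubring : IsSubring R L) (isIdeal : IsIdeal R L I) where
  open RingKit R
  open Sums R
  open IsSubring isSubring
  open IsIdeal isIdeal

  infix 4 _~_
  -- A record, so that unification recovers both sides from the type.
  record _~_ (x y : C) : Set where
    constructor congruent
    field difference : I (x - y)
  open _~_ public

  ≈⇒~ : ∀ {x y} → x ≈ y → x ~ y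
  ≈⇒~ {x} {y} h = congruent (I-resp (sym (trans (+-congʳ h) (-‿inverseʳ y))) I-0)

  ~-refl : ∀ {x} → x ~ x
  ~-refl = ≈⇒~ refl

  ~-trans : ∀ {x y z} → x ~ y → y ~ z → x ~ z
  ~-trans {x} {y} {z} (congruent h) (congruent k) = congruent (I-resp (solve 3 (λ x y z → x :- y :+ (y :- z) := x :- z) refl x y z) (I-+ h k))

  ~-sym : ∀ {x y} → x ~ y → y ~ x
  ~-sym {x} {y} (congruent h) = congruent (I-resp (solve 2 (λ x y → (:- con 1ℤ) :* (x :- y) := y :- x) refl x y) (I-* (L-neg L-1) h))

  ~-+ : ∀ {x x′ y y′} → x ~ x′ → y ~ y′ → x + y ~ x′ + y′
  ~-+ {x} {x′} {y} {y′} (congruent h) (congruent k) = congruent (I-resp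
    (solve 4 (λ x x′ y y′ → x :- x′ :+ (y :- y′) := x :+ y :- (x′ :+ y′)) refl x x′ y y′) (I-+ h k))

  ~-*ˡ : ∀ {c x y} → L c → x ~ y → c * x ~ c * y
  ~-*ˡ {c} {x} {y} c∈L (congruent h) = congruent (I-resp (solve 3 (λ c x y → c :* (x :- y) := c :* x :- c :* y) refl c x y) (I-* c∈L h))

  ~-* : ∀ {x x′ y y′} → L x′ → L y → x ~ x′ → y ~ y′ → x * y ~ x′ * y′
  ~-* {x} {x′} {y} {y′} x′∈L y∈L h k = ~-trans (~-trans (≈⇒~ (*-comm x y)) (~-trans (~-*ˡ y∈L h) (≈⇒~ (*-comm y x′)))) (~-*ˡ x′∈L k)

  I⇒~0 : ∀ {x} → I x → x ~ 0#
  I⇒~0 {x} h = congruent (I-resp (solve 1 (λ x → x := x :- con 0ℤ) refl x) h)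

  ~-∑ : ∀ n {f g} → (∀ i → i < n → f i ~ g i) → ∑ n f ~ ∑ n g
  ~-∑ zero h = ~-refl
  ~-∑ (suc n) h = ~-+ (~-∑ n (λ i i<n → h i (ℕₚ.m≤n⇒m≤1+n i<n))) (h n ℕₚ.≤-refl)

  L-∑ : ∀ n {f} → (∀ i → i < n → L (f i)) → L (∑ n f)
  L-∑ zero h = L-resp (-‿inverseʳ 1#) (L-+ L-1 (L-neg L-1))
  L-∑ (suc n) h = L-+ (L-∑ n (λ i i<n → h i (ℕₚ.m≤n⇒m≤1+n i<n))) (h n ℕₚ.≤-refl)

  L-pw : ∀ {x} k → L x → L (pw x k)
  L-pw zero h = L-1
  L-pw (suc k) h = L-* (L-pw k h) h

  ∑-truncate : ∀ k n {f} → k ℕ.≤ n → (∀ i → k ℕ.≤ i → i < n → f i ~ 0#) → ∑ n f ~ ∑ k f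
  ∑-truncate k n {f} k≤n h with ℕₚ.m≤n⇒m<n∨m≡n k≤n
  ... | inj₂ ≡.refl = ~-refl
  ∑-truncate k (suc n) {f} k≤n h | inj₁ (s≤s k≤n′) = ~-trans
    (~-+ (∑-truncate k n k≤n′ (λ i k≤i i<n → h i k≤i (ℕₚ.m≤n⇒m≤1+n i<n))) (h n k≤n′ ℕₚ.≤-refl)) (≈⇒~ (+-identityʳ _))

  -- Rows `j > m` lie in `I`. A row `j ≤ m` has `n - j` entries, and `2m < n` guarantees that these
  -- still include every index up to `m`, so the triangle is cut down to a full square.
  cauchy-truncate : ∀ n m {c} → m ℕ.+ m < n → (∀ k → k < n → L (c k)) → (∀ k → m < k → k < n → I (c k)) →
    ∑ n (λ k → ∑ (suc k) (λ j → c j * c (k ∸ j))) ~ ∑ (suc m) c * ∑ (suc m) c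
  cauchy-truncate n m {c} 2m<n c∈L c∈I =
    ~-trans (≈⇒~ (trans (∑-triangle n (λ j i → c j * c i)) (∑-cong n (λ j _ → ∑-*ˡ (n ∸ j) (c j) c))))
    (~-trans (∑-truncate (suc m) n (ℕₚ.≤-trans (s≤s (ℕₚ.m≤m+n m m)) 2m<n)
       (λ j m<j j<n → I⇒~0 (I-resp (*-comm _ _) (I-* (L-∑ (n ∸ j) (λ i i<n-j → c∈L i (ℕₚ.≤-trans i<n-j (ℕₚ.m∸n≤m n j)))) (c∈I j m<j j<n)))))
    (~-trans (~-∑ (suc m) (λ j j≤m → ~-*ˡ (c∈L j (ℕₚ.≤-trans j≤m (ℕₚ.≤-trans (s≤s (ℕₚ.m≤m+n m m)) 2m<n)))
       (∑-truncate (suc m) (n ∸ j) (bound j j≤m) (λ i m<i i<n-j → I⇒~0 (c∈I i m<i (ℕₚ.≤-trans i<n-j (ℕₚ.m∸n≤m n j)))))))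
    (≈⇒~ (trans (∑-cong (suc m) (λ j _ → *-comm _ _)) (∑-*ˡ (suc m) _ c)))))
    where
    bound : ∀ j → j < suc m → suc m ℕ.≤ n ∸ j
    bound j (s≤s j≤m) = ℕₚ.m+n≤o⇒m≤o∸n (suc m) (ℕₚ.≤-trans (ℕₚ.+-monoʳ-≤ (suc m) j≤m) 2m<n)

record Localisation (R : CommutativeRing 0ℓ 0ℓ) : Set₁ where
  open CommutativeRing R
  field
    inv : Carrier → Carrier
    inverse : ∀ {x} → ¬ x ≈ 0# → x * inv x ≈ 1#
    1≉0 : ¬ 1# ≈ 0#
    L I : Carrier → Set
    isSubring : IsSubring R L
    isIdeal : IsIdeal R L I

module Local (R : CommutativeRing 0ℓ 0ℓ) (loc : Localisation R) where
  open RingKit R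
  open Sums R
  open Localisation loc
  open IsSubring isSubring public
  open Modulo R isSubring isIdeal public

  Unit : C → Set
  Unit x = ¬ x ≈ 0# × L (inv x)

  ≉0-resp : ∀ {x y} → x ≈ y → ¬ x ≈ 0# → ¬ y ≈ 0#
  ≉0-resp x≈y x≉0 y≈0 = x≉0 (trans x≈y y≈0)

  ≉0-* : ∀ {x y} → ¬ x ≈ 0# → ¬ y ≈ 0# → ¬ x * y ≈ 0#
  ≉0-* {x} {y} x≉0 y≉0 xy≈0 = y≉0 (lc₂ (- y) (inv x) (inverse x≉0) xy≈0
    (solve 3 (λ x i y → y := con 0ℤ :+ (:- y) :* (x :* i :- con 1ℤ) :+ i :* (x :* y :- con 0ℤ)) refl x (inv x) y))

  -- `inv` is not assumed to respect `≈`; equalities between inverses are obtained from uniqueness.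
  unique : ∀ {x y z} → x * y ≈ 1# → x * z ≈ 1# → y ≈ z
  unique {x} {y} {z} h k = lc₂ z (- y) h k
    (solve 3 (λ x y z → y := z :+ z :* (x :* y :- con 1ℤ) :+ (:- y) :* (x :* z :- con 1ℤ)) refl x y z)

  ≉0-intro : ∀ {x y} → x * y ≈ 1# → ¬ x ≈ 0#
  ≉0-intro h x≈0 = 1≉0 (trans (sym h) (trans (*-congʳ x≈0) (zeroˡ _)))

  Unit-intro : ∀ {x y} → x * y ≈ 1# → L y → Unit x
  Unit-intro h y∈L = ≉0-intro h , L-resp (unique h (inverse (≉0-intro h))) y∈L

  Unit-resp : ∀ {x y} → x ≈ y → Unit x → Unit y
  Unit-resp x≈y (x≉0 , h) = Unit-intro (trans (*-congʳ (sym x≈y)) (inverse x≉0)) h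

  Unit-1 : Unit 1#
  Unit-1 = Unit-intro (*-identityˡ 1#) L-1

  Unit-* : ∀ {x y} → Unit x → Unit y → Unit (x * y)
  Unit-* {x} {y} (x≉0 , hx) (y≉0 , hy) = Unit-intro
    (trans (solve 4 (λ x y i j → x :* y :* (i :* j) := x :* i :* (y :* j)) refl x y _ _) (trans (*-cong (inverse x≉0) (inverse y≉0)) (*-identityˡ 1#)))
    (L-* hx hy)

  -- The difference of the inverses is `y y′ (x′ - x)`.
  ~-inverse : ∀ {x x′ y y′} → L y → L y′ → x * y ≈ 1# → x′ * y′ ≈ 1# → x ~ x′ → y ~ y′
  ~-inverse {x} {x′} {y} {y′} y∈L y′∈L h h′ k = ~-trans
    (≈⇒~ (lc₁ (- y) h′ (solve 3 (λ x y z → y := y :* z :* x :+ (:- y) :* (x :* z :- con 1ℤ)) refl x′ y y′)))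
    (~-trans (~-*ˡ (L-* y∈L y′∈L) (~-sym k))
    (≈⇒~ (lc₁ y′ h (solve 3 (λ x y z → y :* z :* x := z :+ z :* (x :* y :- con 1ℤ)) refl x y y′))))

  L-0 : L 0#
  L-0 = L-∑ 0 {λ _ → 0#} (λ _ ())

  L-1- : ∀ {x} → L x → L (1# - x)
  L-1- h = L-+ L-1 (L-neg h)

module Supercongruence (R : CommutativeRing 0ℓ 0ℓ) (loc : Localisation R) (Q u v : CommutativeRing.Carrier R) where
  open RingKit R
  open Sums R
  open QSeries R Q
  open Localisation loc
  module Loc = Local R loc
  open Loc hiding (_~_; congruent; difference; ≈⇒~; ~-refl; ~-trans; ~-sym; ~-+; ~-*ˡ; ~-*; I⇒~0; ~-∑; ∑-truncate)

  a = u * u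

  c : ℕ → C
  c k = ω v k * (1# + u * pw Q k) * inv (1# + u) * (poch a k * poch a k) * (inv (poch Q k) * inv (poch Q k))

  s : ℕ → C
  s k = poch a k * poch u k * inv (poch Q k * poch (Q * u) k) * pw (Q * (v * v)) k

  lhs : ℕ → C
  lhs n = ∑ n (λ k → ∑ (suc k) (λ j → c j * c (k ∸ j)))

  L-poch : ∀ {z} k → L Q → L z → L (poch z k)
  L-poch zero Q∈L z∈L = L-1
  L-poch (suc k) Q∈L z∈L = L-* (L-poch k Q∈L z∈L) (L-1- (L-* z∈L (L-pw k Q∈L)))

  L-ω : ∀ k → L Q → L v → L (ω v k)
  L-ω zero Q∈L v∈L = L-1
  L-ω (suc k) Q∈L v∈L = L-neg (L-* (L-* (L-ω k Q∈L v∈L) (L-* (L-pw k Q∈L) Q∈L)) v∈L)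

  Unit-poch : ∀ {z} k → (∀ i → i < k → Unit (1# - z * pw Q i)) → Unit (poch z k)
  Unit-poch zero h = Unit-1
  Unit-poch (suc k) h = Unit-* (Unit-poch k (λ i i<k → h i (ℕₚ.m≤n⇒m≤1+n i<k))) (h k ℕₚ.≤-refl)

  poch-≉0 : ∀ {z} k → (∀ i → ¬ 1# - z * pw Q i ≈ 0#) → ¬ poch z k ≈ 0#
  poch-≉0 zero h = 1≉0
  poch-≉0 (suc k) h = ≉0-* (poch-≉0 k h) (h k)

  inverse-suc : ∀ {z w} → ¬ z * w ≈ 0# → inv z ≈ inv (z * w) * w
  inverse-suc {z} {w} h = unique (inverse (λ z≈0 → h (trans (*-congʳ z≈0) (zeroˡ w))))
    (trans (solve 3 (λ z w i → z :* (i :* w) := z :* w :* i) refl z w _) (inverse h))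

  -- The case `m > 0`

  module Generic (n m : ℕ) (x y : C) (0<m : 0 < m) (2m<n : m ℕ.+ m < n)
    (uv : u * v ≈ 1#) (x≈ : x ≈ a * pw Q m) (xy : x * y ≈ 1#)
    (Q∈L : L Q) (u∈L : L u) (v∈L : L v) (y∈L : L y) ([1-x]²∈I : I ((1# - x) * (1# - x)))
    (unit-Q : ∀ i → suc i < n → Unit (1# - Q * pw Q i)) (Q≉0 : ∀ i → ¬ 1# - Q * pw Q i ≈ 0#)
    (unit-a : ∀ i → i < m → Unit (1# - a * pw Q i)) (a≉0 : ∀ i → ¬ 1# - a * pw Q i ≈ 0#)
    (unit-x : ∀ i → i < m → Unit (1# - Q * x * pw Q i)) (unit-y : ∀ i → i < m → Unit (1# - Q * y * pw Q i))
    (u≉0 : ∀ j → ¬ 1# - u * pw Q j ≈ 0#) (pole : ∀ j → j ℕ.≤ m → L ((1# - x) * inv (1# - u * pw Q j))) where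

    open Loc using (_~_; congruent; difference; ≈⇒~; ~-refl; ~-trans; ~-sym; ~-+; ~-*ˡ; ~-*; I⇒~0; ~-∑; ∑-truncate)

    private
      a∈L : L a
      a∈L = L-* u∈L u∈L

      x∈L : L x
      x∈L = L-resp (sym x≈) (L-* a∈L (L-pw m Q∈L))

      iQ iA iX iY : ℕ → C
      iQ k = inv (poch Q k)
      iA k = inv (poch a k)
      iX k = inv (poch (Q * x) k)
      iY k = inv (poch (Q * y) k)

      m<n : m < n
      m<n = ℕₚ.≤-trans (s≤s (ℕₚ.m≤m+n m m)) 2m<n

      Unit-Q : ∀ k → k < n → Unit (poch Q k)
      Unit-Q k k<n = Unit-poch k (λ i i<k → unit-Q i (ℕₚ.≤-<-trans i<k k<n))

      Unit-a : ∀ k → k ℕ.≤ m → Unit (poch a k)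
      Unit-a k k≤m = Unit-poch k (λ i i<k → unit-a i (ℕₚ.≤-trans i<k k≤m))

      Unit-x : ∀ k → k ℕ.≤ m → Unit (poch (Q * x) k)
      Unit-x k k≤m = Unit-poch k (λ i i<k → unit-x i (ℕₚ.≤-trans i<k k≤m))

      Unit-y : ∀ k → k ℕ.≤ m → Unit (poch (Q * y) k)
      Unit-y k k≤m = Unit-poch k (λ i i<k → unit-y i (ℕₚ.≤-trans i<k k≤m))

      1-a : Unit (1# - a)
      1-a = Unit-resp (+-congˡ (-‿cong (*-identityʳ a))) (unit-a 0 0<m)

      1+u : Unit (1# + u)
      1+u = Unit-intro (trans (solve 2 (λ u i → (con 1ℤ :+ u) :* ((con 1ℤ :- u) :* i) := (con 1ℤ :- u :* u) :* i) refl u _) (inverse (proj₁ 1-a)))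
        (L-* (L-1- u∈L) (proj₂ 1-a))

      c∈L : ∀ k → k < n → L (c k)
      c∈L k k<n = L-* (L-* (L-* (L-* (L-ω k Q∈L v∈L) (L-+ L-1 (L-* u∈L (L-pw k Q∈L)))) (proj₂ 1+u))
        (L-* (L-poch k Q∈L a∈L) (L-poch k Q∈L a∈L))) (L-* (proj₂ (Unit-Q k k<n)) (proj₂ (Unit-Q k k<n)))

      c∈I : ∀ k → m < k → k < n → I (c k)
      c∈I k m<k k<n = IsIdeal.I-resp isIdeal
        (trans (solve 7 (λ w p i z r j e → w :* p :* i :* (z :* r :* (z :* r)) :* (j :* j) :* (e :* e) := w :* p :* i :* (z :* e :* r :* (z :* e :* r)) :* (j :* j)) refl _ _ _ _ _ _ _)
          (*-congʳ (*-congˡ (*-cong (sym split) (sym split)))))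
        (IsIdeal.I-* isIdeal (L-* (L-* (L-* (L-* (L-ω k Q∈L v∈L) (L-+ L-1 (L-* u∈L (L-pw k Q∈L)))) (proj₂ 1+u))
          (L-* (L-* (L-poch m Q∈L a∈L) rest) (L-* (L-poch m Q∈L a∈L) rest))) (L-* (proj₂ (Unit-Q k k<n)) (proj₂ (Unit-Q k k<n)))) [1-x]²∈I)
        where
        l = k ∸ suc m
        rest : L (poch (a * pw Q (suc m)) l)
        rest = L-poch l Q∈L (L-* a∈L (L-pw (suc m) Q∈L))
        split : poch a k ≈ poch a m * (1# - x) * poch (a * pw Q (suc m)) l
        split = trans (reflexive (≡.cong (poch a) (≡.sym (ℕₚ.m+[n∸m]≡n m<k))))
          (trans (poch-+ a (suc m) l) (*-congʳ (*-congˡ (+-congˡ (-‿cong (sym x≈))))))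

      -- Factor by factor: with `q = Q^k` and `x y = 1`, the difference
      -- `(1 - z q)² - (1 - z x q)(1 - z y q)` equals `z q y (1 - x)²`.
      poch² : ∀ {z} k → L z → poch z k * poch z k ~ poch (z * x) k * poch (z * y) k
      poch² zero z∈L = ~-refl
      poch² {z} (suc k) z∈L = ~-trans (≈⇒~ (swap (poch z k) _ (poch z k) _)) (~-trans
        (~-* (L-* (L-poch k Q∈L (L-* z∈L x∈L)) (L-poch k Q∈L (L-* z∈L y∈L))) (L-* z′ z′) (poch² k z∈L)
           (congruent (IsIdeal.I-resp isIdeal
             (lc₁ (z * q * (x - con2) + z * q * z * q) xy (solve 4 (λ z q x y → let o = con 1ℤ in
                z :* q :* y :* ((o :- x) :* (o :- x)) := (o :- z :* q) :* (o :- z :* q) :- (o :- z :* x :* q) :* (o :- z :* y :* q)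
                  :+ (z :* q :* (x :- con (+ 2)) :+ z :* q :* z :* q) :* (x :* y :- o)) refl z q x y))
             (IsIdeal.I-* isIdeal (L-* (L-* z∈L (L-pw k Q∈L)) y∈L) [1-x]²∈I))))
        (≈⇒~ (swap _ _ _ _)))
        where
        q = pw Q k
        con2 = 1# + 1#
        z′ : L (1# - z * q)
        z′ = L-1- (L-* z∈L (L-pw k Q∈L))
        swap : ∀ p q r s → p * q * (r * s) ≈ p * r * (q * s)
        swap = solve 4 (λ p q r s → p :* q :* (r :* s) := p :* r :* (q :* s)) refl

      module T = Transformation u iQ iA
        (trans (sym (*-identityˡ _)) (inverse 1≉0)) (λ i → inverse-suc (poch-≉0 (suc i) Q≉0))
        (trans (sym (*-identityˡ _)) (inverse 1≉0)) (λ i → inverse-suc (poch-≉0 (suc i) a≉0))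
      module W = T.AtLevel m v x y iX iY uv x≈ xy
        (λ k k≤m → trans (*-comm _ _) (inverse (proj₁ (Unit-x k k≤m)))) (λ k k≤m → trans (*-comm _ _) (inverse (proj₁ (Unit-y k k≤m))))

      c~α : ∀ k → k < suc m → c k ~ inv (1# + u) * W.α k
      c~α k (s≤s k≤m) = ~-trans (≈⇒~ (solve 5 (λ w l i p q → w :* l :* i :* p :* q := i :* (w :* l) :* (p :* q)) refl _ _ _ _ _))
        (~-trans (~-*ˡ (L-* (proj₂ 1+u) (L-* (L-ω k Q∈L v∈L) (L-+ L-1 (L-* u∈L (L-pw k Q∈L)))))
          (~-* (L-* (L-poch k Q∈L (L-* a∈L x∈L)) (L-poch k Q∈L (L-* a∈L y∈L))) (L-* (proj₂ Qk) (proj₂ Qk)) (poch² k a∈L)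
            (~-inverse (L-* (proj₂ Qk) (proj₂ Qk)) (L-* (proj₂ (Unit-x k k≤m)) (proj₂ (Unit-y k k≤m)))
              (product (inverse (proj₁ Qk)) (inverse (proj₁ Qk))) (product (inverse (proj₁ (Unit-x k k≤m))) (inverse (proj₁ (Unit-y k k≤m))))
              (poch² k Q∈L))))
        (≈⇒~ (solve 5 (λ w l i p q → i :* (w :* l) :* (p :* q) := i :* (w :* l :* p :* q)) refl _ _ _ _ _)))
        where
        Qk = Unit-Q k (ℕₚ.≤-<-trans k≤m m<n)
        product : ∀ {p q r t} → p * q ≈ 1# → r * t ≈ 1# → p * r * (q * t) ≈ 1#
        product {p} {q} {r} {t} h k = trans (solve 4 (λ p q r t → p :* r :* (q :* t) := p :* q :* (r :* t)) refl p q r t) (trans (*-cong h k) (*-identityˡ 1#))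

      -- In `s` the factorial `(a; Q)ⱼ` occurs once; writing it as `(a; Q)ⱼ² / (a; Q)ⱼ` yields a
      -- square that can be perturbed like the one in `c`.
      s′ : ℕ → C
      s′ j = (1# - u) * inv (1# - u * pw Q j) * (poch (a * x) j * poch (a * y) j) * (iQ j * iA j) * pw (Q * (v * v)) j

      -- The quotient `(u; Q)ⱼ / (Q u; Q)ⱼ` telescopes to `(1 - u) / (1 - u Q^j)`, which isolates
      -- the only possible pole.
      s-eval : ∀ j → s j ≈ (1# - u) * inv (1# - u * pw Q j) * poch a j * iQ j * pw (Q * (v * v)) j
      s-eval j = trans (*-congʳ (*-congˡ (unique (inverse (≉0-* Pq≉0 Pu≉0)) (trans (solve 4 (λ p q i j → p :* q :* (i :* j) := p :* i :* (q :* j)) refl _ _ _ _)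
            (trans (*-cong (inverse Pq≉0) (inverse Pu≉0)) (*-identityˡ 1#))))))
        (lc₃ (- (pa * Pu * i * w * iU)) (pa * i * w * iU * D) (pa * i * w * (1# - u) * D) (inverse (u≉0 j)) num-eq (inverse Pu≉0)
          (solve 9 (λ pa Pu i iU w u d D P → let o = con 1ℤ in
            pa :* Pu :* (i :* iU) :* w := (o :- u) :* D :* pa :* i :* w
              :+ (:- (pa :* Pu :* i :* w :* iU)) :* (d :* D :- o)
              :+ pa :* i :* w :* iU :* D :* (Pu :* d :- (o :- u) :* P)
              :+ pa :* i :* w :* (o :- u) :* D :* (P :* iU :- o)) refl pa Pu i iU w u (1# - u * pw Q j) D (poch (Q * u) j)))
        where
        pa = poch a j
        i = iQ j
        w = pw (Q * (v * v)) j
        D = inv (1# - u * pw Q j)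
        Pu = poch u j
        Pq≉0 : ¬ poch Q j ≈ 0#
        Pq≉0 = poch-≉0 j Q≉0
        Pu≉0 : ¬ poch (Q * u) j ≈ 0#
        Pu≉0 = poch-≉0 j (λ i → ≉0-resp (+-congˡ (-‿cong (solve 3 (λ u q p → u :* (p :* q) := q :* u :* p) refl u Q (pw Q i)))) (u≉0 (suc i)))
        iU = inv (poch (Q * u) j)
        num-eq : poch u (suc j) ≈ (1# - u) * poch (Q * u) j
        num-eq = trans (poch-head u j) (*-congˡ (poch-cong j (*-comm u Q)))

      -- Both sides carry `1 - x` because `1 / (1 - u Q^j)` alone may lie outside `L`, and then a
      -- congruence could not be multiplied by it.
      s~s′ : ∀ j → j < suc m → (1# - x) * s j ~ (1# - x) * s′ j
      s~s′ j (s≤s j≤m) = ~-trans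
        (≈⇒~ (trans (*-congˡ (s-eval j)) (lc₁ (- ((1# - x) * (1# - u) * inv (1# - u * pw Q j) * poch a j * iQ j * pw (Q * (v * v)) j)) (inverse (proj₁ (Unit-a j j≤m)))
          (solve 7 (λ x u d p i w e → let o = con 1ℤ in
             (o :- x) :* ((o :- u) :* d :* p :* i :* w) := (o :- x) :* d :* ((o :- u) :* (i :* e) :* w) :* (p :* p)
               :+ (:- ((o :- x) :* (o :- u) :* d :* p :* i :* w)) :* (p :* e :- o)) refl x u _ _ _ _ _))))
        (~-trans (~-*ˡ (L-* (pole j j≤m) (L-* (L-* (L-1- u∈L) (L-* (proj₂ (Unit-Q j (ℕₚ.≤-<-trans j≤m m<n))) (proj₂ (Unit-a j j≤m)))) (L-pw j (L-* Q∈L (L-* v∈L v∈L))))) (poch² j a∈L))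
        (≈⇒~ (solve 7 (λ x u d p i w e → let o = con 1ℤ in
             (o :- x) :* d :* ((o :- u) :* (i :* e) :* w) :* p := (o :- x) :* ((o :- u) :* d :* p :* (i :* e) :* w)) refl x u _ _ _ _ _)))

      -- `∑t` read backwards: the closed form `iQ j * iA j / (1 - u Q^j)` is expanded into the
      -- Bailey sum.
      s′-eval : ∀ j → s′ j ≈ (1# - u) * (W.E j * ∑ (suc j) (T.t j))
      s′-eval j = sym (trans (*-congˡ (*-congʳ (W.E-eval j)))
        (lc₂ (- ((1# - u) * p * f)) ((1# - u) * p * d) (inverse (u≉0 j)) (T.∑t j)
          (solve 9 (λ u p r w f i e d D → let o = con 1ℤ in
            (o :- u) :* (p :* r :* w :* f) := (o :- u) :* d :* (p :* r) :* (i :* e) :* w :+ (:- ((o :- u) :* (p :* r :* w) :* f)) :* (D :* d :- o)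
              :+ (o :- u) :* (p :* r :* w) :* d :* (D :* f :- i :* e)) refl u (poch (a * x) j) (poch (a * y) j) (pw (Q * (v * v)) j) f (iQ j) (iA j) d _)))
        where
        p = poch (a * x) j * poch (a * y) j * pw (Q * (v * v)) j
        f = ∑ (suc j) (T.t j)
        d = inv (1# - u * pw Q j)

      L-γ : ∀ k → L (γ a k)
      L-γ zero = L-1
      L-γ (suc k) = L-neg (L-* (L-γ k) (L-* a∈L (L-pw k Q∈L)))

    -- A square root of the right-hand side: `(1 - x) / (1 - a)` becomes `[n] / [r]` in base `q²`,
    -- and `γ a m` squares to the power of `q`, losing its sign.
    Z : C
    Z = (1# - x) * inv (1# - a) * γ a m * ∑ (suc m) s

    private
      -- The factor `1 - x` is distributed over the sum so that `pole` can absorb it term by term.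
      S∈L : L ((1# - x) * ∑ (suc m) s)
      S∈L = L-resp (∑-*ˡ (suc m) (1# - x) s) (L-∑ (suc m) (λ j j<m → let j≤m = ℕₚ.≤-pred j<m in
        L-resp (sym (trans (*-congˡ (s-eval j)) (solve 6 (λ x u d p i w → x :* (u :* d :* p :* i :* w) := x :* d :* (u :* p :* i :* w)) refl _ _ _ _ _ _)))
          (L-* (pole j j≤m) (L-* (L-* (L-* (L-1- u∈L) (L-poch j Q∈L a∈L)) (proj₂ (Unit-Q j (ℕₚ.≤-<-trans j≤m m<n)))) (L-pw j (L-* Q∈L (L-* v∈L v∈L)))))))

      Z≈ : Z ≈ inv (1# - a) * γ a m * ((1# - x) * ∑ (suc m) s)
      Z≈ = solve 4 (λ x i g s → x :* i :* g :* s := i :* g :* (x :* s)) refl _ _ _ _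

      Z∈L : L Z
      Z∈L = L-resp (sym Z≈) (L-* (L-* (proj₂ 1-a) (L-γ m)) S∈L)

      -- `γ` turns `(Q y; Q)ₘ` into `(a; Q)ₘ`, the factor `1 - x = 1 - a Q^m` completes it to
      -- `(a; Q)ₘ₊₁`, and this cancels `iA (suc m)`. There remains
      -- `(1 - u) / (1 - a) = 1 / (1 + u)`.
      exact : inv (1# - a) * γ a m * ((1# - x) * ∑ (suc m) s′) ≈ inv (1# + u) * ∑ (suc m) W.α
      exact = begin
        inv (1# - a) * γ a m * ((1# - x) * ∑ (suc m) s′)
          ≈⟨ *-congˡ (*-congˡ (trans (∑-cong (suc m) (λ j _ → s′-eval j)) (trans (∑-*ˡ (suc m) _ _) (*-congˡ W.transformation)))) ⟩
        inv (1# - a) * γ a m * ((1# - x) * ((1# - u) * (poch (Q * y) m * iA (suc m) * ∑ (suc m) W.α)))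
          ≈⟨ lc₃ (inv (1# - a) * (1# - x) * (1# - u) * iA (suc m) * A) (- (inv (1# - a) * poch a m * (1# - u) * iA (suc m) * A)) (inv (1# - a) * (1# - u) * A)
               (poch-reverse a m y (trans (lc₁ (- y) x≈ (solve 4 (λ a y q x → a :* y :* q := x :* y :+ (:- y) :* (x :- a :* q)) refl a y _ x)) xy)) x≈
               (inverse (poch-≉0 (suc m) a≉0))
               (solve 9 (λ j g x u p i A r q → let o = con 1ℤ in
                  j :* g :* ((o :- x) :* ((o :- u) :* (p :* i :* A))) := (o :- u) :* j :* A
                    :+ j :* (o :- x) :* (o :- u) :* i :* A :* (p :* g :- r)
                    :+ (:- (j :* r :* (o :- u) :* i :* A)) :* (x :- q)
                    :+ j :* (o :- u) :* A :* (r :* (o :- q) :* i :- o)) refl _ _ x u _ _ A _ (a * pw Q m)) ⟩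
        (1# - u) * inv (1# - a) * ∑ (suc m) W.α
          ≈⟨ *-congʳ (unique (trans (solve 2 (λ u i → (con 1ℤ :+ u) :* ((con 1ℤ :- u) :* i) := (con 1ℤ :- u :* u) :* i) refl u _) (inverse (proj₁ 1-a))) (inverse (proj₁ 1+u))) ⟩
        inv (1# + u) * ∑ (suc m) W.α ∎
        where
        open ≈-Reasoning
        A = ∑ (suc m) W.α

      Z~T : Z ~ ∑ (suc m) c
      Z~T = ~-trans (≈⇒~ Z≈) (~-trans
        (~-*ˡ (L-* (proj₂ 1-a) (L-γ m)) (~-trans (≈⇒~ (sym (∑-*ˡ (suc m) _ _))) (~-trans (~-∑ (suc m) s~s′) (≈⇒~ (∑-*ˡ (suc m) _ _)))))
        (~-trans (≈⇒~ (trans exact (sym (∑-*ˡ (suc m) _ _)))) (~-sym (~-∑ (suc m) c~α))))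

    congruence : lhs n ~ Z * Z
    congruence = ~-trans (cauchy-truncate n m 2m<n c∈L c∈I)
      (~-sym (~-* (L-∑ (suc m) (λ k k≤m → c∈L k (ℕₚ.≤-trans k≤m m<n))) Z∈L Z~T Z~T))

  -- The case `m = 0`, with `θ k = Q^(k(k+1)/2)`

  θ : ℕ → C
  θ zero = 1#
  θ (suc k) = θ k * (pw Q k * Q)

  -- Each `c (suc k)` already has the factor `(1 - a)(1 - u)`. Since `1 - a = (1 - u)(1 + u)`, one
  -- more factor `1 + u` completes it to `(1 - a)²`.
  MultipleOf1+u : C → Set
  MultipleOf1+u z = ∃[ l ] L l × z ≈ (1# + u) * l

  isIdeal₁ : IsIdeal R L MultipleOf1+u
  isIdeal₁ = record
    { I-resp = λ x≈y (l , l∈L , h) → l , l∈L , trans (sym x≈y) h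
    ; I-+ = λ (l , l∈L , h) (k , k∈L , h′) → l + k , L-+ l∈L k∈L , trans (+-cong h h′) (sym (distribˡ _ _ _))
    ; I-* = λ {x} x∈L (l , l∈L , h) → x * l , L-* x∈L l∈L , trans (*-congˡ h) (solve 3 (λ x u l → x :* (u :* l) := u :* (x :* l)) refl x _ l)
    ; I-0 = 0# , L-0 , sym (zeroʳ _) }

  module Mod1+u = Modulo R isSubring isIdeal₁

  ∑-reverse : ∀ n f → ∑ n f ≈ ∑ n (λ i → f (n ∸ suc i))
  ∑-reverse zero f = refl
  ∑-reverse (suc n) f = trans (trans (+-congʳ (∑-reverse n f)) (+-comm _ _)) (sym (∑-head n (λ i → f (n ∸ i))))

  module Degenerate (n′ : ℕ)
    (uv : u * v ≈ 1#) (Q∈L : L Q) (u∈L : L u) (v∈L : L v)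
    ([1-a]²∈I : I ((1# - a) * (1# - a))) (1+u≉0 : ¬ 1# + u ≈ 0#)
    (unit-Q : ∀ i → suc i < suc n′ → Unit (1# - Q * pw Q i))
    (Qⁿ : pw Q (suc n′) Mod1+u.~ 1#) (θⁿ : θ (suc n′) Mod1+u.~ 1#) where

    private
      n = suc n′
      a∈L : L a
      a∈L = L-* u∈L u∈L

      L-θ : ∀ k → L (θ k)
      L-θ zero = L-1
      L-θ (suc k) = L-* (L-θ k) (L-* (L-pw k Q∈L) Q∈L)

      -- `y k` is `c (suc k)` with `(1 - a)² / (1 + u) = (1 - a)(1 - u)` removed; what is left lies
      -- in `L` even though `1 + u` need not be a unit.
      y z : ℕ → C
      y k = ω v (suc k) * (1# + u * pw Q (suc k)) * (poch (a * Q) k * poch (a * Q) k) * (inv (poch Q (suc k)) * inv (poch Q (suc k)))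
      z k = inv (1# - Q * pw Q k)

      module Reduction where
        open Mod1+u using (_~_; congruent; difference; ≈⇒~; ~-refl; ~-trans; ~-sym; ~-+; ~-*ˡ; ~-*; I⇒~0; ~-∑; ∑-truncate)

        z∈L : ∀ k → suc k < n → L (z k)
        z∈L k h = proj₂ (unit-Q k h)

        -v~1 : - v ~ 1#
        -v~1 = congruent (- v , L-neg v∈L , lc₁ 1# uv (solve 2 (λ u v → (:- v) :- con 1ℤ := (con 1ℤ :+ u) :* (:- v) :+ con 1ℤ :* (u :* v :- con 1ℤ)) refl u v))

        u~-1 : u ~ - 1#
        u~-1 = congruent (1# , L-1 , solve 1 (λ u → u :- (:- con 1ℤ) := (con 1ℤ :+ u) :* con 1ℤ) refl u)

        a~1 : a ~ 1#
        a~1 = ~-trans (~-* (L-neg L-1) u∈L u~-1 u~-1) (≈⇒~ (solve 0 ((:- con 1ℤ) :* (:- con 1ℤ) := con 1ℤ) refl))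

        ω~θ : ∀ k → ω v k ~ θ k
        ω~θ zero = ~-refl
        ω~θ (suc k) = ~-trans (≈⇒~ (solve 3 (λ w q v → (:- (w :* q :* v)) := w :* q :* (:- v)) refl _ _ v))
          (~-trans (~-* (L-* (L-θ k) q∈L) (L-neg v∈L) (~-* (L-θ k) q∈L (ω~θ k) ~-refl) -v~1) (≈⇒~ (*-identityʳ _)))
          where q∈L = L-* (L-pw k Q∈L) Q∈L

        factor : ∀ q → L q → 1# + u * q ~ 1# - q
        factor q q∈L = ~-trans (~-+ ~-refl (~-* (L-neg L-1) q∈L u~-1 ~-refl)) (≈⇒~ (solve 1 (λ q → con 1ℤ :+ (:- con 1ℤ) :* q := con 1ℤ :- q) refl q))

        poch~ : ∀ k → poch (a * Q) k ~ poch Q k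
        poch~ zero = ~-refl
        poch~ (suc k) = ~-* (L-poch k Q∈L Q∈L) (L-1- (L-* (L-* a∈L Q∈L) (L-pw k Q∈L))) (poch~ k)
          (~-trans (≈⇒~ (solve 3 (λ a q k → con 1ℤ :- a :* q :* k := con 1ℤ :+ a :* (:- (q :* k))) refl a Q _))
          (~-trans (~-+ ~-refl (~-* L-1 (L-neg (L-* Q∈L (L-pw k Q∈L))) a~1 ~-refl)) (≈⇒~ (+-congˡ (*-identityˡ _)))))

        -- At `u = -1`, `a = 1` the factorials cancel except for `(1 - Q^(k+1)) / (1 - Q^(k+1))²`.
        y~ : ∀ k → suc k < n → y k ~ θ (suc k) * z k
        y~ k k<n = ~-trans
          (~-* (L-* (L-* (L-θ (suc k)) (L-1- q∈L)) (L-* P∈L P∈L)) (L-* i∈L i∈L)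
            (~-* (L-* (L-θ (suc k)) (L-1- q∈L)) (L-* aP∈L aP∈L)
              (~-* (L-θ (suc k)) (L-+ L-1 (L-* u∈L q∈L)) (ω~θ (suc k)) (factor _ q∈L))
              (~-* P∈L aP∈L (poch~ k) (poch~ k)))
            ~-refl)
          (≈⇒~ (trans (*-congˡ (*-cong i≈ i≈))
            (lc₂ (t * w * (i * i * (P * j + 1#))) (t * i) (inverse (proj₁ Pk)) (inverse (proj₁ (unit-Q k k<n)))
              (solve 6 (λ t q k P j i → let o = con 1ℤ ; w = o :- q :* k in
                 t :* (o :- k :* q) :* (P :* P) :* (j :* i :* (j :* i)) := t :* i :+ t :* w :* (i :* i :* (P :* j :+ o)) :* (P :* j :- o) :+ t :* i :* (w :* i :- o))
                 refl t Q (pw Q k) P j i))))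
          where
          Pk = Unit-poch k (λ i i<k → unit-Q i (ℕₚ.≤-<-trans i<k (ℕₚ.<-trans ℕₚ.≤-refl k<n)))
          Psk = Unit-poch (suc k) (λ i i<k → unit-Q i (ℕₚ.≤-<-trans i<k k<n))
          q∈L = L-pw (suc k) Q∈L
          P∈L = L-poch k Q∈L Q∈L
          aP∈L = L-poch k Q∈L (L-* a∈L Q∈L)
          i∈L = proj₂ Psk
          t = θ (suc k)
          w = 1# - Q * pw Q k
          P = poch Q k
          j = inv P
          i = z k
          i≈ : inv (poch Q (suc k)) ≈ j * i
          i≈ = unique (inverse (proj₁ Psk)) (trans (solve 4 (λ p w j i → p :* w :* (j :* i) := p :* j :* (w :* i)) refl P w j i)
            (trans (*-cong (inverse (proj₁ Pk)) (inverse (proj₁ (unit-Q k k<n)))) (*-identityˡ 1#)))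

        -- The exponents of `Q` on the two sides differ by `n(n+1)/2 - n k`: `θⁿ` accounts for the
        -- first part, and each induction step uses `Qⁿ` once.
        θ-reflect : ∀ k l → k ℕ.+ l ≡ n → θ l * pw Q k ~ θ k
        θ-reflect zero .n ≡.refl = ~-trans (≈⇒~ (*-identityʳ _)) θⁿ
        θ-reflect (suc k) l eq = ~-sym (~-trans (~-*ʳ (~-sym (θ-reflect k (suc l) eq′)))
          (~-trans (≈⇒~ (trans (solve 5 (λ t l q k r → t :* (l :* q) :* k :* (k :* q) := t :* (k :* q) :* (k :* (l :* q))) refl (θ l) (pw Q l) Q (pw Q k) 1#)
              (*-congˡ (trans (sym (pw-+ Q k (suc l))) (reflexive (≡.cong (pw Q) eq′))))))
          (~-trans (~-*ˡ (L-* (L-θ l) q∈L) Qⁿ) (≈⇒~ (*-identityʳ _)))))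
          where
          eq′ = ≡.trans (ℕₚ.+-suc k l) eq
          q∈L = L-* (L-pw k Q∈L) Q∈L
          ~-*ʳ : ∀ {p r} → p ~ r → p * (pw Q k * Q) ~ r * (pw Q k * Q)
          ~-*ʳ h = ~-trans (≈⇒~ (*-comm _ _)) (~-trans (~-*ˡ q∈L h) (≈⇒~ (*-comm _ _)))

        -- With `K = Q^(k+1)` and `J = Q^(l+1)`, `K J ≡ 1` gives `1 / (1 - J) ≡ -K / (1 - K)`, and
        -- `θ-reflect` absorbs the `K`.
        antisymmetry : ∀ k l → suc k ℕ.+ suc l ≡ n → suc k < n → suc l < n → y k + y l ~ 0#
        antisymmetry k l eq k<n l<n = ~-trans (~-+ (y~ k k<n) (~-trans (y~ l l<n) (~-*ˡ (L-θ (suc l)) z-reflect)))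
          (~-trans (~-+ ~-refl (≈⇒~ (solve 3 (λ t q z → t :* ((:- q) :* z) := (:- z) :* (t :* q)) refl (θ (suc l)) K (z k))))
          (~-trans (~-+ ~-refl (~-*ˡ (L-neg (z∈L k k<n)) (θ-reflect (suc k) (suc l) eq)))
          (≈⇒~ (solve 2 (λ t z → t :* z :+ (:- z) :* t := con 0ℤ) refl _ _))))
          where
          K = pw Q (suc k)
          J = pw Q (suc l)
          KJ : K * J ~ 1#
          KJ = ~-trans (≈⇒~ (trans (sym (pw-+ Q (suc k) (suc l))) (reflexive (≡.cong (pw Q) eq)))) Qⁿ
          z-reflect : z l ~ - K * z k
          z-reflect = ~-trans
            (≈⇒~ (lc₁ (- z l) (inverse (proj₁ (unit-Q k k<n))) (solve 4 (λ zl zk q k → zl := zl :* zk :* (con 1ℤ :- k :* q) :+ (:- zl) :* ((con 1ℤ :- q :* k) :* zk :- con 1ℤ)) refl (z l) (z k) Q (pw Q k))))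
            (~-trans (~-*ˡ (L-* (z∈L l l<n) (z∈L k k<n)) (~-+ (~-sym KJ) ~-refl))
            (≈⇒~ (lc₁ (- (K * z k)) (inverse (proj₁ (unit-Q l l<n)))
              (solve 5 (λ zl zk q k l → zl :* zk :* (k :* (l :* q) :- k) := (:- k) :* zk :+ (:- (k :* zk)) :* ((con 1ℤ :- q :* l) :* zl :- con 1ℤ)) refl (z l) (z k) Q K (pw Q l)))))

      y∈L : ∀ k → suc k < n → L (y k)
      y∈L k k<n = L-* (L-* (L-* (L-ω (suc k) Q∈L v∈L) (L-+ L-1 (L-* u∈L (L-pw (suc k) Q∈L)))) (L-* P P)) (L-* i i)
        where
        P = L-poch k Q∈L (L-* a∈L Q∈L)
        i = proj₂ (Unit-poch (suc k) (λ i i<k → unit-Q i (ℕₚ.≤-<-trans i<k k<n)))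

      c-zero : c 0 ≈ 1#
      c-zero = lc₂ (j * j) (j + 1#) (inverse 1+u≉0) (inverse 1≉0)
        (solve 3 (λ u i j → let o = con 1ℤ in o :* (o :+ u :* o) :* i :* (o :* o) :* (j :* j) := o :+ j :* j :* ((o :+ u) :* i :- o) :+ (j :+ o) :* (o :* j :- o)) refl u _ j)
        where j = inv 1#

      c-suc : ∀ k → c (suc k) ≈ (1# - a) * ((1# - u) * y k)
      c-suc k = trans (*-congʳ (*-congˡ (*-cong (poch-head a k) (poch-head a k))))
        (lc₁ (w * l * ((1# - a) * (1# - u) * (p * p)) * i) (inverse 1+u≉0)
          (solve 6 (λ w l u j p i → let o = con 1ℤ ; a = u :* u in
            w :* l :* j :* ((o :- a) :* p :* ((o :- a) :* p)) :* i := (o :- a) :* ((o :- u) :* (w :* l :* (p :* p) :* i))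
              :+ w :* l :* ((o :- a) :* (o :- u) :* (p :* p)) :* i :* ((o :+ u) :* j :- o)) refl w l u _ p i))
        where
        w = ω v (suc k)
        l = 1# + u * pw Q (suc k)
        p = poch (a * Q) k
        i = inv (poch Q (suc k)) * inv (poch Q (suc k))

      open IsIdeal isIdeal
      open Loc using (_~_; congruent; difference; ≈⇒~; ~-refl; ~-trans; ~-sym; ~-+; ~-*ˡ; ~-*; I⇒~0; ~-∑; ∑-truncate)

      c-pair : ∀ k l → suc k ℕ.+ suc l ≡ n → suc k < n → suc l < n → c (suc k) + c (suc l) ~ 0#
      c-pair k l eq k<n l<n = conclude (Mod1+u.difference (Reduction.antisymmetry k l eq k<n l<n))
       where
       conclude : MultipleOf1+u (y k + y l - 0#) → c (suc k) + c (suc l) ~ 0#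
       conclude (e , e∈L , h) = I⇒~0 (I-resp
        (trans (lc₁ (- ((1# - a) * (1# - u))) h (solve 4 (λ u y y′ e → let o = con 1ℤ ; a = u :* u in
            e :* ((o :- a) :* (o :- a)) := (o :- a) :* ((o :- u) :* y) :+ (o :- a) :* ((o :- u) :* y′)
               :+ (:- ((o :- a) :* (o :- u))) :* (y :+ y′ :- con 0ℤ :- (o :+ u) :* e)) refl u (y k) (y l) e))
          (sym (+-cong (c-suc k) (c-suc l)))) (I-* e∈L [1-a]²∈I))

      cc∈I : ∀ k l → suc k < n → suc l < n → c (suc k) * c (suc l) ~ 0#
      cc∈I k l k<n l<n = I⇒~0 (I-resp
        (trans (solve 4 (λ a u y z → u :* y :* (u :* z) :* (a :* a) := a :* (u :* y) :* (a :* (u :* z))) refl (1# - a) (1# - u) (y k) (y l)) (sym (*-cong (c-suc k) (c-suc l))))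
        (I-* (L-* (L-* (L-1- u∈L) (y∈L k k<n)) (L-* (L-1- u∈L) (y∈L l l<n))) [1-a]²∈I))

      tail : C
      tail = ∑ n′ (λ k → c (suc k))

      row : ∀ j → j < n′ → c (suc j) * ∑ (n′ ∸ j) c ~ c (suc j)
      row j j<n′ = ~-trans (≈⇒~ (trans (*-congˡ (trans (reflexive (≡.cong (λ k → ∑ k c) eq)) (∑-head l c)))
          (trans (distribˡ _ _ _) (+-cong (trans (*-congˡ c-zero) (*-identityʳ _)) (sym (∑-*ˡ l _ _))))))
        (~-trans (~-+ ~-refl (∑-truncate 0 l z≤n (λ i _ i<l → cc∈I j i (s≤s j<n′) (s≤s (ℕₚ.≤-trans i<l (ℕₚ.m∸n≤m n′ (suc j)))))))
        (≈⇒~ (+-identityʳ _)))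
        where
        l = n′ ∸ suc j
        eq : n′ ∸ j ≡ suc l
        eq = ℕₚ.+-∸-assoc 1 j<n′

      -- The double sum contains `tail` twice, from the pairs with first and with second index 0.
      -- Pairing one copy with the reversal of the other gives the result without dividing by 2.
      2tail : tail + tail ~ 0#
      2tail = ~-trans (≈⇒~ (trans (+-congˡ (∑-reverse n′ _)) (sym (∑-+ n′ _ _))))
        (∑-truncate 0 n′ z≤n (λ i _ i<n′ → c-pair i (n′ ∸ suc i) (≡.trans (≡.cong suc (ℕₚ.+-suc i _)) (≡.cong suc (ℕₚ.m+[n∸m]≡n i<n′))) (s≤s i<n′) (s≤s (ℕₚ.∸-monoʳ-< {n′} {suc i} {0} (s≤s z≤n) i<n′))))

    congruence : lhs n ~ 1#
    congruence = ~-trans (≈⇒~ (trans (∑-triangle n (λ j i → c j * c i)) (trans (∑-cong n (λ j _ → ∑-*ˡ (n ∸ j) (c j) c)) (∑-head n′ _))))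
      (~-trans (~-+ (≈⇒~ (trans (*-congʳ c-zero) (trans (*-identityˡ _) (trans (∑-head n′ c) (+-congʳ c-zero))))) (~-∑ n′ row))
      (~-trans (≈⇒~ (+-assoc _ _ _)) (~-trans (~-+ ~-refl 2tail) (≈⇒~ (+-identityʳ _)))))

-- Exponent identities over ℤ

private
  module Exponents where
    open ℤ-Solver

    e-pw : ∀ i k → i ℤ.* k ℤ.+ i ≡ i ℤ.* (1ℤ ℤ.+ k)
    e-pw = solve 2 (λ i k → i :* k :+ i := i :* (con 1ℤ :+ k)) ≡.refl

    e-move : ∀ n d i m → n ≡ n ℤ.+ d ℤ.* (i ℤ.- m) ℤ.+ d ℤ.* (m ℤ.- i)
    e-move = solve 4 (λ n d i m → n := n :+ d :* (i :- m) :+ d :* (m :- i)) ≡.refl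

    e-Q : ∀ d i → + 2 ℤ.* (d ℤ.* (1ℤ ℤ.+ i)) ≡ + 2 ℤ.* d ℤ.+ + 2 ℤ.* d ℤ.* i
    e-Q = solve 2 (λ d i → con (+ 2) :* (d :* (con 1ℤ :+ i)) := con (+ 2) :* d :+ con (+ 2) :* d :* i) ≡.refl

    e-a : ∀ n d i m → + 2 ℤ.* (n ℤ.+ d ℤ.* (i ℤ.- m)) ≡ (n ℤ.- d ℤ.* m) ℤ.+ (n ℤ.- d ℤ.* m) ℤ.+ + 2 ℤ.* d ℤ.* i
    e-a = solve 4 (λ n d i m → con (+ 2) :* (n :+ d :* (i :- m)) := (n :- d :* m) :+ (n :- d :* m) :+ con (+ 2) :* d :* i) ≡.refl

    e-u : ∀ n d j m → n ℤ.+ d ℤ.* (+ 2 ℤ.* j ℤ.- m) ≡ (n ℤ.- d ℤ.* m) ℤ.+ + 2 ℤ.* d ℤ.* j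
    e-u = solve 4 (λ n d j m → n :+ d :* (con (+ 2) :* j :- m) := (n :- d :* m) :+ con (+ 2) :* d :* j) ≡.refl

    e-n : ∀ n d m → + 2 ℤ.* n ≡ (n ℤ.- d ℤ.* m) ℤ.+ (n ℤ.- d ℤ.* m) ℤ.+ + 2 ℤ.* d ℤ.* m
    e-n = solve 3 (λ n d m → con (+ 2) :* n := (n :- d :* m) :+ (n :- d :* m) :+ con (+ 2) :* d :* m) ≡.refl

    e-xy : ∀ n d i t → + 2 ℤ.* (t ℤ.* n ℤ.+ d ℤ.* (1ℤ ℤ.+ i)) ≡ + 2 ℤ.* d ℤ.+ t ℤ.* (+ 2 ℤ.* n) ℤ.+ + 2 ℤ.* d ℤ.* i
    e-xy = solve 4 (λ n d i t → con (+ 2) :* (t :* n :+ d :* (con 1ℤ :+ i)) := con (+ 2) :* d :+ t :* (con (+ 2) :* n) :+ con (+ 2) :* d :* i) ≡.refl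

    e-2 : ∀ i → + 2 ℤ.* i ≡ i ℤ.+ i
    e-2 = solve 1 (λ i → con (+ 2) :* i := i :+ i) ≡.refl

    e-ω : ∀ d k r → d ℤ.* (1ℤ ℤ.+ k) ℤ.* (1ℤ ℤ.+ k) ℤ.+ (1ℤ ℤ.+ k) ℤ.* (d ℤ.- r)
      ≡ d ℤ.* k ℤ.* k ℤ.+ k ℤ.* (d ℤ.- r) ℤ.+ (+ 2 ℤ.* d ℤ.* k ℤ.+ + 2 ℤ.* d) ℤ.+ ℤ.- r
    e-ω = solve 3 (λ d k r → d :* (con 1ℤ :+ k) :* (con 1ℤ :+ k) :+ (con 1ℤ :+ k) :* (d :- r)
      := d :* k :* k :+ k :* (d :- r) :+ (con (+ 2) :* d :* k :+ con (+ 2) :* d) :+ :- r) ≡.refl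

    e-θ : ∀ d k → d ℤ.* (1ℤ ℤ.+ k) ℤ.* (1ℤ ℤ.+ (1ℤ ℤ.+ k)) ≡ d ℤ.* k ℤ.* (1ℤ ℤ.+ k) ℤ.+ (+ 2 ℤ.* d ℤ.* k ℤ.+ + 2 ℤ.* d)
    e-θ = solve 2 (λ d k → d :* (con 1ℤ :+ k) :* (con 1ℤ :+ (con 1ℤ :+ k)) := d :* k :* (con 1ℤ :+ k) :+ (con (+ 2) :* d :* k :+ con (+ 2) :* d)) ≡.refl

    e-γ : ∀ d k r → + 2 ℤ.* (1ℤ ℤ.+ k) ℤ.* (r ℤ.+ r ℤ.+ d ℤ.* ((1ℤ ℤ.+ k) ℤ.- 1ℤ))
      ≡ + 2 ℤ.* k ℤ.* (r ℤ.+ r ℤ.+ d ℤ.* (k ℤ.- 1ℤ)) ℤ.+ ((r ℤ.+ r ℤ.+ + 2 ℤ.* d ℤ.* k) ℤ.+ (r ℤ.+ r ℤ.+ + 2 ℤ.* d ℤ.* k))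
    e-γ = solve 3 (λ d k r → con (+ 2) :* (con 1ℤ :+ k) :* (r :+ r :+ d :* ((con 1ℤ :+ k) :- con 1ℤ))
      := con (+ 2) :* k :* (r :+ r :+ d :* (k :- con 1ℤ)) :+ ((r :+ r :+ con (+ 2) :* d :* k) :+ (r :+ r :+ con (+ 2) :* d :* k))) ≡.refl

    e-γ-end : ∀ n d m → (n ℤ.- d ℤ.* m) ℤ.+ (n ℤ.- d ℤ.* m) ℤ.+ d ℤ.* (m ℤ.- 1ℤ) ≡ n ℤ.+ (n ℤ.- d ℤ.* m) ℤ.- d
    e-γ-end = solve 3 (λ n d m → (n :- d :* m) :+ (n :- d :* m) :+ d :* (m :- con 1ℤ) := n :+ (n :- d :* m) :- d) ≡.refl

    e-s : ∀ d k r → + 2 ℤ.* k ℤ.* (d ℤ.- r) ≡ (+ 2 ℤ.* d ℤ.+ (ℤ.- r ℤ.+ ℤ.- r)) ℤ.* k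
    e-s = solve 3 (λ d k r → con (+ 2) :* k :* (d :- r) := (con (+ 2) :* d :+ (:- r :+ :- r)) :* k) ≡.refl

    e-Qⁿ : ∀ d n → + 2 ℤ.* d ℤ.* n ≡ + 2 ℤ.* n ℤ.* d
    e-Qⁿ = solve 2 (λ d n → con (+ 2) :* d :* n := con (+ 2) :* n :* d) ≡.refl

    e-θⁿ : ∀ d n h → d ℤ.* n ℤ.* (h ℤ.* + 2) ≡ + 2 ℤ.* n ℤ.* (d ℤ.* h)
    e-θⁿ = solve 3 (λ d n h → d :* n :* (h :* con (+ 2)) := con (+ 2) :* n :* (d :* h)) ≡.refl

open Exponents

-- `E i` stands for `q^i`. Units are provided at even exponents, because `1 - q^(2i)` is coprime to
-- both `Φₙ(q)` and `Φₙ(-q)` as soon as `n ∤ i`.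
record Exponential (R : CommutativeRing 0ℓ 0ℓ) (loc : Localisation R) (n : ℕ) : Set where
  open CommutativeRing R
  open Localisation loc
  field
    E : ℤ → Carrier
    E-0 : E 0ℤ ≈ 1#
    E-+ : ∀ i j → E (i ℤ.+ j) ≈ E i * E j
    E-≉0 : ∀ {i} → i ≢ 0ℤ → ¬ 1# - E i ≈ 0#
    E∈L : ∀ i → L (E i)
    E-unit : ∀ {i} → ¬ (+ n) ∣ₛ.∣ i → L (inv (1# - E (+ 2 ℤ.* i)))
    E-modulus : I ((1# - E (+ 2 ℤ.* + n)) * (1# - E (+ 2 ℤ.* + n)))

-- Specialisation to `Q = q^(2d)`, `u = q^r`, `v = q^(-r)`

module Literal (R : CommutativeRing 0ℓ 0ℓ) (loc : Localisation R) (n : ℕ) (exp : Exponential R loc n) (d : ℕ) (r : ℤ) where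
  open RingKit R
  open Sums R
  open Localisation loc
  open Exponential exp

  -- The expressions of the theorem, with E i in place of qⁱ.
  sg : ℕ → C
  sg zero = 1#
  sg (suc k) = - 1# * sg k

  P : ℤ → ℕ → ℕ → C
  P e s zero = 1#
  P e s (suc k) = P e s k * (1# - E (e ℤ.+ + (s ℕ.* k)))

  c′ : ℕ → C
  c′ k = sg k * (((1# + E (+ (2 ℕ.* d ℕ.* k) ℤ.+ r)) * (P (+ 2 ℤ.* r) (2 ℕ.* d) k * P (+ 2 ℤ.* r) (2 ℕ.* d) k))
     * inv ((1# + E r) * (P (+ (2 ℕ.* d)) (2 ℕ.* d) k * P (+ (2 ℕ.* d)) (2 ℕ.* d) k))) * E (+ (d ℕ.* k ℕ.* k) ℤ.+ + k ℤ.* (+ d ℤ.- r))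

  lhs′ : C
  lhs′ = ∑ n (λ k → ∑ (suc k) (λ j → c′ j * c′ (k ∸ j)))

  s′ : ℕ → C
  s′ k = (P (+ 2 ℤ.* r) (2 ℕ.* d) k * P r (2 ℕ.* d) k) * inv (P (+ (2 ℕ.* d)) (2 ℕ.* d) k * P (+ (2 ℕ.* d) ℤ.+ r) (2 ℕ.* d) k)
     * E (+ (2 ℕ.* k) ℤ.* (+ d ℤ.- r))

  qint : ℤ → C
  qint i = (1# - E (+ 2 ℤ.* i)) * inv (1# - E (+ 2))

  rhs′ : ℕ → C
  rhs′ m = (qint (+ n) * qint (+ n)) * inv (qint r * qint r) * E (+ 2 ℤ.* + m ℤ.* (+ n ℤ.+ r ℤ.- + d)) * (∑ (suc m) s′ * ∑ (suc m) s′)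

  module Main (m : ℕ) (0<d : 0 < d) (2m<n : m ℕ.+ m < n) (odd : ∃[ h ] suc n ≡ h ℕ.* 2) (coprime : Coprime n d)
    (r≡ : r ≡ + n ℤ.- + d ℤ.* + m) where
    open Local R loc

    D = + d
    Q = E (+ (2 ℕ.* d))
    u = E r
    v = E (ℤ.- r)
    a = u * u

    open QSeries R Q
    module SC = Supercongruence R loc Q u v

    m<n : m < n
    m<n = ℕₚ.≤-trans (s≤s (ℕₚ.m≤m+n m m)) 2m<n

    E-cong : ∀ {i j} → i ≡ j → E i ≈ E j
    E-cong h = reflexive (cong E h)

    E-pw : ∀ i k → pw (E i) k ≈ E (i ℤ.* + k)
    E-pw i zero = trans (sym E-0) (E-cong (≡.sym (ℤₚ.*-zeroʳ i)))
    E-pw i (suc k) = trans (*-congʳ (E-pw i k)) (trans (sym (E-+ _ _)) (E-cong (e-pw i (+ k))))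

    2d≡ : + (2 ℕ.* d) ≡ + 2 ℤ.* D
    2d≡ = ℤₚ.pos-* 2 d

    Q-pw : ∀ k → pw Q k ≈ E (+ 2 ℤ.* D ℤ.* + k)
    Q-pw k = trans (E-pw _ k) (E-cong (cong (ℤ._* + k) 2d≡))

    E-inverse : ∀ i j → i ℤ.+ j ≡ 0ℤ → E i * E j ≈ 1#
    E-inverse i j h = trans (sym (E-+ i j)) (trans (E-cong h) E-0)

    -- Modulo `n` the exponent is `d j`; as `d` is coprime to `n`, divisibility would pass to `j`,
    -- which is nonzero and smaller than `n` in absolute value.
    not-divisible : ∀ {i} t j → j ≢ 0ℤ → ℤ.∣ j ∣ < n → i ≡ t ℤ.* + n ℤ.+ D ℤ.* j → ¬ (+ n) ∣ₛ.∣ i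
    not-divisible {i} t j j≢0 j<n ≡.refl n∣i = ℕₚ.<⇒≱ j<n (∣.∣⇒≤ {{ℕ.≢-nonZero (λ e → j≢0 (ℤₚ.∣i∣≡0⇒i≡0 e))}}
      (coprime-divisor coprime (≡.subst (n ∣.∣_) (ℤₚ.abs-* D j) (∣ₛ.∣⇒∣ᵤ n∣Dj))))
      where
      n∣Dj : (+ n) ∣ₛ.∣ (D ℤ.* j)
      n∣Dj = ∣ₛ.∣m+n∣m⇒∣n n∣i (∣ₛ.divides t ≡.refl)

    -- All required units have exponent `2 (t n + d j)` with `0 < |j| < n`: `t = 0` for the factors
    -- of `(Q; Q)`, `t = 1` for those involving `a`, `x` or `u`, and `t = -1` for `y`.
    unit-E : ∀ {i e} t j → j ≢ 0ℤ → ℤ.∣ j ∣ < n → i ≡ t ℤ.* + n ℤ.+ D ℤ.* j → e ≡ + 2 ℤ.* i → Unit (1# - E e)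
    unit-E {i} t j j≢0 j<n i≡ ≡.refl = E-≉0 2i≢0 , E-unit (not-divisible t j j≢0 j<n i≡)
      where
      2i≢0 : + 2 ℤ.* i ≢ 0ℤ
      2i≢0 h with ℤₚ.i*j≡0⇒i≡0∨j≡0 (+ 2) h
      ... | inj₂ ≡.refl = not-divisible t j j≢0 j<n i≡ (∣ₛ.divides 0ℤ (≡.sym (ℤₚ.*-zeroˡ (+ n))))

    -- n = d (m - i) forces d = 1, and then m ≥ n.
    shifted≢0 : ∀ i → + n ℤ.+ D ℤ.* (+ i ℤ.- + m) ≢ 0ℤ
    shifted≢0 i h = ℕₚ.<⇒≱ m<n (ℕₚ.≤-trans (ℕₚ.≤-reflexive n≡) (ℕₚ.m∸n≤m m i))
      where
      n≡D : + n ≡ D ℤ.* (+ m ℤ.- + i)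
      n≡D = ≡.trans (e-move (+ n) D (+ i) (+ m)) (≡.trans (cong (ℤ._+ _) h) (ℤₚ.+-identityˡ _))
      n≡d : n ≡ d ℕ.* ℤ.∣ + m ℤ.- + i ∣
      n≡d = ≡.trans (cong ℤ.∣_∣ n≡D) (ℤₚ.abs-* D (+ m ℤ.- + i))
      d≡1 : d ≡ 1
      d≡1 = coprime (∣.divides ℤ.∣ + m ℤ.- + i ∣ (≡.trans n≡d (ℕₚ.*-comm d _)) , ∣.∣-refl)
      n≡m-i : + n ≡ + m ℤ.- + i
      n≡m-i = ≡.trans n≡D (≡.trans (cong (λ d → + d ℤ.* (+ m ℤ.- + i)) d≡1) (ℤₚ.*-identityˡ _))
      n≡ : n ≡ m ∸ i
      n≡ with i ℕ.≤? m
      ... | yes i≤m = ℤₚ.+-injective (≡.trans n≡m-i (≡.trans (ℤₚ.m-n≡m⊖n m i) (ℤₚ.⊖-≥ i≤m)))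
      ... | no i≰m = contradiction (≡.trans n≡m-i (≡.trans (ℤₚ.m-n≡m⊖n m i) (ℤₚ.⊖-< (ℕₚ.≰⇒> i≰m)))) (neg (i ∸ m) (ℕₚ.m<n⇒0<n∸m (ℕₚ.≰⇒> i≰m)))
        where
        neg : ∀ k → 0 < k → + n ≢ ℤ.- (+ k)
        neg (suc k) _ ()

    2*≢0 : ∀ {i} → i ≢ 0ℤ → + 2 ℤ.* i ≢ 0ℤ
    2*≢0 i≢0 h with ℤₚ.i*j≡0⇒i≡0∨j≡0 (+ 2) h
    ... | inj₂ i≡0 = i≢0 i≡0

    Q∈L : L Q
    Q∈L = E∈L _

    uv : u * v ≈ 1#
    uv = E-inverse r (ℤ.- r) (ℤₚ.+-inverseʳ r)

    1-Q : ∀ i → 1# - E (+ 2 ℤ.* (D ℤ.* + suc i)) ≈ 1# - Q * pw Q i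
    1-Q i = +-congˡ (-‿cong (trans (E-cong (e-Q D (+ i)))
      (trans (E-+ _ _) (*-cong (E-cong (≡.sym 2d≡)) (sym (Q-pw i))))))

    1-a : ∀ i → 1# - E (+ 2 ℤ.* (+ n ℤ.+ D ℤ.* (+ i ℤ.- + m))) ≈ 1# - a * pw Q i
    1-a i = +-congˡ (-‿cong (trans (E-cong (≡.trans (e-a (+ n) D (+ i) (+ m))
        (cong (λ r → r ℤ.+ r ℤ.+ + 2 ℤ.* D ℤ.* + i) (≡.sym r≡))))
      (trans (E-+ _ _) (*-cong (E-+ r r) (sym (Q-pw i))))))

    1-u : ∀ j → 1# - E (+ n ℤ.+ D ℤ.* (+ (2 ℕ.* j) ℤ.- + m)) ≈ 1# - u * pw Q j
    1-u j = +-congˡ (-‿cong (trans (E-cong (≡.trans (cong (λ z → + n ℤ.+ D ℤ.* (z ℤ.- + m)) (ℤₚ.pos-* 2 j))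
        (≡.trans (e-u (+ n) D (+ j) (+ m))
        (cong (λ r → r ℤ.+ + 2 ℤ.* D ℤ.* + j) (≡.sym r≡)))))
      (trans (E-+ _ _) (*-congˡ (sym (Q-pw j))))))

    Q≉0 : ∀ i → ¬ 1# - Q * pw Q i ≈ 0#
    Q≉0 i = ≉0-resp (1-Q i) (E-≉0 (2*≢0 (λ h → case ℤₚ.i*j≡0⇒i≡0∨j≡0 D h of λ { (inj₁ d≡0) → contradiction 0<d (λ 0<d → ℕₚ.<-irrefl (≡.sym (ℤₚ.+-injective d≡0)) 0<d) ; (inj₂ ()) })))

    a≉0 : ∀ i → ¬ 1# - a * pw Q i ≈ 0#
    a≉0 i = ≉0-resp (1-a i) (E-≉0 (2*≢0 (shifted≢0 i)))

    u≉0 : ∀ j → ¬ 1# - u * pw Q j ≈ 0#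
    u≉0 j = ≉0-resp (1-u j) (E-≉0 (shifted≢0 (2 ℕ.* j)))

    unit-Q : ∀ i → suc i < n → Unit (1# - Q * pw Q i)
    unit-Q i i<n = Unit-resp (1-Q i) (unit-E 0ℤ (+ suc i) (λ ()) i<n (≡.sym (ℤₚ.+-identityˡ _)) ≡.refl)

    x = E (+ 2 ℤ.* + n)
    y = E (-1ℤ ℤ.* (+ 2 ℤ.* + n))

    x≈ : x ≈ a * pw Q m
    x≈ = trans (E-cong (≡.trans (e-n (+ n) D (+ m)) (cong (λ r → r ℤ.+ r ℤ.+ + 2 ℤ.* D ℤ.* + m) (≡.sym r≡))))
      (trans (E-+ _ _) (*-cong (E-+ r r) (sym (Q-pw m))))

    xy : x * y ≈ 1#
    xy = E-inverse _ _ (≡.trans (cong (λ z → + 2 ℤ.* + n ℤ.+ z) (ℤₚ.-1*i≡-i _)) (ℤₚ.+-inverseʳ (+ 2 ℤ.* + n)))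

    1-xy : ∀ t i {z} → z ≈ E (t ℤ.* (+ 2 ℤ.* + n)) → 1# - E (+ 2 ℤ.* (t ℤ.* + n ℤ.+ D ℤ.* + suc i)) ≈ 1# - Q * z * pw Q i
    1-xy t i z≈ = +-congˡ (-‿cong (trans (E-cong (e-xy (+ n) D (+ i) t))
      (trans (E-+ _ _) (*-cong (trans (E-+ _ _) (*-cong (E-cong (≡.sym 2d≡)) (sym z≈))) (sym (Q-pw i))))))

    unit-x : ∀ i → i < m → Unit (1# - Q * x * pw Q i)
    unit-x i i<m = Unit-resp (1-xy 1ℤ i (E-cong (≡.sym (ℤₚ.*-identityˡ _)))) (unit-E 1ℤ (+ suc i) (λ ()) (ℕₚ.≤-<-trans i<m m<n) ≡.refl ≡.refl)

    unit-y : ∀ i → i < m → Unit (1# - Q * y * pw Q i)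
    unit-y i i<m = Unit-resp (1-xy -1ℤ i refl) (unit-E -1ℤ (+ suc i) (λ ()) (ℕₚ.≤-<-trans i<m m<n) ≡.refl ≡.refl)

    ∣i-m∣<n : ∀ i → i ℕ.≤ m ℕ.+ m → ℤ.∣ + i ℤ.- + m ∣ < n
    ∣i-m∣<n i i≤2m = ℕₚ.≤-<-trans (ℕₚ.≤-trans (ℕₚ.≤-reflexive (cong ℤ.∣_∣ (ℤₚ.m-n≡m⊖n i m))) bound) m<n
      where
      bound : ℤ.∣ i ℤ.⊖ m ∣ ℕ.≤ m
      bound with ℕₚ.≤-total i m
      ... | inj₁ i≤m = ℕₚ.≤-trans (ℕₚ.≤-reflexive (ℤₚ.∣⊖∣-≤ i≤m)) (ℕₚ.m∸n≤m m i)
      ... | inj₂ m≤i = ℕₚ.≤-trans (ℕₚ.≤-reflexive (≡.trans (ℤₚ.∣m⊖n∣≡∣n⊖m∣ i m) (ℤₚ.∣⊖∣-≤ m≤i))) (ℕₚ.m≤n+o⇒m∸n≤o i m i≤2m)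

    i-m≢0 : ∀ {i} → i ≢ m → + i ℤ.- + m ≢ 0ℤ
    i-m≢0 i≢m h = i≢m (ℤₚ.+-injective (ℤₚ.i-j≡0⇒i≡j _ _ h))

    shift-form : ∀ j → + n ℤ.+ D ℤ.* j ≡ 1ℤ ℤ.* + n ℤ.+ D ℤ.* j
    shift-form j = cong (ℤ._+ D ℤ.* j) (≡.sym (ℤₚ.*-identityˡ (+ n)))

    unit-a : ∀ i → i < m → Unit (1# - a * pw Q i)
    unit-a i i<m = Unit-resp (1-a i) (unit-E 1ℤ (+ i ℤ.- + m) (i-m≢0 (ℕₚ.<⇒≢ i<m)) (∣i-m∣<n i (ℕₚ.≤-trans (ℕₚ.<⇒≤ i<m) (ℕₚ.m≤m+n m m))) (shift-form _) ≡.refl)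

    E-double : ∀ i → E (+ 2 ℤ.* i) ≈ E i * E i
    E-double i = trans (E-cong (e-2 i)) (E-+ i i)

    factor-1-E : ∀ i → (1# - E i) * (1# + E i) ≈ 1# - E (+ 2 ℤ.* i)
    factor-1-E i = trans (solve 1 (λ e → (con 1ℤ :- e) :* (con 1ℤ :+ e) := con 1ℤ :- e :* e) refl (E i)) (+-congˡ (-‿cong (sym (E-double i))))

    -- Here `u Q^j = q^e` with `e = n + d (2j - m)`. If `2j ≠ m`, then `|2j - m| ≤ m < n` makes
    -- `1 - q^(2e)` a unit, hence also its divisor `1 - q^e`. If `2j = m`, the quotient is
    -- `1 + q^n`.
    pole : ∀ j → j ℕ.≤ m → L ((1# - x) * inv (1# - u * pw Q j))
    pole j j≤m with 2 ℕ.* j ℕ.≟ m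
    ... | no 2j≢m = L-* (L-1- (E∈L _)) (proj₂ (Unit-resp (1-u j) (Unit-intro
        (trans (trans (sym (*-assoc _ _ _)) (*-congʳ (factor-1-E e))) (inverse (proj₁ unit)))
        (L-* (L-+ L-1 (E∈L e)) (proj₂ unit)))))
      where
      e = + n ℤ.+ D ℤ.* (+ (2 ℕ.* j) ℤ.- + m)
      unit : Unit (1# - E (+ 2 ℤ.* e))
      unit = unit-E 1ℤ (+ (2 ℕ.* j) ℤ.- + m) (i-m≢0 2j≢m)
        (∣i-m∣<n (2 ℕ.* j) (ℕₚ.≤-trans (ℕₚ.≤-reflexive (cong (j ℕ.+_) (ℕₚ.+-identityʳ j))) (ℕₚ.+-mono-≤ j≤m j≤m))) (shift-form _) ≡.refl
    ... | yes 2j≡m = L-resp (lc₂ (- (1# + e)) i (inverse (u≉0 j)) (trans (*-congʳ w≈) (factor-1-E (+ n)))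
        (solve 4 (λ e i w x → con 1ℤ :+ e := (con 1ℤ :- x) :* i :+ (:- (con 1ℤ :+ e)) :* (w :* i :- con 1ℤ) :+ i :* (w :* (con 1ℤ :+ e) :- (con 1ℤ :- x)))
          refl e i w x)) (L-+ L-1 (E∈L (+ n)))
      where
      e = E (+ n)
      w = 1# - u * pw Q j
      i = inv w
      w≈ : w ≈ 1# - e
      w≈ = trans (sym (1-u j)) (+-congˡ (-‿cong (E-cong (≡.trans (cong (λ z → + n ℤ.+ D ℤ.* (+ z ℤ.- + m)) 2j≡m)
        (≡.trans (cong (λ z → + n ℤ.+ D ℤ.* z) (ℤₚ.+-inverseʳ (+ m))) (≡.trans (cong (λ z → + n ℤ.+ z) (ℤₚ.*-zeroʳ D)) (ℤₚ.+-identityʳ (+ n))))))))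

    inv-cong : ∀ {w z} → ¬ z ≈ 0# → w ≈ z → inv w ≈ inv z
    inv-cong z≉0 w≈z = unique (trans (*-congʳ (sym w≈z)) (inverse (≉0-resp (sym w≈z) z≉0))) (inverse z≉0)

    inv-* : ∀ {w z} → ¬ w ≈ 0# → ¬ z ≈ 0# → inv (w * z) ≈ inv w * inv z
    inv-* w≉0 z≉0 = unique (inverse (≉0-* w≉0 z≉0))
      (trans (solve 4 (λ w z i j → w :* z :* (i :* j) := w :* i :* (z :* j)) refl _ _ _ _) (trans (*-cong (inverse w≉0) (inverse z≉0)) (*-identityˡ 1#)))

    1-a≉0 : ¬ 1# - a ≈ 0#
    1-a≉0 = ≉0-resp (+-congˡ (-‿cong (*-identityʳ a))) (a≉0 0)

    1+u≉0 : ¬ 1# + u ≈ 0#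
    1+u≉0 h = 1-a≉0 (trans (solve 1 (λ u → con 1ℤ :- u :* u := (con 1ℤ :+ u) :* (con 1ℤ :- u)) refl u) (trans (*-congʳ h) (zeroˡ _)))

    P-poch : ∀ e {z} → E e ≈ z → ∀ k → P e (2 ℕ.* d) k ≈ poch z k
    P-poch e h zero = refl
    P-poch e h (suc k) = *-cong (P-poch e h k) (+-congˡ (-‿cong (trans (E-+ _ _) (*-cong h (trans (E-cong (≡.trans (ℤₚ.pos-* (2 ℕ.* d) k) (cong (ℤ._* + k) 2d≡))) (sym (Q-pw k)))))))

    ω-link : ∀ k → sg k * E (D ℤ.* + k ℤ.* + k ℤ.+ + k ℤ.* (D ℤ.- r)) ≈ ω v k
    ω-link zero = trans (*-identityˡ _) (trans (E-cong (cong (ℤ._+ 0ℤ) (ℤₚ.*-zeroʳ (D ℤ.* 0ℤ)))) E-0)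
    ω-link (suc k) = trans (*-congˡ (trans (E-cong (e-ω D (+ k) r)) (trans (E-+ _ _) (*-congʳ (trans (E-+ _ _) (*-congˡ (trans (E-+ _ _) (*-cong (sym (Q-pw k)) (E-cong (≡.sym 2d≡))))))))))
      (lc₁ (- (pw Q k * Q * v)) (ω-link k)
        (solve 6 (λ s e p q v w → (:- con 1ℤ) :* s :* (e :* (p :* q) :* v) := (:- (w :* (p :* q) :* v)) :+ (:- (p :* q :* v)) :* (s :* e :- w)) refl (sg k) _ (pw Q k) Q v _))

    c-link : ∀ k → c′ k ≈ SC.c k
    c-link k = trans
      (*-cong (*-congˡ (*-cong (*-cong (+-congˡ num) (*-cong (P-poch _ (E-double r) k) (P-poch _ (E-double r) k)))
          (trans (inv-cong (≉0-* 1+u≉0 (≉0-* pq pq)) (*-congˡ (*-cong (P-poch _ refl k) (P-poch _ refl k))))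
            (trans (inv-* 1+u≉0 (≉0-* pq pq)) (*-congˡ (inv-* pq pq))))))
        (E-cong (cong (ℤ._+ + k ℤ.* (D ℤ.- r)) (≡.trans (ℤₚ.pos-* (d ℕ.* k) k) (cong (ℤ._* + k) (ℤₚ.pos-* d k))))))
      (lc₁ ((1# + u * pw Q k) * inv (1# + u) * (poch a k * poch a k) * (inv (poch Q k) * inv (poch Q k))) (ω-link k)
        (solve 7 (λ s l p i j e w → s :* ((l :* p) :* (i :* j)) :* e := w :* l :* i :* p :* j :+ l :* i :* p :* j :* (s :* e :- w)) refl _ _ _ _ _ _ _))
      where
      pq : ¬ poch Q k ≈ 0#
      pq = SC.poch-≉0 k Q≉0
      num : E (+ (2 ℕ.* d ℕ.* k) ℤ.+ r) ≈ u * pw Q k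
      num = trans (E-+ _ _) (trans (*-comm _ _) (*-congˡ (trans (E-cong (≡.trans (ℤₚ.pos-* (2 ℕ.* d) k) (cong (ℤ._* + k) 2d≡))) (sym (Q-pw k)))))

    Qu≉0 : ∀ i → ¬ 1# - Q * u * pw Q i ≈ 0#
    Qu≉0 i = ≉0-resp (+-congˡ (-‿cong (solve 3 (λ u q p → u :* (p :* q) := q :* u :* p) refl u Q (pw Q i)))) (u≉0 (suc i))

    s-link : ∀ k → s′ k ≈ SC.s k
    s-link k = *-cong (*-cong (*-cong (P-poch _ (E-double r) k) (P-poch _ refl k))
        (inv-cong (≉0-* (SC.poch-≉0 k Q≉0) (SC.poch-≉0 k Qu≉0)) (*-cong (P-poch _ refl k) (P-poch _ (E-+ _ r) k))))
      (trans (E-cong (≡.trans (cong (ℤ._* (D ℤ.- r)) (ℤₚ.pos-* 2 k)) (≡.trans (e-s D (+ k) r) (cong (λ z → (z ℤ.+ (ℤ.- r ℤ.+ ℤ.- r)) ℤ.* + k) (≡.sym 2d≡)))))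
        (trans (sym (E-pw _ k)) (pw-cong k (trans (E-+ _ _) (*-congˡ (E-+ _ _))))))

    -- The square is `a^(2k) Q^(k(k-1))`. At `k = m`, `d m = n - r` turns its exponent into
    -- `2 m (n + r - d)`, the one in the theorem.
    γ-link : ∀ k → γ a k * γ a k ≈ E (+ 2 ℤ.* + k ℤ.* (r ℤ.+ r ℤ.+ D ℤ.* (+ k ℤ.- 1ℤ)))
    γ-link zero = trans (*-identityˡ 1#) (trans (sym E-0) (E-cong (≡.sym (ℤₚ.*-zeroˡ (r ℤ.+ r ℤ.+ D ℤ.* (0ℤ ℤ.- 1ℤ))))))
    γ-link (suc k) = trans (solve 2 (λ g b → (:- (g :* b)) :* (:- (g :* b)) := g :* g :* (b :* b)) refl (γ a k) (a * pw Q k))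
      (trans (*-cong (γ-link k) (*-cong step step)) (trans (*-congˡ (sym (E-+ _ _))) (trans (sym (E-+ _ _)) (E-cong (≡.sym (e-γ D (+ k) r))))))
      where
      step : a * pw Q k ≈ E (r ℤ.+ r ℤ.+ + 2 ℤ.* D ℤ.* + k)
      step = trans (*-cong (sym (E-+ r r)) (Q-pw k)) (sym (E-+ _ _))

    Z : C
    Z = (1# - x) * inv (1# - a) * γ a m * ∑ (suc m) SC.s

    qint²≉0 : ¬ qint r * qint r ≈ 0#
    qint²≉0 = ≉0-* q≉0 q≉0
      where
      e≉0 : ¬ 1# - E (+ 2) ≈ 0#
      e≉0 = E-≉0 (λ ())
      q≉0 : ¬ qint r ≈ 0#
      q≉0 = ≉0-* (≉0-resp (+-congˡ (-‿cong (sym (E-double r)))) 1-a≉0) (≉0-intro (trans (*-comm _ _) (inverse e≉0)))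

    rhs-link : rhs′ m ≈ Z * Z
    rhs-link = trans
      (*-cong (*-cong (*-congˡ inv≈) (trans (E-cong (cong (+ 2 ℤ.* + m ℤ.*_) exponent)) (sym (γ-link m)))) (*-cong S≈ S≈))
      (lc₁ ((1# - x) * (1# - x) * (j * j) * (γ a m * γ a m) * (S * S) * (e * i + 1#)) (inverse e≉0)
        (solve 6 (λ x i j e g s → let o = con 1ℤ in
           ((o :- x) :* i) :* ((o :- x) :* i) :* (j :* e :* (j :* e)) :* (g :* g) :* (s :* s)
           := (o :- x) :* j :* g :* s :* ((o :- x) :* j :* g :* s) :+ (o :- x) :* (o :- x) :* (j :* j) :* (g :* g) :* (s :* s) :* (e :* i :+ o) :* (e :* i :- o))
          refl x i j e (γ a m) S))
      where
      e = 1# - E (+ 2)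
      i = inv e
      j = inv (1# - a)
      S = ∑ (suc m) SC.s
      e≉0 : ¬ e ≈ 0#
      e≉0 = E-≉0 (λ ())
      S≈ : ∑ (suc m) s′ ≈ S
      S≈ = ∑-cong (suc m) (λ k _ → s-link k)
      exponent : + n ℤ.+ r ℤ.- D ≡ r ℤ.+ r ℤ.+ D ℤ.* (+ m ℤ.- 1ℤ)
      exponent = ≡.sym (≡.trans (cong (λ r → r ℤ.+ r ℤ.+ D ℤ.* (+ m ℤ.- 1ℤ)) r≡) (≡.trans (e-γ-end (+ n) D (+ m)) (cong (λ r → + n ℤ.+ r ℤ.- D) (≡.sym r≡))))
      w : qint r * (j * e) ≈ 1#
      w = trans (*-congʳ (*-congʳ (+-congˡ (-‿cong (E-double r))))) (trans (solve 4 (λ w i j e → w :* i :* (j :* e) := w :* j :* (e :* i)) refl (1# - a) i j e)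
        (trans (*-cong (inverse 1-a≉0) (inverse e≉0)) (*-identityˡ 1#)))
      w² : qint r * qint r * (j * e * (j * e)) ≈ 1#
      w² = trans (solve 2 (λ q k → q :* q :* (k :* k) := q :* k :* (q :* k)) refl (qint r) (j * e)) (trans (*-cong w w) (*-identityˡ 1#))
      inv≈ : inv (qint r * qint r) ≈ j * e * (j * e)
      inv≈ = unique (inverse qint²≉0) w²

    lhs-link : lhs′ ≈ SC.lhs n
    lhs-link = ∑-cong n (λ k _ → ∑-cong (suc k) (λ j _ → *-cong (c-link j) (c-link (k ∸ j))))

    positive : 0 < m → lhs′ ~ rhs′ m
    positive 0<m = ~-trans (≈⇒~ lhs-link) (~-trans G.congruence (≈⇒~ (sym rhs-link)))
      where
      module G = SC.Generic n m x y 0<m 2m<n uv x≈ xy Q∈L (E∈L _) (E∈L _) (E∈L _) E-modulus unit-Q Q≉0 unit-a a≉0 unit-x unit-y u≉0 pole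

    zero-case : m ≡ 0 → 0 < n → lhs′ ~ rhs′ m
    zero-case m≡0 0<n = ~-trans (≈⇒~ lhs-link) (~-trans (body n ≡.refl 0<n) (≈⇒~ (sym (trans rhs-link (trans (*-cong Z≈1 Z≈1) (*-identityˡ 1#))))))
      where
      r≡n : r ≡ + n
      r≡n = ≡.trans r≡ (≡.trans (cong (λ m → + n ℤ.- D ℤ.* + m) m≡0) (≡.trans (cong (λ z → + n ℤ.- z) (ℤₚ.*-zeroʳ D)) (ℤₚ.+-identityʳ (+ n))))
      x≈a : x ≈ a
      x≈a = trans (E-cong (cong (+ 2 ℤ.*_) (≡.sym r≡n))) (E-double r)
      S≈1 : ∑ (suc m) SC.s ≈ 1#
      S≈1 = trans (reflexive (cong (λ m → ∑ (suc m) SC.s) m≡0)) (trans (+-identityˡ _)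
        (trans (solve 1 (λ j → con 1ℤ :* con 1ℤ :* j :* con 1ℤ := con 1ℤ :* con 1ℤ :* j) refl (inv (1# * 1#))) (inverse (≉0-* 1≉0 1≉0))))
      Z≈1 : Z ≈ 1#
      Z≈1 = trans (*-cong (*-cong (*-congʳ (+-congˡ (-‿cong x≈a))) (reflexive (cong (γ a) m≡0))) S≈1)
        (trans (*-identityʳ _) (trans (*-identityʳ _) (inverse 1-a≉0)))
      -- `n` is a module parameter, so the split into zero and successor is made on a copy.
      body : ∀ n₀ → n₀ ≡ n → 0 < n₀ → SC.lhs n₀ ~ 1#
      body (suc n′) eq _ = SC.Degenerate.congruence n′ uv Q∈L (E∈L _) (E∈L _)
        (IsIdeal.I-resp isIdeal (*-cong (+-congˡ (-‿cong x≈a)) (+-congˡ (-‿cong x≈a))) E-modulus) 1+u≉0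
        (λ i i<n → unit-Q i (≡.subst (suc i <_) eq i<n))
        (one~ d (trans (Q-pw (suc n′)) (E-cong (≡.trans (cong (λ n → + 2 ℤ.* D ℤ.* + n) eq) (e-Qⁿ D (+ n))))))
        -- Since `n` is odd, `θ n = q^(d n (n+1))` is the integral power `a^(d (n+1)/2)`, and
        -- `a ≡ 1` modulo `1 + u`.
        (one~ (d ℕ.* h) (trans (θ-link (suc n′)) (E-cong (≡.trans (cong (λ n → D ℤ.* + n ℤ.* (1ℤ ℤ.+ + n)) eq)
          (≡.trans (cong (λ k → D ℤ.* + n ℤ.* k) (≡.trans (cong +_ (proj₂ odd)) (ℤₚ.pos-* h 2)))
          (≡.trans (e-θⁿ D (+ n) (+ h)) (cong (+ 2 ℤ.* + n ℤ.*_) (≡.sym (ℤₚ.pos-* d h)))))))))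
        where
        h = proj₁ odd
        module M = SC.Mod1+u
        pw~1 : ∀ k → pw a k M.~ 1#
        pw~1 zero = M.~-refl
        pw~1 (suc k) = M.~-trans (M.~-* L-1 (L-* (E∈L r) (E∈L r)) (pw~1 k) (M.congruent (- (1# - u) , L-neg (L-1- (E∈L r)) ,
          solve 1 (λ u → u :* u :- con 1ℤ := (con 1ℤ :+ u) :* (:- (con 1ℤ :- u))) refl u))) (M.≈⇒~ (*-identityʳ 1#))
        one~ : ∀ k {z} → z ≈ E (+ 2 ℤ.* + n ℤ.* + k) → z M.~ 1#
        one~ k z≈ = M.~-trans (M.≈⇒~ (trans z≈ (trans (sym (E-pw _ k)) (pw-cong k x≈a)))) (pw~1 k)
        θ-link : ∀ k → SC.θ k ≈ E (D ℤ.* + k ℤ.* (1ℤ ℤ.+ + k))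
        θ-link zero = trans (sym E-0) (E-cong (≡.sym (cong (ℤ._* 1ℤ) (ℤₚ.*-zeroʳ D))))
        θ-link (suc k) = trans (*-cong (θ-link k) (*-cong (Q-pw k) (E-cong 2d≡))) (trans (*-congˡ (sym (E-+ _ _))) (trans (sym (E-+ _ _)) (E-cong (≡.sym (e-θ D (+ k))))))

    congruence : lhs′ ~ rhs′ m
    congruence = case m ℕ.≟ 0 of λ
      { (yes m≡0) → zero-case m≡0 (ℕₚ.≤-<-trans z≤n m<n)
      ; (no m≢0) → positive (ℕₚ.n≢0⇒n>0 m≢0) }

-- Fractions and localisation

record IsDecidableDomain (R : CommutativeRing 0ℓ 0ℓ) : Set where
  open CommutativeRing R
  field
    zero? : ∀ p → Dec (p ≈ 0#)
    1≉0 : ¬ 1# ≈ 0#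
    *-nonzero : ∀ {p q} → ¬ p ≈ 0# → ¬ q ≈ 0# → ¬ p * q ≈ 0#

module Fractions (R : CommutativeRing 0ℓ 0ℓ) (domain : IsDecidableDomain R) where
  open RingKit R
  open Sums R using (lc₁; lc₂; lc₃)
  open IsDecidableDomain domain

  cancel : ∀ {p x y} → ¬ p ≈ 0# → p * x ≈ p * y → x ≈ y
  cancel {p} {x} {y} p≉0 h with zero? (x - y)
  ... | yes x-y≈0 = lc₁ 1# x-y≈0 (solve 2 (λ x y → x := y :+ con 1ℤ :* (x :- y :- con 0ℤ)) refl x y)
  ... | no x-y≉0 = contradiction
    (lc₁ 1# h (solve 3 (λ p x y → p :* (x :- y) := con 0ℤ :+ con 1ℤ :* (p :* x :- p :* y)) refl p x y)) (*-nonzero p≉0 x-y≉0)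

  record Fraction : Set where
    constructor frac
    field
      num den : C
      den≉0 : ¬ den ≈ 0#
  open Fraction public

  infix 4 _≃_
  record _≃_ (x y : Fraction) : Set where
    constructor cross
    field cross-eq : num x * den y ≈ num y * den x
  open _≃_ public

  infixl 6 _⊕_
  infixl 7 _⊗_
  _⊕_ _⊗_ : Fraction → Fraction → Fraction
  frac a b b≉0 ⊕ frac c d d≉0 = frac (a * d + c * b) (b * d) (*-nonzero b≉0 d≉0)
  frac a b b≉0 ⊗ frac c d d≉0 = frac (a * c) (b * d) (*-nonzero b≉0 d≉0)

  ⊝_ : Fraction → Fraction
  ⊝ frac a b b≉0 = frac (- a) b b≉0

  embed : C → Fraction
  embed p = frac p 1# 1≉0

  ≃-trans : ∀ {x y z} → x ≃ y → y ≃ z → x ≃ z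
  ≃-trans {frac a b _} {frac c d d≉0} {frac e f _} (cross h) (cross k) = cross (cancel d≉0
    (lc₂ f b h k (solve 6 (λ a b c d e f → d :* (a :* f) := d :* (e :* b) :+ f :* (a :* d :- c :* b) :+ b :* (c :* f :- e :* d)) refl a b c d e f)))

  ⊕-cong : ∀ {x x′ y y′} → x ≃ x′ → y ≃ y′ → x ⊕ y ≃ x′ ⊕ y′
  ⊕-cong {frac a b _} {frac a′ b′ _} {frac c d _} {frac c′ d′ _} (cross h) (cross k) = cross
    (lc₂ (d * d′) (b * b′) h k (solve 8 (λ a b a′ b′ c d c′ d′ → (a :* d :+ c :* b) :* (b′ :* d′) := (a′ :* d′ :+ c′ :* b′) :* (b :* d)
       :+ d :* d′ :* (a :* b′ :- a′ :* b) :+ b :* b′ :* (c :* d′ :- c′ :* d)) refl a b a′ b′ c d c′ d′))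

  ⊗-cong : ∀ {x x′ y y′} → x ≃ x′ → y ≃ y′ → x ⊗ y ≃ x′ ⊗ y′
  ⊗-cong {frac a b _} {frac a′ b′ _} {frac c d _} {frac c′ d′ _} (cross h) (cross k) = cross
    (lc₂ (c * d′) (a′ * b) h k (solve 8 (λ a b a′ b′ c d c′ d′ → a :* c :* (b′ :* d′) := a′ :* c′ :* (b :* d)
       :+ c :* d′ :* (a :* b′ :- a′ :* b) :+ a′ :* b :* (c :* d′ :- c′ :* d)) refl a b a′ b′ c d c′ d′))

  ⊝-cong : ∀ {x y} → x ≃ y → ⊝ x ≃ ⊝ y
  ⊝-cong {frac a b _} {frac c d _} (cross h) = cross
    (lc₁ (- 1#) h (solve 4 (λ a b c d → (:- a) :* d := (:- c) :* b :+ (:- con 1ℤ) :* (a :* d :- c :* b)) refl a b c d))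

  fractionRing : CommutativeRing 0ℓ 0ℓ
  fractionRing = record
    { Carrier = Fraction ; _≈_ = _≃_ ; _+_ = _⊕_ ; _*_ = _⊗_ ; -_ = ⊝_ ; 0# = embed 0# ; 1# = embed 1#
    ; isCommutativeRing = record
      { isRing = record
        { +-isAbelianGroup = record
          { isGroup = record
            { isMonoid = record
              { isSemigroup = record
                { isMagma = record
                  { isEquivalence = record { refl = cross refl ; sym = λ h → cross (sym (cross-eq h)) ; trans = ≃-trans }
                  ; ∙-cong = ⊕-cong }
                ; assoc = λ { (frac a b _) (frac c d _) (frac e f _) → cross
                    (solve 6 (λ a b c d e f → ((a :* d :+ c :* b) :* f :+ e :* (b :* d)) :* (b :* (d :* f)) := (a :* (d :* f) :+ (c :* f :+ e :* d) :* b) :* (b :* d :* f)) refl a b c d e f) } }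
              ; identity = (λ { (frac a b _) → cross (solve 2 (λ a b → (con 0ℤ :* b :+ a :* con 1ℤ) :* b := a :* (con 1ℤ :* b)) refl a b) })
                         , (λ { (frac a b _) → cross (solve 2 (λ a b → (a :* con 1ℤ :+ con 0ℤ :* b) :* b := a :* (b :* con 1ℤ)) refl a b) }) }
            ; inverse = (λ { (frac a b _) → cross (solve 2 (λ a b → ((:- a) :* b :+ a :* b) :* con 1ℤ := con 0ℤ :* (b :* b)) refl a b) })
                      , (λ { (frac a b _) → cross (solve 2 (λ a b → (a :* b :+ (:- a) :* b) :* con 1ℤ := con 0ℤ :* (b :* b)) refl a b) })
            ; ⁻¹-cong = ⊝-cong }
          ; comm = λ { (frac a b _) (frac c d _) → cross (solve 4 (λ a b c d → (a :* d :+ c :* b) :* (d :* b) := (c :* b :+ a :* d) :* (b :* d)) refl a b c d) } }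
        ; *-cong = ⊗-cong
        ; *-assoc = λ { (frac a b _) (frac c d _) (frac e f _) → cross (solve 6 (λ a b c d e f → a :* c :* e :* (b :* (d :* f)) := a :* (c :* e) :* (b :* d :* f)) refl a b c d e f) }
        ; *-identity = (λ { (frac a b _) → cross (solve 2 (λ a b → con 1ℤ :* a :* b := a :* (con 1ℤ :* b)) refl a b) })
                     , (λ { (frac a b _) → cross (solve 2 (λ a b → a :* con 1ℤ :* b := a :* (b :* con 1ℤ)) refl a b) })
        ; distrib = (λ { (frac a b _) (frac c d _) (frac e f _) → cross
                      (solve 6 (λ a b c d e f → a :* (c :* f :+ e :* d) :* (b :* d :* (b :* f)) := (a :* c :* (b :* f) :+ a :* e :* (b :* d)) :* (b :* (d :* f))) refl a b c d e f) })
                  , (λ { (frac a b _) (frac c d _) (frac e f _) → cross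
                      (solve 6 (λ a b c d e f → (c :* f :+ e :* d) :* a :* (d :* b :* (f :* b)) := (c :* a :* (f :* b) :+ e :* a :* (d :* b)) :* (d :* f :* b)) refl a b c d e f) }) }
      ; *-comm = λ { (frac a b _) (frac c d _) → cross (solve 4 (λ a b c d → a :* c :* (d :* b) := c :* a :* (b :* d)) refl a b c d) } }
    }

  -- The default value 0 at a vanishing numerator makes inversion total; decidability of zero
  -- selects the branch.
  invert : Fraction → Fraction
  invert (frac a b b≉0) with zero? a
  ... | yes _ = embed 0#
  ... | no a≉0 = frac b a a≉0

  num-≉0 : ∀ {x} → ¬ x ≃ embed 0# → ¬ num x ≈ 0#
  num-≉0 {frac a b _} x≄0 a≈0 = x≄0 (cross (trans (*-congʳ a≈0) (trans (zeroˡ _) (sym (zeroˡ _)))))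

  invert-inverse : ∀ {x} → ¬ x ≃ embed 0# → x ⊗ invert x ≃ embed 1#
  invert-inverse {frac a b b≉0} x≄0 with zero? a
  ... | yes a≈0 = contradiction a≈0 (num-≉0 x≄0)
  ... | no a≉0 = cross (solve 2 (λ a b → a :* b :* con 1ℤ := con 1ℤ :* (b :* a)) refl a b)

-- Proper divisors

∈-properDivisors⁺ : ∀ {d n} → 0 < d → d < n → d ∣ n → d ∈ properDivisors n
∈-properDivisors⁺ {suc d} {suc n} _ (s≤s d<n) d∣n = ∈-filter⁺ (_∣? suc n) (∈-applyUpTo⁺ suc d<n) d∣n

∈-properDivisors⁻ : ∀ {d n} → d ∈ properDivisors n → 0 < d × d < n × d ∣ n
∈-properDivisors⁻ {d} {suc n} h with ∈-filter⁻ (_∣? suc n) {xs = applyUpTo suc n} h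
... | h′ , d∣n with ∈-applyUpTo⁻ suc h′
... | i , i<n , ≡.refl = s≤s z≤n , s≤s i<n , d∣n

properDivisors-unique : ∀ n → Unique (properDivisors n)
properDivisors-unique n = Unique.filter⁺ (_∣? n) (Unique.drop⁺ 1 (Unique.upTo⁺ n))

-- Cop V W: some constant (over ℤ, a nonzero integer) is a combination of V and W, i.e. V and W are coprime over ℚ.
module Bezout (R : CommutativeRing 0ℓ 0ℓ) (Const : CommutativeRing.Carrier R → Set)
  (Const-resp : ∀ {x y} → CommutativeRing._≈_ R x y → Const x → Const y)
  (Const-1 : Const (CommutativeRing.1# R))
  (Const-* : ∀ {x y} → Const x → Const y → Const (CommutativeRing._*_ R x y)) where
  open RingKit R
  open Sums R

  Divides : C → C → Set
  Divides x y = ∃[ k ] y ≈ x * k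

  Cop : C → C → Set
  Cop V W = ∃[ a ] ∃[ b ] ∃[ s ] Const s × a * V + b * W ≈ s

  Cop-sym : ∀ {V W} → Cop V W → Cop W V
  Cop-sym (a , b , s , c , h) = b , a , s , c , trans (+-comm _ _) h

  Cop-1 : ∀ {W} → Cop 1# W
  Cop-1 {W} = 1# , 0# , 1# , Const-1 , solve 1 (λ w → con 1ℤ :* con 1ℤ :+ con 0ℤ :* w := con 1ℤ) refl W

  Cop-resp : ∀ {V V′ W} → V ≈ V′ → Cop V W → Cop V′ W
  Cop-resp h (a , b , s , c , k) = a , b , s , c , trans (+-congʳ (*-congˡ (sym h))) k

  Cop-* : ∀ {V V′ W} → Cop V W → Cop V′ W → Cop (V * V′) W
  Cop-* {V} {V′} {W} (a , b , s , c , h) (a′ , b′ , s′ , c′ , h′) =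
    a * a′ , a * V * b′ + b * (a′ * V′ + b′ * W) , s * s′ , Const-* c c′ ,
    trans (solve 7 (λ a b a′ b′ v v′ w → a :* a′ :* (v :* v′) :+ (a :* v :* b′ :+ b :* (a′ :* v′ :+ b′ :* w)) :* w
       := (a :* v :+ b :* w) :* (a′ :* v′ :+ b′ :* w)) refl a b a′ b′ V V′ W) (*-cong h h′)

  -- A common factor of `V` and `W` divides `U`, which is coprime to `W`; substitution turns this
  -- into a Bézout identity.
  Cop-combination : ∀ {U V W W′} α β → U ≈ α * V + β * W′ → Divides W W′ → Cop U W → Cop V W
  Cop-combination {U} {V} {W} {W′} α β e (k , d) (a , b , s , c , h) = a * α , a * β * k + b , s , c ,
    trans (lc₂ (- a) (- (a * β)) e d (solve 9 (λ u v w w′ α β k a b → a :* α :* v :+ (a :* β :* k :+ b) :* w :=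
       a :* u :+ b :* w :+ (:- a) :* (u :- (α :* v :+ β :* w′)) :+ (:- (a :* β)) :* (w′ :- w :* k)) refl U V W W′ α β k a b)) h

  Cop-dividesˡ : ∀ {V V′ W} → Divides V V′ → Cop V′ W → Cop V W
  Cop-dividesˡ {V} {V′} {W} (k , d) = Cop-combination k 0# (trans d (solve 3 (λ v k w → v :* k := k :* v :+ con 0ℤ :* w) refl V k W)) (1# , sym (*-identityʳ W))

  Divides-trans : ∀ {x y z} → Divides x y → Divides y z → Divides x z
  Divides-trans (k , h) (l , h′) = k * l , trans h′ (trans (*-congʳ h) (*-assoc _ _ _))

  ∏ : (ℕ → C) → List ℕ → C
  ∏ f xs = foldr _*_ 1# (map f xs)

  ∏-middle : ∀ f ys x zs → ∏ f (ys ++ x ∷ zs) ≈ f x * ∏ f (ys ++ zs)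
  ∏-middle f [] x zs = refl
  ∏-middle f (y ∷ ys) x zs = trans (*-congˡ (∏-middle f ys x zs)) (solve 3 (λ y x p → y :* (x :* p) := x :* (y :* p)) refl _ _ _)

  -- The head `x` is cut out of `ys`; since `xs` has no repetitions, its other elements survive in
  -- what remains.
  ∏-subset : ∀ f {xs ys} → Unique xs → (∀ {x} → x ∈ xs → x ∈ ys) → Divides (∏ f xs) (∏ f ys)
  ∏-subset f {[]} [] h = _ , sym (*-identityˡ _)
  ∏-subset f {x ∷ xs} (x∉ ∷ unique) h with ∈-∃++ (h (here ≡.refl))
  ... | ys , zs , ≡.refl with ∏-subset f {xs} {ys ++ zs} unique drop
    where
    drop : ∀ {w} → w ∈ xs → w ∈ ys ++ zs
    drop w∈xs with ∈-++⁻ ys (h (there w∈xs))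
    ... | inj₁ w∈ys = ∈-++⁺ˡ w∈ys
    ... | inj₂ (here ≡.refl) = contradiction ≡.refl (All.lookup x∉ w∈xs)
    ... | inj₂ (there w∈zs) = ∈-++⁺ʳ ys w∈zs
  ... | k , e = k , trans (∏-middle f ys x zs) (trans (*-congˡ e) (sym (*-assoc _ _ _)))

  ∏-Cop : ∀ f {W} {xs} → All (λ x → Cop (f x) W) xs → Cop (∏ f xs) W
  ∏-Cop f [] = Cop-1
  ∏-Cop f (h ∷ hs) = Cop-* h (∏-Cop f hs)

  -- If `a f(x) + b p = t` with `p` the remaining product, then in `t s A` the first summand is
  -- divisible through `p ∣ s A` and the second through `f(x) ∣ A`. The constants accumulate because
  -- coprimality holds over ℚ only.
  ∏-divides : ∀ f {A} xs → All (λ x → Divides (f x) A) xs → AllPairs (λ x y → Cop (f x) (f y)) xs →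
    ∃[ s ] Const s × Divides (∏ f xs) (s * A)
  ∏-divides f {A} [] [] [] = 1# , Const-1 , 1# * A , sym (*-identityˡ _)
  ∏-divides f {A} (x ∷ xs) ((k , h) ∷ hs) (cs ∷ css) with ∏-divides f xs hs css | Cop-sym (∏-Cop f (All.map Cop-sym cs))
  ... | s , s-const , l , e | a , b , t , t-const , e′ = t * s , Const-* t-const s-const , a * l + b * s * k ,
    trans (*-congʳ (*-congʳ (sym e′))) (lc₂ (a * f x) (b * s * ∏ f xs) e h
      (solve 8 (λ a b x p s A l k → (a :* x :+ b :* p) :* s :* A := x :* p :* (a :* l :+ b :* s :* k) :+ a :* x :* (s :* A :- p :* l) :+ b :* s :* p :* (A :- x :* k))
        refl a b (f x) (∏ f xs) s A l k))

  -- The elements `q^n - 1`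

  module Powers (q : C) where
    X : ℕ → C
    X n = pw q n - 1#

    X-multiple : ∀ t g → Divides (X g) (X (t ℕ.* g))
    X-multiple zero g = 0# , trans (-‿inverseʳ 1#) (sym (zeroʳ _))
    X-multiple (suc t) g with X-multiple t g
    ... | k , h = 1# + pw q g * k , trans (+-congʳ (pw-+ q g (t ℕ.* g)))
      (lc₁ (pw q g) h (solve 3 (λ p r k → p :* r :- con 1ℤ := (p :- con 1ℤ) :* (con 1ℤ :+ p :* k) :+ p :* (r :- con 1ℤ :- (p :- con 1ℤ) :* k)) refl _ _ k))

    X-∣ : ∀ {g n} → g ∣ n → Divides (X g) (X n)
    X-∣ {g} (divides t ≡.refl) = X-multiple t g

    nat : ℕ → C
    nat zero = 0#
    nat (suc t) = 1# + nat t

    -- (q^(tg) - 1)/(q^g - 1) ≡ t modulo q^g - 1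
    X-quotient : ∀ t g → ∃[ k ] ∃[ l ] X (t ℕ.* g) ≈ X g * k × k ≈ nat t + X g * l
    X-quotient zero g = 0# , 0# , trans (-‿inverseʳ 1#) (sym (zeroʳ _)) , solve 1 (λ x → con 0ℤ := con 0ℤ :+ x :* con 0ℤ) refl (X g)
    X-quotient (suc t) g with X-quotient t g
    ... | k , l , h , h′ = 1# + pw q g * k , l + k , trans (+-congʳ (pw-+ q g (t ℕ.* g)))
        (lc₁ (pw q g) h (solve 3 (λ p r k → p :* r :- con 1ℤ := (p :- con 1ℤ) :* (con 1ℤ :+ p :* k) :+ p :* (r :- con 1ℤ :- (p :- con 1ℤ) :* k)) refl _ _ k)) ,
      lc₁ 1# h′ (solve 4 (λ p k t l → con 1ℤ :+ p :* k := con 1ℤ :+ t :+ (p :- con 1ℤ) :* (l :+ k) :+ con 1ℤ :* (k :- (t :+ (p :- con 1ℤ) :* l))) refl _ k _ l)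

    X-difference : ∀ d k → X d ≈ X (d ℕ.+ k) - pw q d * X k
    X-difference d k = trans (solve 2 (λ p r → p :- con 1ℤ := p :* r :- con 1ℤ :- p :* (r :- con 1ℤ)) refl _ (pw q k))
      (+-congʳ (+-congʳ (sym (pw-+ q d k))))

    -- A Bézout identity `g + y n = x m` between exponents becomes `X g = X (x m) - q^g X (y n)`,
    -- whose terms are multiples of `X m` and `X n`; the other sign is symmetric.
    X-gcd : ∀ m n → ∃[ α ] ∃[ β ] X (gcd m n) ≈ α * X m + β * X n
    X-gcd m n with Bézout.identity (gcd-GCD m n)
    ... | Bézout.+- x y eq = let (k , h) = X-multiple x m ; (l , h′) = X-multiple y n in k , - (pw q (gcd m n) * l) ,
      trans (X-difference (gcd m n) (y ℕ.* n)) (trans (+-cong (trans (reflexive (≡.cong X eq)) h) (-‿cong (*-congˡ h′)))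
        (solve 5 (λ a k p b l → a :* k :- p :* (b :* l) := k :* a :+ (:- (p :* l)) :* b) refl _ k _ _ l))
    ... | Bézout.-+ x y eq = let (k , h) = X-multiple x m ; (l , h′) = X-multiple y n in - (pw q (gcd m n) * k) , l ,
      trans (X-difference (gcd m n) (x ℕ.* m)) (trans (+-cong (trans (reflexive (≡.cong X eq)) h′) (-‿cong (*-congˡ h)))
        (solve 5 (λ a k p b l → b :* l :- p :* (a :* k) := (:- (p :* k)) :* a :+ l :* b) refl _ k _ _ l))

    -- Coprimality of cyclotomic factors

    module Cyclotomic (nat-Const : ∀ t → Const (nat (suc t))) (X-cancel : ∀ {n x y} → 0 < n → X n * x ≈ X n * y → x ≈ y) (Φ : ℕ → C) where

      -- Kept as a property of one index, since proving it at `n` needs coprimality of the factors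
      -- below `n`, which itself rests on the smaller instances.
      Factors : ℕ → Set
      Factors n = X n ≈ Φ n * ∏ Φ (properDivisors n)

      -- `g` and its proper divisors are proper divisors of `n`, so `Φ n` times some `w` equals
      -- `(q^n - 1) / (q^g - 1)`. That quotient is `n/g` modulo `q^g - 1`, which yields a nonzero
      -- constant as combination.
      Cop-proper : ∀ {g n} → 0 < g → g < n → g ∣ n → Factors g → Factors n → Cop (Φ n) (X g)
      Cop-proper {g} {n} 0<g g<n g∣n@(divides t ≡.refl) fg fn with X-quotient t g | ∏-subset Φ {g ∷ properDivisors g} {properDivisors n} unique subset
        where
        unique : Unique (g ∷ properDivisors g)
        unique = All.tabulate (λ {x} x∈ g≡x → ℕₚ.<-irrefl (≡.sym g≡x) (proj₁ (proj₂ (∈-properDivisors⁻ x∈)))) ∷ properDivisors-unique g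
        subset : ∀ {x} → x ∈ g ∷ properDivisors g → x ∈ properDivisors n
        subset (here ≡.refl) = ∈-properDivisors⁺ 0<g g<n g∣n
        subset (there x∈) = let (0<x , x<g , x∣g) = ∈-properDivisors⁻ x∈ in ∈-properDivisors⁺ 0<x (ℕₚ.<-trans x<g g<n) (∣.∣-trans x∣g g∣n)
      ... | k , l , h , h′ | w , e = w , - l , nat t , nat-Const′ t t≢0 ,
        lc₂ 1# 1# k≈ h′ (solve 6 (λ w l p x t k → w :* p :+ (:- l) :* x := t :+ con 1ℤ :* (p :* w :- k) :+ con 1ℤ :* (k :- (t :+ x :* l))) refl w l (Φ n) (X g) (nat t) k)
        where
        t≢0 : t ≢ 0
        t≢0 ≡.refl = contradiction g<n λ ()
        nat-Const′ : ∀ t → t ≢ 0 → Const (nat t)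
        nat-Const′ zero h = contradiction ≡.refl h
        nat-Const′ (suc t) _ = nat-Const t
        k≈ : Φ n * w ≈ k
        k≈ = X-cancel 0<g (trans (lc₂ (w * Φ n) (- Φ n) fg e
          (solve 6 (λ x w p r g d → x :* (p :* w) := p :* r :+ w :* p :* (x :- g :* d) :+ (:- p) :* (r :- g :* d :* w)) refl (X g) w (Φ n) (∏ Φ (properDivisors n)) (Φ g) (∏ Φ (properDivisors g)))) (trans (sym fn) h))

      Φ-divides : ∀ {n} → Factors n → Divides (Φ n) (X n)
      Φ-divides f = _ , f

      private
        -- A common factor of `Φ d` and `Φ e` divides `q^d - 1` and `q^e - 1`, hence `q^g - 1` for
        -- `g = gcd d e`; but `Φ d` is coprime to that because `g` is a proper divisor of `d`.
        Cop-distinct′ : ∀ {d e} → gcd d e < d → 0 < gcd d e → Factors (gcd d e) → Factors d → Factors e → Cop (Φ e) (Φ d)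
        Cop-distinct′ {d} {e} g<d 0<g fg fd fe with X-gcd d e
        ... | α , β , h = Cop-dividesˡ (Φ-divides fe) (Cop-combination β α (trans h (+-comm _ _)) (Φ-divides fd)
            (Cop-sym (Cop-proper 0<g g<d (gcd[m,n]∣m d e) fg fd)))

      Cop-distinct : ∀ {n d e} → (∀ {m} → 0 < m → m < n → Factors m) → 0 < d → d < n → 0 < e → e < n → d ≢ e → Cop (Φ d) (Φ e)
      Cop-distinct {n} {d} {e} fs 0<d d<n 0<e e<n d≢e with ℕₚ.m≤n⇒m<n∨m≡n (∣.∣⇒≤ {{ℕ.>-nonZero 0<d}} (gcd[m,n]∣m d e))
      ... | inj₁ g<d = Cop-sym (Cop-distinct′ g<d 0<g (fs 0<g (ℕₚ.<-trans g<d d<n)) (fs 0<d d<n) (fs 0<e e<n))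
        where
        0<g : 0 < gcd d e
        0<g = ℕₚ.n≢0⇒n>0 (gcd[m,n]≢0 d e (inj₁ (ℕₚ.n>0⇒n≢0 0<d)))
      ... | inj₂ g≡d = Cop-distinct′ g<e 0<g (fs 0<g (ℕₚ.<-trans g<e e<n)) (fs 0<e e<n) (fs 0<d d<n)
        where
        0<g : 0 < gcd e d
        0<g = ℕₚ.n≢0⇒n>0 (gcd[m,n]≢0 e d (inj₁ (ℕₚ.n>0⇒n≢0 0<e)))
        g<e : gcd e d < e
        g<e = ℕₚ.≤∧≢⇒< (∣.∣⇒≤ {{ℕ.>-nonZero 0<e}} (gcd[m,n]∣m e d)) (λ g≡e → d≢e (∣.∣-antisym
          (≡.subst (_∣ e) g≡d (gcd[m,n]∣n d e)) (≡.subst (_∣ d) g≡e (gcd[m,n]∣n e d))))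

      X-divisible : ∀ n → (∀ {m} → 0 < m → m < n → Factors m) → ∃[ s ] Const s × Divides (∏ Φ (properDivisors n)) (s * X n)
      X-divisible n fs = ∏-divides Φ (properDivisors n)
        (All.tabulate (λ d∈ → let (0<d , d<n , d∣n) = ∈-properDivisors⁻ d∈ in Divides-trans (Φ-divides (fs 0<d d<n)) (X-∣ d∣n)))
        (pairs (properDivisors n) (λ d∈ → d∈) (properDivisors-unique n))
        where
        pairs : ∀ ds → (∀ {d} → d ∈ ds → d ∈ properDivisors n) → Unique ds → AllPairs (λ d e → Cop (Φ d) (Φ e)) ds
        pairs [] h [] = []
        pairs (d ∷ ds) h (d∉ ∷ unique) = All.tabulate (λ {e} e∈ →
            let (0<d , d<n , _) = ∈-properDivisors⁻ (h (here ≡.refl)) ; (0<e , e<n , _) = ∈-properDivisors⁻ (h (there e∈)) in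
            Cop-distinct fs 0<d d<n 0<e e<n (All.lookup d∉ e∈)) ∷ pairs ds (λ e∈ → h (there e∈)) unique

      Cop-nondivisor : ∀ {n e} → 0 < n → (∀ {m} → 0 < m → Factors m) → ¬ n ∣ e → Cop (X e) (Φ n)
      Cop-nondivisor {n} {e} 0<n fs n∤e with X-gcd n e
      ... | α , β , h = Cop-combination β α (trans h (+-comm _ _)) (Φ-divides (fs 0<n)) (Cop-sym (Cop-proper 0<g g<n (gcd[m,n]∣m n e) (fs 0<g) (fs 0<n)))
        where
        0<g : 0 < gcd n e
        0<g = ℕₚ.n≢0⇒n>0 (gcd[m,n]≢0 n e (inj₁ (ℕₚ.n>0⇒n≢0 0<n)))
        g<n : gcd n e < n
        g<n = ℕₚ.≤∧≢⇒< (∣.∣⇒≤ {{ℕ.>-nonZero 0<n}} (gcd[m,n]∣m n e)) (λ g≡n → n∤e (≡.subst (_∣ e) g≡n (gcd[m,n]∣n n e)))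

-- Fractions with denominator coprime to `P`

module LocalFractions (R : CommutativeRing 0ℓ 0ℓ) (domain : IsDecidableDomain R) (Const : CommutativeRing.Carrier R → Set)
  (Const-resp : ∀ {x y} → CommutativeRing._≈_ R x y → Const x → Const y)
  (Const-1 : Const (CommutativeRing.1# R))
  (Const-* : ∀ {x y} → Const x → Const y → Const (CommutativeRing._*_ R x y))
  (q P : CommutativeRing.Carrier R) where
  open RingKit R
  open Sums R
  open IsDecidableDomain domain
  open Fractions R domain
  open Bezout R Const Const-resp Const-1 Const-*
  open Powers q

  -- A · U/V with V coprime to P
  record MultipleOf (A : C) (x : Fraction) : Set where
    constructor multiple
    field
      U V : C
      coprime : Cop V P
      num-eq : num x * V ≈ A * U * den x
  open MultipleOf public

  multiple-resp : ∀ {A x y} → x ≃ y → MultipleOf A x → MultipleOf A y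
  multiple-resp {A} {frac a b b≉0} {frac c d _} (cross e) (multiple U V cop h) = multiple U V cop (cancel b≉0
    (lc₂ (- V) d e h (solve 7 (λ a b c d A U V → b :* (c :* V) := b :* (A :* U :* d) :+ (:- V) :* (a :* d :- c :* b) :+ d :* (a :* V :- A :* U :* b)) refl a b c d A U V)))

  multiple-+ : ∀ {A x y} → MultipleOf A x → MultipleOf A y → MultipleOf A (x ⊕ y)
  multiple-+ {A} {frac a b _} {frac c d _} (multiple U V cop h) (multiple U′ V′ cop′ h′) = multiple (U * V′ + U′ * V) (V * V′) (Cop-* cop cop′)
    (lc₂ (d * V′) (b * V) h h′ (solve 9 (λ a b c d A U V U′ V′ → (a :* d :+ c :* b) :* (V :* V′) := A :* (U :* V′ :+ U′ :* V) :* (b :* d)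
      :+ d :* V′ :* (a :* V :- A :* U :* b) :+ b :* V :* (c :* V′ :- A :* U′ :* d)) refl a b c d A U V U′ V′))

  multiple-* : ∀ {A B x y} → MultipleOf A x → MultipleOf B y → MultipleOf (A * B) (x ⊗ y)
  multiple-* {A} {B} {frac a b _} {frac c d _} (multiple U V cop h) (multiple U′ V′ cop′ h′) = multiple (U * U′) (V * V′) (Cop-* cop cop′)
    (trans (solve 4 (λ a c v w → a :* c :* (v :* w) := a :* v :* (c :* w)) refl a c V V′) (trans (*-cong h h′)
      (solve 6 (λ A B U U′ b d → A :* U :* b :* (B :* U′ :* d) := A :* B :* (U :* U′) :* (b :* d)) refl A B U U′ b d)))

  multiple-A : ∀ {A B x} → A ≈ B → MultipleOf A x → MultipleOf B x
  multiple-A A≈B (multiple U V cop h) = multiple U V cop (trans h (*-congʳ (*-congʳ A≈B)))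

  isSubring : IsSubring fractionRing (MultipleOf 1#)
  isSubring = record
    { L-resp = multiple-resp
    ; L-+ = multiple-+
    ; L-* = λ h k → multiple-A (*-identityˡ 1#) (multiple-* h k)
    ; L-neg = λ { {frac a b _} (multiple U V cop h) → multiple (- U) V cop
        (lc₁ (- 1#) h (solve 4 (λ a b U V → (:- a) :* V := con 1ℤ :* (:- U) :* b :+ (:- con 1ℤ) :* (a :* V :- con 1ℤ :* U :* b)) refl a b U V)) }
    ; L-1 = multiple 1# 1# Cop-1 (solve 0 (con 1ℤ :* con 1ℤ := con 1ℤ :* con 1ℤ :* con 1ℤ) refl) }

  isIdeal : IsIdeal fractionRing (MultipleOf 1#) (MultipleOf P)
  isIdeal = record
    { I-resp = multiple-resp
    ; I-+ = multiple-+
    ; I-* = λ h k → multiple-A (*-identityˡ P) (multiple-* h k)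
    ; I-0 = multiple 0# 1# Cop-1 (solve 1 (λ p → con 0ℤ :* con 1ℤ := p :* con 0ℤ :* con 1ℤ) refl P) }

  localisation : Localisation fractionRing
  localisation = record
    { inv = invert ; inverse = invert-inverse ; 1≉0 = λ (cross h) → 1≉0 (trans (sym (*-identityʳ 1#)) (trans h (zeroˡ 1#)))
    ; L = MultipleOf 1# ; I = MultipleOf P ; isSubring = isSubring ; isIdeal = isIdeal }

  invert∈L : ∀ x → Cop (num x) P → MultipleOf 1# (invert x)
  invert∈L (frac a b b≉0) cop with zero? a
  ... | yes a≈0 = multiple 0# 1# Cop-1 (solve 0 (con 0ℤ :* con 1ℤ := con 1ℤ :* con 0ℤ :* con 1ℤ) refl)
  ... | no a≉0 = multiple b a cop (solve 2 (λ a b → b :* a := con 1ℤ :* b :* a) refl a b)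

  module _ (n : ℕ) (q≉0 : ¬ q ≈ 0#) (X≉0 : ∀ {k} → 0 < k → ¬ X k ≈ 0#) (q-coprime : Cop q P)
    (X-coprime : ∀ {k} → ¬ n ∣.∣ k → Cop (X (2 ℕ.* k)) P) (P-divides : Divides P (X (2 ℕ.* n) * X (2 ℕ.* n))) where

    pw≉0 : ∀ k → ¬ pw q k ≈ 0#
    pw≉0 zero = 1≉0
    pw≉0 (suc k) = *-nonzero (pw≉0 k) q≉0

    E : ℤ → Fraction
    E (+ k) = embed (pw q k)
    E -[1+ k ] = frac 1# (pw q (suc k)) (pw≉0 (suc k))

    private
      E-⊖ : ∀ j k → E (j ℤ.⊖ k) ≃ frac (pw q j) (pw q k) (pw≉0 k)
      E-⊖ j zero = cross refl
      E-⊖ zero (suc k) = cross refl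
      E-⊖ (suc j) (suc k) = ≡.subst (λ i → E i ≃ _) (≡.sym (ℤₚ.[1+m]⊖[1+n]≡m⊖n j k)) (≃-trans (E-⊖ j k)
        (cross (solve 3 (λ j k q → j :* (k :* q) := j :* q :* k) refl (pw q j) (pw q k) q)))

      E-+ : ∀ i j → E (i ℤ.+ j) ≃ E i ⊗ E j
      E-+ (+ i) (+ j) = cross (*-cong (pw-+ q i j) (*-identityʳ 1#))
      E-+ (+ i) -[1+ j ] = ≃-trans (E-⊖ i (suc j)) (cross (solve 2 (λ i j → i :* (con 1ℤ :* j) := i :* con 1ℤ :* j) refl _ _))
      E-+ -[1+ i ] (+ j) = ≃-trans (E-⊖ j (suc i)) (cross (solve 2 (λ i j → j :* (i :* con 1ℤ) := con 1ℤ :* j :* i) refl _ _))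
      E-+ -[1+ i ] -[1+ j ] = cross (*-cong (sym (*-identityˡ 1#)) (trans (sym (pw-+ q (suc i) (suc j))) (reflexive (cong (pw q) (cong suc (ℕₚ.+-suc i j))))))

      1-E : ℤ → Fraction
      1-E i = embed 1# ⊕ ⊝ E i

      num-1-E-+ : ∀ k → num (1-E (+ k)) ≈ - X k
      num-1-E-+ k = solve 1 (λ p → con 1ℤ :* con 1ℤ :+ (:- p) :* con 1ℤ := :- (p :- con 1ℤ)) refl (pw q k)

      num-1-E-neg : ∀ k → num (1-E -[1+ k ]) ≈ X (suc k)
      num-1-E-neg k = solve 1 (λ p → con 1ℤ :* p :+ (:- con 1ℤ) :* con 1ℤ := p :- con 1ℤ) refl (pw q (suc k))

      neg≉0 : ∀ {p} → ¬ p ≈ 0# → ¬ - p ≈ 0#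
      neg≉0 {p} h k = h (trans (sym (-‿involutive p)) (trans (-‿cong k) -0#≈0#))

      zero-num : ∀ {x} → x ≃ embed 0# → num x ≈ 0#
      zero-num {frac a b _} (cross h) = trans (sym (*-identityʳ a)) (trans h (zeroˡ b))

      E-≉0 : ∀ {i} → i ≢ 0ℤ → ¬ 1-E i ≃ embed 0#
      E-≉0 {+ zero} i≢0 h = i≢0 ≡.refl
      E-≉0 {+ suc k} i≢0 h = neg≉0 (X≉0 {suc k} (s≤s z≤n)) (trans (sym (num-1-E-+ (suc k))) (zero-num h))
      E-≉0 { -[1+ k ]} i≢0 h = X≉0 {suc k} (s≤s z≤n) (trans (sym (num-1-E-neg k)) (zero-num h))

      pw-coprime : ∀ k → Cop (pw q k) P
      pw-coprime zero = Cop-1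
      pw-coprime (suc k) = Cop-* (pw-coprime k) q-coprime

      E∈L : ∀ i → MultipleOf 1# (E i)
      E∈L (+ k) = multiple (pw q k) 1# Cop-1 (solve 1 (λ p → p :* con 1ℤ := con 1ℤ :* p :* con 1ℤ) refl _)
      E∈L -[1+ k ] = multiple 1# (pw q (suc k)) (pw-coprime (suc k)) (solve 1 (λ p → con 1ℤ :* p := con 1ℤ :* con 1ℤ :* p) refl _)

      Cop-neg : ∀ {W} → Cop W P → Cop (- W) P
      Cop-neg {W} (a , b , s , c , h) = - a , b , s , c , trans (solve 4 (λ a w b p → (:- a) :* (:- w) :+ b :* p := a :* w :+ b :* p) refl a W b P) h

      num-coprime : ∀ i → Cop (X ℤ.∣ i ∣) P → Cop (num (1-E i)) P
      num-coprime (+ k) cop = Cop-resp (sym (num-1-E-+ k)) (Cop-neg {X k} cop)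
      num-coprime -[1+ k ] cop = Cop-resp (sym (num-1-E-neg k)) cop

      E-unit : ∀ {i} → ¬ (+ n) ∣ₛ.∣ i → MultipleOf 1# (invert (1-E (+ 2 ℤ.* i)))
      E-unit {i} n∤i = invert∈L (1-E (+ 2 ℤ.* i)) (num-coprime (+ 2 ℤ.* i) (≡.subst (λ k → Cop (X k) P) (≡.sym (ℤₚ.abs-* (+ 2) i)) (X-coprime (λ h → n∤i (∣ₛ.∣ᵤ⇒∣ h)))))

      E-modulus : MultipleOf P (1-E (+ 2 ℤ.* + n) ⊗ 1-E (+ 2 ℤ.* + n))
      E-modulus = ≡.subst (λ i → MultipleOf P (1-E i ⊗ 1-E i)) (ℤₚ.pos-* 2 n) (multiple (proj₁ P-divides) 1# Cop-1
        (lc₁ 1# (proj₂ P-divides) (solve 3 (λ p P k → let o = con 1ℤ ; e = o :* o :+ (:- p) :* o in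
           e :* e :* o := P :* k :* (o :* o :* (o :* o)) :+ o :* ((p :- o) :* (p :- o) :- P :* k)) refl (pw q (2 ℕ.* n)) P (proj₁ P-divides))))

    exponential : Exponential fractionRing localisation n
    exponential = record { E = E ; E-0 = cross refl ; E-+ = E-+ ; E-≉0 = E-≉0 ; E∈L = E∈L ; E-unit = E-unit ; E-modulus = E-modulus }

-- Integer polynomials

open import Defs

coeff : Poly → ℕ → ℤ
coeff [] i = 0ℤ
coeff (a ∷ p) zero = a
coeff (a ∷ p) (suc i) = coeff p i

infix 4 _≋_
-- Coefficient lists are not normalised, so equality has to ignore trailing zeros.
record _≋_ (p q : Poly) : Set where
  constructor coeffs
  field at : ∀ i → coeff p i ≡ coeff q i
open _≋_

≋-refl : ∀ {p} → p ≋ p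
≋-refl .at i = ≡.refl

≋-sym : ∀ {p q} → p ≋ q → q ≋ p
≋-sym h .at i = ≡.sym (h .at i)

≋-trans : ∀ {p q r} → p ≋ q → q ≋ r → p ≋ r
≋-trans h k .at i = ≡.trans (h .at i) (k .at i)

≡⇒≋ : ∀ {p q} → p ≡ q → p ≋ q
≡⇒≋ ≡.refl = ≋-refl

∷-cong : ∀ {a b p q} → a ≡ b → p ≋ q → a ∷ p ≋ b ∷ q
∷-cong h k .at zero = h
∷-cong h k .at (suc i) = k .at i

tail-≋ : ∀ {a b p q} → a ∷ p ≋ b ∷ q → p ≋ q
tail-≋ h .at i = h .at (suc i)

tail-≋[] : ∀ {a p} → a ∷ p ≋ [] → p ≋ []
tail-≋[] h .at i = h .at (suc i)

0∷[] : 0ℤ ∷ [] ≋ []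
0∷[] .at zero = ≡.refl
0∷[] .at (suc i) = ≡.refl

coeff-+ : ∀ p q i → coeff (p +ₚ q) i ≡ coeff p i ℤ.+ coeff q i
coeff-+ [] q i = ≡.sym (ℤₚ.+-identityˡ _)
coeff-+ (a ∷ p) [] i = ≡.sym (ℤₚ.+-identityʳ _)
coeff-+ (a ∷ p) (b ∷ q) zero = ≡.refl
coeff-+ (a ∷ p) (b ∷ q) (suc i) = coeff-+ p q i

coeff-· : ∀ c p i → coeff (c ·ₚ p) i ≡ c ℤ.* coeff p i
coeff-· c [] i = ≡.sym (ℤₚ.*-zeroʳ c)
coeff-· c (a ∷ p) zero = ≡.refl
coeff-· c (a ∷ p) (suc i) = coeff-· c p i

coeff-neg : ∀ p i → coeff (-ₚ p) i ≡ ℤ.- coeff p i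
coeff-neg [] i = ≡.refl
coeff-neg (a ∷ p) zero = ≡.refl
coeff-neg (a ∷ p) (suc i) = coeff-neg p i

+ₚ-cong : ∀ {p p′ q q′} → p ≋ p′ → q ≋ q′ → p +ₚ q ≋ p′ +ₚ q′
+ₚ-cong {p} {p′} {q} {q′} h k .at i = ≡.trans (coeff-+ p q i) (≡.trans (cong₂ ℤ._+_ (h .at i) (k .at i)) (≡.sym (coeff-+ p′ q′ i)))

·ₚ-cong : ∀ {c d p q} → c ≡ d → p ≋ q → c ·ₚ p ≋ d ·ₚ q
·ₚ-cong {c} {d} {p} {q} h k .at i = ≡.trans (coeff-· c p i) (≡.trans (cong₂ ℤ._*_ h (k .at i)) (≡.sym (coeff-· d q i)))

-ₚ-cong : ∀ {p q} → p ≋ q → -ₚ p ≋ -ₚ q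
-ₚ-cong {p} {q} h .at i = ≡.trans (coeff-neg p i) (≡.trans (cong ℤ.-_ (h .at i)) (≡.sym (coeff-neg q i)))

+ₚ-assoc : ∀ p q r → p +ₚ q +ₚ r ≋ p +ₚ (q +ₚ r)
+ₚ-assoc p q r .at i = begin
  coeff (p +ₚ q +ₚ r) i                   ≡⟨ ≡.trans (coeff-+ (p +ₚ q) r i) (cong (ℤ._+ coeff r i) (coeff-+ p q i)) ⟩
  coeff p i ℤ.+ coeff q i ℤ.+ coeff r i   ≡⟨ ℤₚ.+-assoc (coeff p i) (coeff q i) (coeff r i) ⟩
  coeff p i ℤ.+ (coeff q i ℤ.+ coeff r i) ≡⟨ ≡.trans (coeff-+ p (q +ₚ r) i) (cong (λ z → coeff p i ℤ.+ z) (coeff-+ q r i)) ⟨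
  coeff (p +ₚ (q +ₚ r)) i                 ∎
  where open ≡.≡-Reasoning

+ₚ-comm : ∀ p q → p +ₚ q ≋ q +ₚ p
+ₚ-comm p q .at i = ≡.trans (coeff-+ p q i) (≡.trans (ℤₚ.+-comm (coeff p i) (coeff q i)) (≡.sym (coeff-+ q p i)))

+ₚ-identityʳ : ∀ p → p +ₚ [] ≋ p
+ₚ-identityʳ p .at i = ≡.trans (coeff-+ p [] i) (ℤₚ.+-identityʳ _)

-ₚ-inverseʳ : ∀ p → p +ₚ (-ₚ p) ≋ []
-ₚ-inverseʳ p .at i = ≡.trans (coeff-+ p (-ₚ p) i) (≡.trans (cong (λ z → coeff p i ℤ.+ z) (coeff-neg p i)) (ℤₚ.+-inverseʳ (coeff p i)))

+ₚ-interchange : ∀ p q r s → p +ₚ q +ₚ (r +ₚ s) ≋ p +ₚ r +ₚ (q +ₚ s)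
+ₚ-interchange p q r s = ≋-trans (+ₚ-assoc p q (r +ₚ s)) (≋-trans (+ₚ-cong {p = p} ≋-refl
  (≋-trans (≋-sym (+ₚ-assoc q r s)) (≋-trans (+ₚ-cong (+ₚ-comm q r) ≋-refl) (+ₚ-assoc r q s)))) (≋-sym (+ₚ-assoc p r (q +ₚ s))))

0·ₚ : ∀ p → 0ℤ ·ₚ p ≋ []
0·ₚ p .at i = coeff-· 0ℤ p i

1·ₚ : ∀ p → 1ℤ ·ₚ p ≋ p
1·ₚ p .at i = ≡.trans (coeff-· 1ℤ p i) (ℤₚ.*-identityˡ _)

·ₚ-+ₚ : ∀ c p q → c ·ₚ (p +ₚ q) ≋ c ·ₚ p +ₚ c ·ₚ q
·ₚ-+ₚ c p q .at i = ≡.trans (coeff-· c (p +ₚ q) i) (≡.trans (cong (c ℤ.*_) (coeff-+ p q i)) (≡.trans (ℤₚ.*-distribˡ-+ c (coeff p i) (coeff q i))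
  (≡.sym (≡.trans (coeff-+ (c ·ₚ p) (c ·ₚ q) i) (cong₂ ℤ._+_ (coeff-· c p i) (coeff-· c q i))))))

+·ₚ : ∀ c d p → (c ℤ.+ d) ·ₚ p ≋ c ·ₚ p +ₚ d ·ₚ p
+·ₚ c d p .at i = ≡.trans (coeff-· (c ℤ.+ d) p i) (≡.trans (ℤₚ.*-distribʳ-+ (coeff p i) c d)
  (≡.sym (≡.trans (coeff-+ (c ·ₚ p) (d ·ₚ p) i) (cong₂ ℤ._+_ (coeff-· c p i) (coeff-· d p i)))))

*·ₚ : ∀ c d p → (c ℤ.* d) ·ₚ p ≋ c ·ₚ (d ·ₚ p)
*·ₚ c d p .at i = ≡.trans (coeff-· (c ℤ.* d) p i) (≡.trans (ℤₚ.*-assoc c d (coeff p i))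
  (≡.sym (≡.trans (coeff-· c (d ·ₚ p) i) (cong (c ℤ.*_) (coeff-· d p i)))))

shift-+ₚ : ∀ p q → 0ℤ ∷ (p +ₚ q) ≋ (0ℤ ∷ p) +ₚ (0ℤ ∷ q)
shift-+ₚ p q = ∷-cong ≡.refl ≋-refl

shift-[] : ∀ {p} → p ≋ [] → 0ℤ ∷ p ≋ []
shift-[] h = ≋-trans (∷-cong ≡.refl h) 0∷[]

·ₚ-shift : ∀ c p → c ·ₚ (0ℤ ∷ p) ≋ 0ℤ ∷ (c ·ₚ p)
·ₚ-shift c p = ∷-cong (ℤₚ.*-zeroʳ c) ≋-refl

*ₚ-zeroʳ : ∀ p → p *ₚ [] ≋ []
*ₚ-zeroʳ [] = ≋-refl
*ₚ-zeroʳ (a ∷ p) = shift-[] (*ₚ-zeroʳ p)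

≋[]-*ₚ : ∀ {p} q → p ≋ [] → p *ₚ q ≋ []
≋[]-*ₚ {[]} q h = ≋-refl
≋[]-*ₚ {a ∷ p} q h = ≋-trans (+ₚ-cong (≋-trans (·ₚ-cong {q = q} (h .at 0) ≋-refl) (0·ₚ q)) (shift-[] (≋[]-*ₚ q (tail-≋[] h)))) ≋-refl

*ₚ-cong : ∀ {p p′ q q′} → p ≋ p′ → q ≋ q′ → p *ₚ q ≋ p′ *ₚ q′
*ₚ-cong {[]} {p′} {q} {q′} h k = ≋-sym (≋[]-*ₚ {p′} q′ (≋-sym h))
*ₚ-cong {a ∷ p} {[]} {q} {q′} h k = ≋[]-*ₚ {a ∷ p} q h
*ₚ-cong {a ∷ p} {b ∷ p′} h k = +ₚ-cong (·ₚ-cong (h .at 0) k) (∷-cong ≡.refl (*ₚ-cong (tail-≋ h) k))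

*ₚ-distribʳ : ∀ r p q → (p +ₚ q) *ₚ r ≋ p *ₚ r +ₚ q *ₚ r
*ₚ-distribʳ r [] q = ≋-refl
*ₚ-distribʳ r (a ∷ p) [] = ≋-sym (+ₚ-identityʳ _)
*ₚ-distribʳ r (a ∷ p) (b ∷ q) = ≋-trans
  (+ₚ-cong (+·ₚ a b r) (≋-trans (∷-cong ≡.refl (*ₚ-distribʳ r p q)) (shift-+ₚ (p *ₚ r) (q *ₚ r))))
  (+ₚ-interchange (a ·ₚ r) (b ·ₚ r) _ _)

·ₚ-*ₚ : ∀ c p q → (c ·ₚ p) *ₚ q ≋ c ·ₚ (p *ₚ q)
·ₚ-*ₚ c [] q = ≋-refl
·ₚ-*ₚ c (a ∷ p) q = ≋-sym (≋-trans (·ₚ-+ₚ c (a ·ₚ q) (0ℤ ∷ (p *ₚ q)))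
  (+ₚ-cong (≋-sym (*·ₚ c a q)) (≋-trans (·ₚ-shift c (p *ₚ q)) (∷-cong ≡.refl (≋-sym (·ₚ-*ₚ c p q))))))

shift-*ₚ : ∀ p q → (0ℤ ∷ p) *ₚ q ≋ 0ℤ ∷ (p *ₚ q)
shift-*ₚ p q = +ₚ-cong {q = 0ℤ ∷ (p *ₚ q)} (0·ₚ q) ≋-refl

*ₚ-assoc : ∀ p q r → p *ₚ q *ₚ r ≋ p *ₚ (q *ₚ r)
*ₚ-assoc [] q r = ≋-refl
*ₚ-assoc (a ∷ p) q r = ≋-trans (*ₚ-distribʳ r (a ·ₚ q) (0ℤ ∷ (p *ₚ q)))
  (+ₚ-cong (·ₚ-*ₚ a q r) (≋-trans (shift-*ₚ (p *ₚ q) r) (∷-cong ≡.refl (*ₚ-assoc p q r))))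

*ₚ-∷ : ∀ p b q → p *ₚ (b ∷ q) ≋ b ·ₚ p +ₚ (0ℤ ∷ (p *ₚ q))
*ₚ-∷ [] b q = ≋-sym 0∷[]
*ₚ-∷ (a ∷ p) b q = ∷-cong (cong (ℤ._+ 0ℤ) (ℤₚ.*-comm a b)) (≋-trans (+ₚ-cong {a ·ₚ q} ≋-refl (*ₚ-∷ p b q))
  (≋-trans (≋-sym (+ₚ-assoc (a ·ₚ q) (b ·ₚ p) _)) (≋-trans (+ₚ-cong (+ₚ-comm (a ·ₚ q) (b ·ₚ p)) ≋-refl) (+ₚ-assoc (b ·ₚ p) (a ·ₚ q) _))))

*ₚ-comm : ∀ p q → p *ₚ q ≋ q *ₚ p
*ₚ-comm [] q = ≋-sym (*ₚ-zeroʳ q)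
*ₚ-comm (a ∷ p) q = ≋-trans (+ₚ-cong {a ·ₚ q} ≋-refl (∷-cong ≡.refl (*ₚ-comm p q))) (≋-sym (*ₚ-∷ q a p))

const-*ₚ : ∀ c p → constₚ c *ₚ p ≋ c ·ₚ p
const-*ₚ c p = ≋-trans (+ₚ-cong {c ·ₚ p} ≋-refl 0∷[]) (+ₚ-identityʳ _)

*ₚ-identityˡ : ∀ p → constₚ 1ℤ *ₚ p ≋ p
*ₚ-identityˡ p = ≋-trans (const-*ₚ 1ℤ p) (1·ₚ p)

polyRing : CommutativeRing 0ℓ 0ℓ
polyRing = record
  { Carrier = Poly ; _≈_ = _≋_ ; _+_ = _+ₚ_ ; _*_ = _*ₚ_ ; -_ = -ₚ_ ; 0# = [] ; 1# = constₚ 1ℤ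
  ; isCommutativeRing = record
    { isRing = record
      { +-isAbelianGroup = record
        { isGroup = record
          { isMonoid = record
            { isSemigroup = record
              { isMagma = record
                { isEquivalence = record { refl = ≋-refl ; sym = ≋-sym ; trans = ≋-trans }
                ; ∙-cong = +ₚ-cong }
              ; assoc = +ₚ-assoc }
            ; identity = (λ p → ≋-refl) , +ₚ-identityʳ }
          ; inverse = (λ p → ≋-trans (+ₚ-comm (-ₚ p) p) (-ₚ-inverseʳ p)) , -ₚ-inverseʳ
          ; ⁻¹-cong = -ₚ-cong }
        ; comm = +ₚ-comm }
      ; *-cong = *ₚ-cong
      ; *-assoc = *ₚ-assoc
      ; *-identity = *ₚ-identityˡ , (λ p → ≋-trans (*ₚ-comm p _) (*ₚ-identityˡ p))
      ; distrib = (λ p q r → ≋-trans (*ₚ-comm p (q +ₚ r)) (≋-trans (*ₚ-distribʳ p q r) (+ₚ-cong (*ₚ-comm q p) (*ₚ-comm r p)))) , *ₚ-distribʳ }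
    ; *-comm = *ₚ-comm }
  }

IsZero⇒≋[] : ∀ {p} → IsZero p → p ≋ []
IsZero⇒≋[] [] = ≋-refl
IsZero⇒≋[] (h ∷ hs) = ≋-trans (∷-cong h (IsZero⇒≋[] hs)) 0∷[]

≋[]⇒IsZero : ∀ {p} → p ≋ [] → IsZero p
≋[]⇒IsZero {[]} h = []
≋[]⇒IsZero {a ∷ p} h = h .at 0 ∷ ≋[]⇒IsZero (tail-≋[] h)

≋⇒≈ₚ : ∀ {p q} → p ≋ q → p ≈ₚ q
≋⇒≈ₚ {p} {q} h = ≋[]⇒IsZero (≋-trans (+ₚ-cong {q = -ₚ q} h ≋-refl) (-ₚ-inverseʳ q))

zero? : ∀ p → Dec (p ≋ [])
zero? p with All.all? (ℤ._≟ 0ℤ) p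
... | yes h = yes (IsZero⇒≋[] h)
... | no ¬h = no (λ h → ¬h (≋[]⇒IsZero h))

VanishesFrom : ℕ → Poly → Set
VanishesFrom n p = ∀ i → n ℕ.≤ i → coeff p i ≡ 0ℤ

vanishes-length : ∀ p → VanishesFrom (length p) p
vanishes-length [] i _ = ≡.refl
vanishes-length (a ∷ p) (suc i) (s≤s h) = vanishes-length p i h

vanishes-weaken : ∀ {m n p} → m ℕ.≤ n → VanishesFrom m p → VanishesFrom n p
vanishes-weaken m≤n h i n≤i = h i (ℕₚ.≤-trans m≤n n≤i)

leading : ∀ p → ¬ p ≋ [] → ∃[ d ] coeff p d ≢ 0ℤ × VanishesFrom (suc d) p
leading [] p≉0 = contradiction ≋-refl p≉0
leading (a ∷ p) p≉0 with zero? p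
... | no p≉[] = let (d , h , v) = leading p p≉[] in suc d , h , λ { (suc i) (s≤s l) → v i l }
... | yes p≋[] = 0 , (λ a≡0 → p≉0 (≋-trans (∷-cong a≡0 p≋[]) 0∷[])) , λ { (suc i) _ → p≋[] .at i }

coeff-*-top : ∀ p q d e → VanishesFrom (suc d) p → VanishesFrom (suc e) q →
  coeff (p *ₚ q) (d ℕ.+ e) ≡ coeff p d ℤ.* coeff q e
coeff-*-top [] q d e vp vq = ≡.refl
coeff-*-top (a ∷ p) q zero e vp vq = begin
  coeff (a ·ₚ q +ₚ (0ℤ ∷ (p *ₚ q))) e                  ≡⟨ coeff-+ (a ·ₚ q) _ e ⟩
  coeff (a ·ₚ q) e ℤ.+ coeff (0ℤ ∷ (p *ₚ q)) e         ≡⟨ cong₂ ℤ._+_ (coeff-· a q e) (shift-[] (≋[]-*ₚ {p} q (coeffs λ i → vp (suc i) (s≤s z≤n))) .at e) ⟩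
  a ℤ.* coeff q e ℤ.+ 0ℤ                               ≡⟨ ℤₚ.+-identityʳ _ ⟩
  a ℤ.* coeff q e                                      ∎
  where open ≡.≡-Reasoning
coeff-*-top (a ∷ p) q (suc d) e vp vq = begin
  coeff (a ·ₚ q +ₚ (0ℤ ∷ (p *ₚ q))) (suc (d ℕ.+ e))                ≡⟨ coeff-+ (a ·ₚ q) _ (suc (d ℕ.+ e)) ⟩
  coeff (a ·ₚ q) (suc (d ℕ.+ e)) ℤ.+ coeff (p *ₚ q) (d ℕ.+ e)      ≡⟨ cong₂ ℤ._+_ lem (coeff-*-top p q d e (λ i l → vp (suc i) (s≤s l)) vq) ⟩
  0ℤ ℤ.+ coeff p d ℤ.* coeff q e                                   ≡⟨ ℤₚ.+-identityˡ _ ⟩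
  coeff p d ℤ.* coeff q e                                          ∎
  where
  open ≡.≡-Reasoning
  lem : coeff (a ·ₚ q) (suc (d ℕ.+ e)) ≡ 0ℤ
  lem = ≡.trans (coeff-· a q _) (≡.trans (cong (a ℤ.*_) (vq _ (s≤s (ℕₚ.m≤n+m e d)))) (ℤₚ.*-zeroʳ a))

*ₚ-nonzero : ∀ {p q} → ¬ p ≋ [] → ¬ q ≋ [] → ¬ p *ₚ q ≋ []
*ₚ-nonzero {p} {q} p≉0 q≉0 pq≋0 with leading p p≉0 | leading q q≉0
... | d , hp , vp | e , hq , vq with ℤₚ.i*j≡0⇒i≡0∨j≡0 (coeff p d) (≡.trans (≡.sym (coeff-*-top p q d e vp vq)) (pq≋0 .at (d ℕ.+ e)))
... | inj₁ h = hp h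
... | inj₂ h = hq h

-- The top coefficient of `q` times the nonzero leading coefficient of `p` appears in the product,
-- so the bound on `q` can be lowered one step at a time from its length down to `n`.
degree-bound : ∀ {p} q n → ¬ p ≋ [] → VanishesFrom n (p *ₚ q) → VanishesFrom n q
degree-bound {p} q n p≉0 v with leading p p≉0
... | d , hp , vp = descend (length q) (vanishes-length q)
  where
  descend : ∀ N → VanishesFrom N q → VanishesFrom n q
  descend zero vq i _ = vq i z≤n
  descend (suc N) vq with n ℕ.≤? N
  ... | no n≰N = vanishes-weaken {p = q} (ℕₚ.≰⇒> n≰N) vq
  ... | yes n≤N = descend N step
    where
    top : coeff q N ≡ 0ℤ
    top with ℤₚ.i*j≡0⇒i≡0∨j≡0 (coeff p d) (≡.trans (≡.sym (coeff-*-top p q d N vp vq)) (v (d ℕ.+ N) (ℕₚ.≤-trans n≤N (ℕₚ.m≤n+m N d))))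
    ... | inj₁ h = contradiction h hp
    ... | inj₂ h = h
    step : VanishesFrom N q
    step i N≤i with ℕₚ.m≤n⇒m<n∨m≡n N≤i
    ... | inj₁ N<i = vq i N<i
    ... | inj₂ ≡.refl = top

-- Cyclotomic polynomials

coeff-tail0 : ∀ p i → coeff (tail0 p) i ≡ coeff p (suc i)
coeff-tail0 [] i = ≡.refl
coeff-tail0 (a ∷ p) i = ≡.refl

head0≡ : ∀ p → head0 p ≡ coeff p 0
head0≡ [] = ≡.refl
head0≡ (a ∷ p) = ≡.refl

coeff-*-0 : ∀ p q → coeff (p *ₚ q) 0 ≡ coeff p 0 ℤ.* coeff q 0
coeff-*-0 [] q = ≡.refl
coeff-*-0 (a ∷ p) q = ≡.trans (coeff-+ (a ·ₚ q) _ 0) (≡.trans (ℤₚ.+-identityʳ _) (coeff-· a q 0))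

coeff-*-suc : ∀ p q i → coeff (p *ₚ q) (suc i) ≡ coeff q 0 ℤ.* coeff p (suc i) ℤ.+ coeff (p *ₚ tail0 q) i
coeff-*-suc p [] i = ≡.trans (*ₚ-zeroʳ p .at (suc i)) (≡.sym (≡.cong₂ ℤ._+_ (ℤₚ.*-zeroˡ (coeff p (suc i))) (*ₚ-zeroʳ p .at i)))
coeff-*-suc p (b ∷ q) i = ≡.trans (*ₚ-∷ p b q .at (suc i)) (≡.trans (coeff-+ (b ·ₚ p) _ (suc i)) (cong (ℤ._+ coeff (p *ₚ q) i) (coeff-· b p (suc i))))

seriesDiv-vanishes : ∀ N a b → VanishesFrom N (seriesDiv N a b)
seriesDiv-vanishes zero a b i _ = ≡.refl
seriesDiv-vanishes (suc N) a b (suc i) (s≤s h) = seriesDiv-vanishes N _ b i h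

-- The factor `c` admits a quotient `w` that is exact only up to a constant. As the constant term of
-- `b` squares to 1, the emitted coefficient times `c` is the head of `w`, and the tails satisfy the
-- same hypothesis with the same `c`.
seriesDiv-coeff : ∀ N a b w c → coeff b 0 ℤ.* coeff b 0 ≡ 1ℤ → (∀ i → c ℤ.* coeff a i ≡ coeff (b *ₚ w) i) →
  ∀ i → i < N → c ℤ.* coeff (seriesDiv N a b) i ≡ coeff w i
seriesDiv-coeff (suc N) a b w c unit h = λ { zero _ → lead ; (suc i) (s≤s i<N) → ≡.trans (seriesDiv-coeff N _ b (tail0 w) c unit rest i i<N) (coeff-tail0 w i) }
  where
  open ℤ-Solver
  open ≡.≡-Reasoning
  b₀ = coeff b 0
  e = head0 b ℤ.* head0 a
  lead : c ℤ.* e ≡ coeff w 0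
  lead = begin
    c ℤ.* e ≡⟨ cong₂ (λ x y → c ℤ.* (x ℤ.* y)) (head0≡ b) (head0≡ a) ⟩
    c ℤ.* (b₀ ℤ.* coeff a 0) ≡⟨ solve 3 (λ c b a → c :* (b :* a) := b :* (c :* a)) ≡.refl c b₀ (coeff a 0) ⟩
    b₀ ℤ.* (c ℤ.* coeff a 0) ≡⟨ cong (b₀ ℤ.*_) (≡.trans (h 0) (coeff-*-0 b w)) ⟩
    b₀ ℤ.* (b₀ ℤ.* coeff w 0) ≡⟨ ℤₚ.*-assoc b₀ b₀ _ ⟨
    b₀ ℤ.* b₀ ℤ.* coeff w 0 ≡⟨ cong (ℤ._* coeff w 0) unit ⟩
    1ℤ ℤ.* coeff w 0 ≡⟨ ℤₚ.*-identityˡ _ ⟩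
    coeff w 0 ∎
  rest : ∀ i → c ℤ.* coeff (tail0 (a -ₚ e ·ₚ b)) i ≡ coeff (b *ₚ tail0 w) i
  rest i = begin
    c ℤ.* coeff (tail0 (a -ₚ e ·ₚ b)) i ≡⟨ cong (c ℤ.*_) (≡.trans (coeff-tail0 (a -ₚ e ·ₚ b) i) (≡.trans (coeff-+ a _ (suc i)) (cong (λ z → coeff a (suc i) ℤ.+ z) (≡.trans (coeff-neg (e ·ₚ b) (suc i)) (cong ℤ.-_ (coeff-· e b (suc i))))))) ⟩
    c ℤ.* (coeff a (suc i) ℤ.+ ℤ.- (e ℤ.* coeff b (suc i))) ≡⟨ solve 4 (λ c a e b → c :* (a :+ :- (e :* b)) := c :* a :+ :- (c :* e :* b)) ≡.refl c (coeff a (suc i)) e (coeff b (suc i)) ⟩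
    c ℤ.* coeff a (suc i) ℤ.+ ℤ.- (c ℤ.* e ℤ.* coeff b (suc i)) ≡⟨ cong₂ (λ x y → x ℤ.+ ℤ.- (y ℤ.* coeff b (suc i))) (≡.trans (h (suc i)) (coeff-*-suc b w i)) lead ⟩
    coeff w 0 ℤ.* coeff b (suc i) ℤ.+ coeff (b *ₚ tail0 w) i ℤ.+ ℤ.- (coeff w 0 ℤ.* coeff b (suc i)) ≡⟨ solve 2 (λ x y → x :+ y :+ :- x := y) ≡.refl (coeff w 0 ℤ.* coeff b (suc i)) (coeff (b *ₚ tail0 w) i) ⟩
    coeff (b *ₚ tail0 w) i ∎

·ₚ-cancel : ∀ {c p q} → c ≢ 0ℤ → c ·ₚ p ≋ c ·ₚ q → p ≋ q
·ₚ-cancel {c} {p} {q} c≢0 h .at i = ℤₚ.*-cancelˡ-≡ c _ _ {{ℤ.≢-nonZero c≢0}} (≡.trans (≡.sym (coeff-· c p i)) (≡.trans (h .at i) (coeff-· c q i)))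

-- A quotient over ℚ of bounded degree is already the truncated series quotient over ℤ.
seriesDiv-exact : ∀ n a b w c → c ≢ 0ℤ → coeff b 0 ℤ.* coeff b 0 ≡ 1ℤ → VanishesFrom n a → c ·ₚ a ≋ b *ₚ w → a ≋ seriesDiv n a b *ₚ b
seriesDiv-exact n a b w c c≢0 unit va h = ·ₚ-cancel c≢0 (≋-trans h (≋-trans (*ₚ-comm b w)
  (≋-trans (*ₚ-cong (≋-sym cd≋w) (≋-refl {b})) (·ₚ-*ₚ c (seriesDiv n a b) b))))
  where
  b≉0 : ¬ b ≋ []
  b≉0 b≋0 = contradiction (≡.trans (≡.sym unit) (cong₂ ℤ._*_ (b≋0 .at 0) (b≋0 .at 0))) λ ()
  -- The degree of `w` is below `n`, so truncating the series after `n` coefficients loses nothing.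
  vw : VanishesFrom n w
  vw = degree-bound {b} w n b≉0 (λ i n≤i → ≡.trans (≡.sym (h .at i)) (≡.trans (coeff-· c a i) (≡.trans (cong (c ℤ.*_) (va i n≤i)) (ℤₚ.*-zeroʳ c))))
  cd≋w : c ·ₚ seriesDiv n a b ≋ w
  cd≋w .at i with i ℕ.<? n
  ... | yes i<n = ≡.trans (coeff-· c (seriesDiv n a b) i) (seriesDiv-coeff n a b w c unit (λ j → ≡.trans (≡.sym (coeff-· c a j)) (h .at j)) i i<n)
  ... | no i≮n = let n≤i = ℕₚ.≮⇒≥ i≮n in ≡.trans (coeff-· c (seriesDiv n a b) i) (≡.trans (cong (c ℤ.*_) (seriesDiv-vanishes n a b i n≤i)) (≡.trans (ℤₚ.*-zeroʳ c) (≡.sym (vw i n≤i))))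

-- Proper divisors are smaller than `n`, so fuel beyond `n` is never reached. The two sides unfold
-- with different remaining fuel at each divisor `d`, and both are compared with `Φ d`; hence the
-- induction on fuel for all indices at once.
cycloF-fuel : ∀ f {n} → 0 < n → n ℕ.≤ f → cycloF f n ≡ Φ n
cycloF-fuel = <-rec _ step
  where
  step : ∀ f → (∀ {g} → g < f → ∀ {n} → 0 < n → n ℕ.≤ g → cycloF g n ≡ Φ n) → ∀ {n} → 0 < n → n ℕ.≤ f → cycloF f n ≡ Φ n
  step (suc f) ih {suc n} _ (s≤s n≤f) = cong (λ ps → seriesDiv (suc (suc n)) (monoₚ (suc n) -ₚ constₚ 1ℤ) (prodₚ ps))
    (map-cong-local (All.tabulate (λ d∈ → let (0<d , d<n , _) = ∈-properDivisors⁻ d∈ in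
      ≡.trans (ih ℕₚ.≤-refl 0<d (ℕₚ.≤-trans (ℕₚ.≤-pred d<n) n≤f)) (≡.sym (ih (s≤s n≤f) 0<d (ℕₚ.≤-pred d<n))))))

Φ-unfold : ∀ n → Φ (suc n) ≡ seriesDiv (suc (suc n)) (monoₚ (suc n) -ₚ constₚ 1ℤ) (prodₚ (map Φ (properDivisors (suc n))))
Φ-unfold n = cong (λ ps → seriesDiv (suc (suc n)) (monoₚ (suc n) -ₚ constₚ 1ℤ) (prodₚ ps))
  (map-cong-local (All.tabulate (λ d∈ → let (0<d , d<n , _) = ∈-properDivisors⁻ d∈ in cycloF-fuel n 0<d (ℕₚ.≤-pred d<n))))

q : Poly
q = 0ℤ ∷ 1ℤ ∷ []

module PS = Sums polyRing

monoₚ≋ : ∀ n → monoₚ n ≋ PS.pw q n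
monoₚ≋ zero = ≋-refl
monoₚ≋ (suc n) = ≋-trans (∷-cong ≡.refl (monoₚ≋ n)) (≋-sym (≋-trans (*ₚ-comm (PS.pw q n) q)
  (≋-trans (shift-*ₚ (1ℤ ∷ []) (PS.pw q n)) (∷-cong ≡.refl (*ₚ-identityˡ (PS.pw q n))))))

record IsConst (p : Poly) : Set where
  constructor isConst
  field
    value : ℤ
    value≢0 : value ≢ 0ℤ
    p≋ : p ≋ constₚ value
open IsConst

const-* : ∀ c d → constₚ c *ₚ constₚ d ≋ constₚ (c ℤ.* d)
const-* c d = const-*ₚ c (constₚ d)

IsConst-* : ∀ {p r} → IsConst p → IsConst r → IsConst (p *ₚ r)
IsConst-* {p} {r} (isConst c c≢0 h) (isConst d d≢0 k) = isConst (c ℤ.* d)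
  (λ cd≡0 → case ℤₚ.i*j≡0⇒i≡0∨j≡0 c cd≡0 of λ { (inj₁ e) → c≢0 e ; (inj₂ e) → d≢0 e })
  (≋-trans (*ₚ-cong h k) (const-* c d))

IsConst-resp : ∀ {p r} → p ≋ r → IsConst p → IsConst r
IsConst-resp p≋r (isConst c c≢0 h) = isConst c c≢0 (≋-trans (≋-sym p≋r) h)

IsConst-1 : IsConst (constₚ 1ℤ)
IsConst-1 = isConst 1ℤ (λ ()) ≋-refl

open Bezout polyRing IsConst IsConst-resp IsConst-1 IsConst-*
open Powers q

nat-const : ∀ t → nat t ≋ constₚ (+ t)
nat-const zero = ≋-sym 0∷[]
nat-const (suc t) = +ₚ-cong (≋-refl {constₚ 1ℤ}) (nat-const t)

coeff-X-0 : ∀ n → 0 < n → coeff (X n) 0 ≡ -1ℤ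
coeff-X-0 (suc n) _ = ≡.trans (coeff-+ (PS.pw q (suc n)) (-ₚ constₚ 1ℤ) 0) (cong (ℤ._+ -1ℤ) (≡.sym (monoₚ≋ (suc n) .at 0)))

X-nonzero : ∀ {n} → 0 < n → ¬ X n ≋ []
X-nonzero {n} 0<n h = contradiction (≡.trans (≡.sym (coeff-X-0 n 0<n)) (h .at 0)) λ ()

polyCancel : ∀ {p x y} → ¬ p ≋ [] → p *ₚ x ≋ p *ₚ y → x ≋ y
polyCancel {p} {x} {y} p≉0 h with zero? (x -ₚ y)
... | yes e = PS.lc₁ (constₚ 1ℤ) e (solve 2 (λ x y → x := y :+ con 1ℤ :* (x :- y :- con 0ℤ)) ≋-refl x y)
  where open RingKit polyRing
... | no ne = contradiction (PS.lc₁ (constₚ 1ℤ) h (solve 3 (λ p x y → p :* (x :- y) := con 0ℤ :+ con 1ℤ :* (p :* x :- p :* y)) ≋-refl p x y)) (*ₚ-nonzero p≉0 ne)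
  where open RingKit polyRing

nat-IsConst : ∀ t → IsConst (nat (suc t))
nat-IsConst t = isConst (+ suc t) (λ ()) (nat-const (suc t))

X-cancel : ∀ {n x y} → 0 < n → X n *ₚ x ≋ X n *ₚ y → x ≋ y
X-cancel 0<n = polyCancel (X-nonzero 0<n)

open Cyclotomic nat-IsConst X-cancel Φ

private
  ±1-factor : ∀ {x y} → x ℤ.* y ≡ -1ℤ → y ℤ.* y ≡ 1ℤ → x ℤ.* x ≡ 1ℤ
  ±1-factor {x} {y} h k = begin
    x ℤ.* x                      ≡⟨ ℤₚ.*-identityʳ _ ⟨
    x ℤ.* x ℤ.* 1ℤ               ≡⟨ cong (x ℤ.* x ℤ.*_) k ⟨
    x ℤ.* x ℤ.* (y ℤ.* y)        ≡⟨ solve 2 (λ x y → x :* x :* (y :* y) := x :* y :* (x :* y)) ≡.refl x y ⟩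
    x ℤ.* y ℤ.* (x ℤ.* y)        ≡⟨ cong₂ ℤ._*_ h h ⟩
    1ℤ                           ∎
    where
    open ≡.≡-Reasoning
    open ℤ-Solver

  UnitConstant : Poly → Set
  UnitConstant p = coeff p 0 ℤ.* coeff p 0 ≡ 1ℤ

  unit-* : ∀ {p r} → UnitConstant p → UnitConstant r → UnitConstant (p *ₚ r)
  unit-* {p} {r} h k = ≡.trans (cong₂ ℤ._*_ (coeff-*-0 p r) (coeff-*-0 p r))
    (≡.trans (solve 2 (λ x y → x :* y :* (x :* y) := x :* x :* (y :* y)) ≡.refl (coeff p 0) (coeff r 0)) (cong₂ ℤ._*_ h k))
    where open ℤ-Solver

  unit-prod : ∀ ps → All UnitConstant ps → UnitConstant (prodₚ ps)
  unit-prod [] [] = ≡.refl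
  unit-prod (p ∷ ps) (h ∷ hs) = unit-* {p} {prodₚ ps} h (unit-prod ps hs)

  -- The two claims need each other: exact division at `n` requires the constant term of the divisor
  -- product to be ±1, and the factorisation then forces the same for `Φ n`, because the two
  -- constant terms multiply to -1.
  factors-and-unit : ∀ n → 0 < n → Factors n × UnitConstant (Φ n)
  factors-and-unit = <-rec _ step
    where
    step : ∀ n → (∀ {m} → m < n → 0 < m → Factors m × UnitConstant (Φ m)) → 0 < n → Factors n × UnitConstant (Φ n)
    step n@(suc n′) ih 0<n with X-divisible n (λ 0<m m<n → proj₁ (ih m<n 0<m))
    ... | s , isConst c c≢0 s≋ , w , e = factors , ±1-factor {coeff (Φ n) 0} {coeff b 0} (≡.trans (≡.sym (coeff-*-0 (Φ n) b)) (≡.trans (≡.sym (factors .at 0)) (coeff-X-0 n 0<n))) unit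
      where
      b = ∏ Φ (properDivisors n)
      a = monoₚ n -ₚ constₚ 1ℤ
      a≋X : a ≋ X n
      a≋X = +ₚ-cong (monoₚ≋ n) (≋-refl { -ₚ constₚ 1ℤ })
      mono-vanishes : ∀ n → VanishesFrom (suc n) (monoₚ n)
      mono-vanishes zero (suc i) _ = ≡.refl
      mono-vanishes (suc n) (suc i) (s≤s h) = mono-vanishes n i h
      va : VanishesFrom (suc n) a
      va (suc i) h = ≡.trans (coeff-+ (monoₚ n) (-ₚ constₚ 1ℤ) (suc i)) (≡.trans (ℤₚ.+-identityʳ _) (mono-vanishes n (suc i) h))
      all-units : ∀ ds → (∀ {d} → d ∈ ds → d ∈ properDivisors n) → All UnitConstant (map Φ ds)
      all-units [] h = []
      all-units (d ∷ ds) h = (let (0<d , d<n , _) = ∈-properDivisors⁻ (h (here ≡.refl)) in proj₂ (ih d<n 0<d)) ∷ all-units ds (λ d∈ → h (there d∈))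
      unit : UnitConstant b
      unit = unit-prod (map Φ (properDivisors n)) (all-units (properDivisors n) (λ d∈ → d∈))
      factors : Factors n
      factors = ≋-trans (≋-sym a≋X) (≋-trans (seriesDiv-exact (suc n) a b w c c≢0 unit va
        (≋-trans (≋-sym (const-*ₚ c a)) (≋-trans (*ₚ-cong (≋-sym s≋) a≋X) e))) (*ₚ-cong (≡⇒≋ (≡.sym (Φ-unfold n′))) ≋-refl))

factors : ∀ {n} → 0 < n → Factors n
factors 0<n = proj₁ (factors-and-unit _ 0<n)

module PK = RingKit polyRing

polyDomain : IsDecidableDomain polyRing
polyDomain = record { zero? = zero? ; 1≉0 = λ h → contradiction (h .at 0) λ () ; *-nonzero = *ₚ-nonzero }

-- The substitution `q ↦ -q` and the modulus

negVar-[] : ∀ {p} → p ≋ [] → negVar p ≋ []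
negVar-[] {[]} h = ≋-refl
negVar-[] {a ∷ p} h = ≋-trans (∷-cong (h .at 0) (-ₚ-cong (negVar-[] (tail-≋[] h)))) 0∷[]

negVar-cong : ∀ {p r} → p ≋ r → negVar p ≋ negVar r
negVar-cong {[]} {r} h = ≋-sym (negVar-[] (≋-sym h))
negVar-cong {a ∷ p} {[]} h = negVar-[] {a ∷ p} h
negVar-cong {a ∷ p} {b ∷ r} h = ∷-cong (h .at 0) (-ₚ-cong (negVar-cong (tail-≋ h)))

negVar-+ : ∀ p r → negVar (p +ₚ r) ≋ negVar p +ₚ negVar r
negVar-+ [] r = ≋-refl
negVar-+ (a ∷ p) [] = ≋-refl
negVar-+ (a ∷ p) (b ∷ r) = ∷-cong ≡.refl (≋-trans (-ₚ-cong (negVar-+ p r)) (≋-sym (PK.-‿+-comm (negVar p) (negVar r))))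

negVar-· : ∀ c p → negVar (c ·ₚ p) ≋ c ·ₚ negVar p
negVar-· c [] = ≋-refl
negVar-· c (a ∷ p) = ∷-cong ≡.refl (≋-trans (-ₚ-cong (negVar-· c p)) (≋-trans (-ₚ-cong (≋-sym (const-*ₚ c (negVar p))))
  (≋-trans (PK.-‿distribʳ-* (constₚ c) (negVar p)) (const-*ₚ c (-ₚ negVar p)))))

negVar-* : ∀ p r → negVar (p *ₚ r) ≋ negVar p *ₚ negVar r
negVar-* [] r = ≋-refl
negVar-* (a ∷ p) r = ≋-trans (negVar-+ (a ·ₚ r) (0ℤ ∷ (p *ₚ r)))
  (+ₚ-cong (negVar-· a r) (∷-cong ≡.refl (≋-trans (-ₚ-cong (negVar-* p r)) (PK.-‿distribˡ-* (negVar p) (negVar r)))))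

negVar-q : negVar q ≋ -ₚ q
negVar-q = ≋-refl

negVar-pw-even : ∀ k → negVar (PS.pw q (2 ℕ.* k)) ≋ PS.pw q (2 ℕ.* k)
negVar-pw-even zero = ≋-refl
negVar-pw-even (suc k) = ≡.subst (λ j → negVar (PS.pw q j) ≋ PS.pw q j) (≡.sym (cong suc (ℕₚ.+-suc k (k ℕ.+ 0))))
  (≋-trans (negVar-* (PS.pw q (2 ℕ.* k) *ₚ q) q) (≋-trans (*ₚ-cong (≋-trans (negVar-* (PS.pw q (2 ℕ.* k)) q) (*ₚ-cong (negVar-pw-even k) negVar-q)) negVar-q)
    (solve 2 (λ p q → p :* (:- q) :* (:- q) := p :* q :* q) ≋-refl (PS.pw q (2 ℕ.* k)) q)))
  where open PK

negVar-X-even : ∀ k → negVar (X (2 ℕ.* k)) ≋ X (2 ℕ.* k)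
negVar-X-even k = ≋-trans (negVar-+ (PS.pw q (2 ℕ.* k)) (-ₚ constₚ 1ℤ)) (+ₚ-cong (negVar-pw-even k) ≋-refl)

negVar-X-odd : ∀ k → negVar (X (suc (2 ℕ.* k))) ≋ -ₚ (PS.pw q (suc (2 ℕ.* k)) +ₚ constₚ 1ℤ)
negVar-X-odd k = ≋-trans (negVar-+ (PS.pw q (2 ℕ.* k) *ₚ q) (-ₚ constₚ 1ℤ)) (≋-trans (+ₚ-cong (≋-trans (negVar-* (PS.pw q (2 ℕ.* k)) q) (*ₚ-cong (negVar-pw-even k) negVar-q)) ≋-refl)
  (solve 2 (λ p q → p :* (:- q) :+ (:- con 1ℤ) := :- (p :* q :+ con 1ℤ)) ≋-refl (PS.pw q (2 ℕ.* k)) q))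
  where open PK

Cop-negVar : ∀ {V W} → Cop V W → Cop (negVar V) (negVar W)
Cop-negVar {V} {W} (a , b , s , isConst c c≢0 s≋ , h) = negVar a , negVar b , negVar s , isConst c c≢0 (negVar-cong s≋) ,
  ≋-trans (≋-sym (≋-trans (negVar-+ (a *ₚ V) (b *ₚ W)) (+ₚ-cong (negVar-* a V) (negVar-* b W)))) (negVar-cong h)

module OddIndex (n h : ℕ) (n≡ : n ≡ suc (2 ℕ.* h)) where
  0<n : 0 < n
  0<n = ≡.subst (0 <_) (≡.sym n≡) (s≤s z≤n)

  M : Poly
  M = modulus n

  coprime-2 : Coprime n 2
  coprime-2 {k} (k∣n , k∣2) = ∣.∣1⇒≡1 (∣.∣m+n∣m⇒∣n (≡.subst (k ∣_) (≡.trans n≡ (ℕₚ.+-comm 1 _)) k∣n) (∣.∣m⇒∣m*n h k∣2))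

  -- Oddness of `n` turns `n ∤ k` into `n ∤ 2k`; and `q^(2k) - 1` is even in `q`, so coprimality to
  -- `Φₙ(q)` carries over to `Φₙ(-q)`.
  X-coprime : ∀ {k} → ¬ n ∣ k → Cop (X (2 ℕ.* k)) M
  X-coprime {k} n∤k = Cop-sym (Cop-* (Cop-* (Cop-* negΦ negΦ) posΦ) posΦ)
    where
    base : Cop (X (2 ℕ.* k)) (Φ n)
    base = Cop-nondivisor {n} {2 ℕ.* k} 0<n factors (λ n∣2k → n∤k (coprime-divisor coprime-2 n∣2k))
    posΦ : Cop (Φ n) (X (2 ℕ.* k))
    posΦ = Cop-sym base
    negΦ : Cop (negVar (Φ n)) (X (2 ℕ.* k))
    negΦ = Cop-sym (Cop-resp (negVar-X-even k) (Cop-negVar base))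

  -- In `q^(2n) - 1 = (q^n + 1)(q^n - 1)` the first factor is, for odd `n`, minus the second one at
  -- `-q`, so it is divisible by `Φₙ(-q)`.
  M-divides : Divides M (X (2 ℕ.* n) *ₚ X (2 ℕ.* n))
  M-divides = k *ₚ l *ₚ (k *ₚ l) , ≋-trans (*ₚ-cong X2n X2n)
        (solve 4 (λ a b k l → (:- (b :* l)) :* (a :* k) :* ((:- (b :* l)) :* (a :* k)) := b :* b :* a :* a :* (k :* l :* (k :* l))) ≋-refl (Φ n) (negVar (Φ n)) k l)
    where
    open PK using (solve; _:=_; _:+_; _:*_; _:-_; :-_; con)
    e : Divides (Φ n) (X n)
    e = Φ-divides {n} (factors 0<n)
    k = proj₁ e
    l = negVar k
    plus : PS.pw q n +ₚ constₚ 1ℤ ≋ -ₚ (negVar (Φ n) *ₚ l)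
    plus = ≋-trans (≋-sym (PK.-‿involutive _)) (-ₚ-cong (≋-trans (≋-sym (≡.subst (λ n → negVar (X n) ≋ -ₚ (PS.pw q n +ₚ constₚ 1ℤ)) (≡.sym n≡) (negVar-X-odd h)))
      (≋-trans (negVar-cong (proj₂ e)) (negVar-* (Φ n) k))))
    X2n : X (2 ℕ.* n) ≋ -ₚ (negVar (Φ n) *ₚ l) *ₚ (Φ n *ₚ k)
    X2n = ≋-trans (+ₚ-cong (≋-trans (PS.pw-+ q n (n ℕ.+ 0)) (*ₚ-cong {PS.pw q n} ≋-refl (≡⇒≋ (cong (PS.pw q) (ℕₚ.+-identityʳ n))))) ≋-refl)
      (≋-trans (solve 1 (λ p → p :* p :- con 1ℤ := (p :+ con 1ℤ) :* (p :- con 1ℤ)) ≋-refl (PS.pw q n)) (*ₚ-cong plus (proj₂ e)))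

  -- Inherited from `q^(2n) - 1`, whose constant term is -1 and whose square `M` divides.
  q-coprime : Cop q M
  q-coprime = Cop-sym (Cop-dividesˡ M-divides (Cop-* cop cop))
    where
    open PK using (solve; _:=_; _:+_; _:*_; _:-_; :-_; con)
    shift : ∀ j → 0 < j → Cop (X j) q
    shift (suc j) _ = -ₚ constₚ 1ℤ , PS.pw q j , constₚ 1ℤ , isConst 1ℤ (λ ()) ≋-refl ,
      solve 2 (λ p q → (:- con 1ℤ) :* (p :* q :- con 1ℤ) :+ p :* q := con 1ℤ) ≋-refl (PS.pw q j) q
    cop : Cop (X (2 ℕ.* n)) q
    cop = shift (2 ℕ.* n) (ℕₚ.≤-trans 0<n (ℕₚ.m≤m+n n (n ℕ.+ 0)))

  module LF = LocalFractions polyRing polyDomain IsConst IsConst-resp IsConst-1 IsConst-* q M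

  q≉0 : ¬ q ≋ []
  q≉0 h = contradiction (h .at 1) λ ()

  exponential : Exponential (Fractions.fractionRing polyRing polyDomain) LF.localisation n
  exponential = LF.exponential n q≉0 X-nonzero q-coprime X-coprime M-divides

-- From pairs of coefficient lists to the fraction field

open Fractions polyRing polyDomain using (Fraction; frac; _≃_; cross; _⊕_; _⊗_; ⊝_; embed; invert; num-≉0; fractionRing)
  renaming (num to numᶠ; den to denᶠ; den≉0 to denᶠ≉0)

-- A pair in `Frac` may have a zero denominator, so its nonvanishing has to be established along
-- every operation, division included.
record Represents (X : Frac) (x : Fraction) : Set where
  constructor represents
  field
    nonzero : ¬ den X ≋ []
    same : num X *ₚ denᶠ x ≋ numᶠ x *ₚ den X
open Represents

module _ where
  open PK using (solve; _:=_; _:+_; _:*_; _:-_; :-_; con)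
  open PS

  rep-+ : ∀ {X Y x y} → Represents X x → Represents Y y → Represents (X +f Y) (x ⊕ y)
  rep-+ {a , b} {c , d} {frac a′ b′ _} {frac c′ d′ _} (represents b≉0 h) (represents d≉0 k) = represents (*ₚ-nonzero b≉0 d≉0)
    (lc₂ (d *ₚ d′) (b *ₚ b′) h k (solve 8 (λ a b a′ b′ c d c′ d′ → (a :* d :+ c :* b) :* (b′ :* d′) := (a′ :* d′ :+ c′ :* b′) :* (b :* d)
       :+ d :* d′ :* (a :* b′ :- a′ :* b) :+ b :* b′ :* (c :* d′ :- c′ :* d)) ≋-refl a b a′ b′ c d c′ d′))

  rep-minus : ∀ {X Y x y} → Represents X x → Represents Y y → Represents (X -f Y) (x ⊕ ⊝ y)
  rep-minus {a , b} {c , d} {frac a′ b′ _} {frac c′ d′ _} (represents b≉0 h) (represents d≉0 k) = represents (*ₚ-nonzero b≉0 d≉0)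
    (lc₂ (d *ₚ d′) (-ₚ (b *ₚ b′)) h k (solve 8 (λ a b a′ b′ c d c′ d′ → (a :* d :- c :* b) :* (b′ :* d′) := (a′ :* d′ :+ (:- c′) :* b′) :* (b :* d)
       :+ d :* d′ :* (a :* b′ :- a′ :* b) :+ (:- (b :* b′)) :* (c :* d′ :- c′ :* d)) ≋-refl a b a′ b′ c d c′ d′))

  rep-* : ∀ {X Y x y} → Represents X x → Represents Y y → Represents (X *f Y) (x ⊗ y)
  rep-* {a , b} {c , d} {frac a′ b′ _} {frac c′ d′ _} (represents b≉0 h) (represents d≉0 k) = represents (*ₚ-nonzero b≉0 d≉0)
    (lc₂ (c *ₚ d′) (a′ *ₚ b) h k (solve 8 (λ a b a′ b′ c d c′ d′ → a :* c :* (b′ :* d′) := a′ :* c′ :* (b :* d)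
       :+ c :* d′ :* (a :* b′ :- a′ :* b) :+ a′ :* b :* (c :* d′ :- c′ :* d)) ≋-refl a b a′ b′ c d c′ d′))

  rep-/ : ∀ {X Y x y} → Represents X x → Represents Y y → ¬ y ≃ embed [] → Represents (X /f Y) (x ⊗ invert y)
  rep-/ {a , b} {c , d} {frac a′ b′ _} {frac c′ d′ d′≉0} (represents b≉0 h) (represents d≉0 k) y≄0 with zero? c′
  ... | yes c′≈0 = contradiction c′≈0 (num-≉0 y≄0)
  ... | no c′≉0 = represents (*ₚ-nonzero b≉0 c≉0)
    (lc₂ (d *ₚ c′) (-ₚ (a′ *ₚ b)) h k (solve 8 (λ a b a′ b′ c d c′ d′ → a :* d :* (b′ :* c′) := a′ :* d′ :* (b :* c)
       :+ d :* c′ :* (a :* b′ :- a′ :* b) :+ (:- (a′ :* b)) :* (c :* d′ :- c′ :* d)) ≋-refl a b a′ b′ c d c′ d′))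
    where
    c≉0 : ¬ c ≋ []
    c≉0 c≈0 = *ₚ-nonzero c′≉0 d≉0 (≋-trans (≋-sym k) (≋[]-*ₚ d′ c≈0))

  ≡f-intro : ∀ n h (n≡ : n ≡ suc (2 ℕ.* h)) {X Y x y} → Represents X x → Represents Y y →
    OddIndex.LF.MultipleOf n h n≡ (modulus n) (x ⊕ ⊝ y) → X ≡f Y [mod modulus n ]
  ≡f-intro n h n≡ {a , b} {c , d} {frac a′ b′ b′≉0} {frac c′ d′ d′≉0} (represents b≉0 h₁) (represents d≉0 h₂) mult =
    (λ z → b≉0 (IsZero⇒≋[] z)) , (λ z → d≉0 (IsZero⇒≋[] z)) , U , V ,
    (proj₁ coprime , proj₁ (proj₂ coprime) , value const , value≢0 const , ≋⇒≈ₚ (≋-trans (proj₂ (proj₂ (proj₂ (proj₂ coprime)))) (p≋ const))) ,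
    -- The required equation is proved after multiplication by the denominators `b′ d′` of the
    -- representing fractions, which are nonzero and cancel.
    ≋⇒≈ₚ (polyCancel (*ₚ-nonzero b′≉0 d′≉0)
      (lc₃ (d *ₚ d′ *ₚ V) (-ₚ (b *ₚ b′ *ₚ V)) (b *ₚ d) h₁ h₂ num-eq
        (solve 11 (λ a b c d a′ b′ c′ d′ M U V → b′ :* d′ :* ((a :* d :- c :* b) :* V) := b′ :* d′ :* (M :* U :* b :* d)
           :+ d :* d′ :* V :* (a :* b′ :- a′ :* b) :+ (:- (b :* b′ :* V)) :* (c :* d′ :- c′ :* d)
           :+ b :* d :* ((a′ :* d′ :+ (:- c′) :* b′) :* V :- M :* U :* (b′ :* d′)))
          ≋-refl a b c d a′ b′ c′ d′ (modulus n) U V)))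
    where
    open OddIndex n h n≡
    open LF.MultipleOf mult
    const = proj₁ (proj₂ (proj₂ (proj₂ coprime)))

module Represent (n h : ℕ) (n≡ : n ≡ suc (2 ℕ.* h)) (d : ℕ) (r : ℤ) where
  open OddIndex n h n≡
  open Exponential exponential using (E)
  module Lit = Literal fractionRing LF.localisation n exponential d r
  open Sums fractionRing using (∑)
  open Lit

  rep-const : ∀ c → Represents (constf c) (embed (constₚ c))
  rep-const c = represents (λ h → contradiction (h .at 0) λ ()) ≋-refl

  rep-0 : Represents (constf 0ℤ) (embed [])
  rep-0 = represents (λ h → contradiction (h .at 0) λ ()) (*ₚ-cong {0ℤ ∷ []} {[]} {constₚ 1ℤ} 0∷[] ≋-refl)

  rep-qpow : ∀ i → Represents (qpow i) (E i)
  rep-qpow (+ k) = represents (λ h → contradiction (h .at 0) λ ()) (*ₚ-cong (monoₚ≋ k) ≋-refl)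
  rep-qpow -[1+ k ] = represents (λ h → LF.pw≉0 n q≉0 X-nonzero q-coprime X-coprime M-divides (suc k) (≋-trans (≋-sym (monoₚ≋ (suc k))) h))
    (*ₚ-cong {constₚ 1ℤ} ≋-refl (≋-sym (monoₚ≋ (suc k))))

  rep-∑ : ∀ k {f g} → (∀ i → Represents (f i) (g i)) → Represents (sumf k f) (∑ k g)
  rep-∑ zero h = rep-0
  rep-∑ (suc k) h = rep-+ (rep-∑ k h) (h k)

  rep-sign : ∀ k → Represents (signf k) (sg k)
  rep-sign zero = rep-const 1ℤ
  rep-sign (suc k) = rep-* (rep-const -1ℤ) (rep-sign k)

  rep-poch : ∀ e s k → Represents (qpoch e s k) (P e s k)
  rep-poch e s zero = rep-const 1ℤ
  rep-poch e s (suc k) = rep-* (rep-poch e s k) (rep-minus (rep-const 1ℤ) (rep-qpow (e ℤ.+ + (s ℕ.* k))))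

  rep-sq : ∀ {X x} → Represents X x → Represents (sq X) (x ⊗ x)
  rep-sq h = rep-* h h

  module _ (m : ℕ) (0<d : 0 < d) (2m<n : m ℕ.+ m < n) (coprime : Coprime n d) (r≡ : r ≡ + n ℤ.- + d ℤ.* + m) where
    module Reflected = Lit.Main m 0<d 2m<n (suc h , ≡.trans (cong suc n≡) (cong (λ k → suc (suc k)) (ℕₚ.*-comm 2 h))) coprime r≡
    open Reflected
    open Local fractionRing LF.localisation using (≉0-*; ≉0-resp)
    open CommutativeRing fractionRing using (sym; trans)

    rep-c : ∀ k → Represents (cq d r k) (c′ k)
    rep-c k = rep-* (rep-* (rep-sign k) (rep-/
        (rep-* (rep-+ (rep-const 1ℤ) (rep-qpow (+ (2 ℕ.* d ℕ.* k) ℤ.+ r))) (rep-sq (rep-poch (+ 2 ℤ.* r) (2 ℕ.* d) k)))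
        (rep-* (rep-+ (rep-const 1ℤ) (rep-qpow r)) (rep-sq (rep-poch (+ (2 ℕ.* d)) (2 ℕ.* d) k)))
        (≉0-* 1+u≉0 (≉0-* P≉0 P≉0)))) (rep-qpow (+ (d ℕ.* k ℕ.* k) ℤ.+ + k ℤ.* (+ d ℤ.- r)))
      where
      P≉0 : ¬ P (+ (2 ℕ.* d)) (2 ℕ.* d) k ≃ embed []
      P≉0 = ≉0-resp (sym (P-poch (+ (2 ℕ.* d)) (CommutativeRing.refl fractionRing) k)) (SC.poch-≉0 k Q≉0)

    rep-s : ∀ k → Represents (rterm d r k) (s′ k)
    rep-s k = rep-* (rep-/ (rep-* (rep-poch (+ 2 ℤ.* r) (2 ℕ.* d) k) (rep-poch r (2 ℕ.* d) k))
        (rep-* (rep-poch (+ (2 ℕ.* d)) (2 ℕ.* d) k) (rep-poch (+ (2 ℕ.* d) ℤ.+ r) (2 ℕ.* d) k)) (≉0-* P≉0 P′≉0)) (rep-qpow (+ (2 ℕ.* k) ℤ.* (+ d ℤ.- r)))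
      where
      P≉0 : ¬ P (+ (2 ℕ.* d)) (2 ℕ.* d) k ≃ embed []
      P≉0 = ≉0-resp (sym (P-poch (+ (2 ℕ.* d)) (CommutativeRing.refl fractionRing) k)) (SC.poch-≉0 k Q≉0)
      P′≉0 : ¬ P (+ (2 ℕ.* d) ℤ.+ r) (2 ℕ.* d) k ≃ embed []
      P′≉0 = ≉0-resp (sym (P-poch (+ (2 ℕ.* d) ℤ.+ r) (Exponential.E-+ exponential (+ (2 ℕ.* d)) r) k)) (SC.poch-≉0 k Qu≉0)

    rep-qint : ∀ i → Represents (qint2 i) (qint i)
    rep-qint i = rep-/ (rep-minus (rep-const 1ℤ) (rep-qpow (+ 2 ℤ.* i))) (rep-minus (rep-const 1ℤ) (rep-qpow (+ 2))) (Exponential.E-≉0 exponential {+ 2} (λ ()))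

    rep-lhs : Represents (lhs n d r) lhs′
    rep-lhs = rep-∑ n (λ k → rep-∑ (suc k) (λ j → rep-* (rep-c j) (rep-c (k ∸ j))))

    rep-rhs : Represents ((sq (qint2 (+ n)) /f sq (qint2 r)) *f qpow (+ 2 ℤ.* + m ℤ.* (+ n ℤ.+ r ℤ.- + d)) *f sq (sumf (suc m) (rterm d r))) (rhs′ m)
    rep-rhs = rep-* (rep-* (rep-/ (rep-sq (rep-qint (+ n))) (rep-sq (rep-qint r)) qint²≉0) (rep-qpow (+ 2 ℤ.* + m ℤ.* (+ n ℤ.+ r ℤ.- + d)))) (rep-sq (rep-∑ (suc m) rep-s))

    congruent-fractions : lhs n d r ≡f ((sq (qint2 (+ n)) /f sq (qint2 r)) *f qpow (+ 2 ℤ.* + m ℤ.* (+ n ℤ.+ r ℤ.- + d)) *f sq (sumf (suc m) (rterm d r))) [mod modulus n ]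
    congruent-fractions = ≡f-intro n h n≡ rep-lhs rep-rhs (Modulo.difference congruence)

-- Exact quotients and the passage from `r` to `m`

/ℕ-exact : ∀ i d .{{_ : ℕ.NonZero d}} → (i ℤ.* + d) ℤ./ℕ d ≡ i
/ℕ-exact i d = ≡.sym (ℤₚ.i-j≡0⇒i≡j i k (ℤₚ.∣i∣≡0⇒i≡0 (small ℤ.∣ i ℤ.- k ∣ abs≡)))
  where
  open ℤ-Solver
  k = (i ℤ.* + d) ℤ./ℕ d
  ρ = (i ℤ.* + d) ℤ.%ℕ d
  ρ≡ : + ρ ≡ (i ℤ.- k) ℤ.* + d
  ρ≡ = ≡.trans (solve 2 (λ ρ kd → ρ := ρ :+ kd :- kd) ≡.refl (+ ρ) (k ℤ.* + d))
    (≡.trans (cong (λ z → z ℤ.- k ℤ.* + d) (≡.sym (ℤ÷.a≡a%ℕn+[a/ℕn]*n (i ℤ.* + d) d)))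
      (solve 3 (λ i k d → i :* d :- k :* d := (i :- k) :* d) ≡.refl i k (+ d)))
  abs≡ : ρ ≡ ℤ.∣ i ℤ.- k ∣ ℕ.* d
  abs≡ = ≡.trans (cong ℤ.∣_∣ ρ≡) (ℤₚ.abs-* (i ℤ.- k) (+ d))
  -- The remainder is `t d` with `t = |i - k|` and also less than `d`, so `t` can only be 0.
  small : ∀ t → ρ ≡ t ℕ.* d → t ≡ 0
  small zero _ = ≡.refl
  small (suc t) e = contradiction (ℤ÷.n%ℕd<d (i ℤ.* + d) d) (ℕₚ.≤⇒≯ (ℕₚ.≤-trans (ℕₚ.m≤m+n d (t ℕ.* d)) (ℕₚ.≤-reflexive (≡.sym e))))

odd-form : ∀ n → ¬ (2 ∣ n) → ∃[ h ] n ≡ suc (2 ℕ.* h)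
odd-form zero ¬2∣n = contradiction (∣.divides 0 ≡.refl) ¬2∣n
odd-form (suc zero) _ = 0 , ≡.refl
odd-form (suc (suc n)) ¬2∣n with odd-form n (λ 2∣n → ¬2∣n (∣.∣m∣n⇒∣m+n ∣.∣-refl 2∣n))
... | h , eq = suc h , cong suc (≡.trans (cong suc eq) (cong suc (≡.sym (ℕₚ.+-suc h (h ℕ.+ 0)))))

-- The lower bound on `r` is doubled to clear the denominator 2. The witness `m` of the divisibility
-- is `(n - r)/d`.
theorem1p3 : (n d : ℕ) .{{_ : ℕ.NonZero d}} (r : ℤ) →
    1 < n → ¬ (2 ∣ n) → Coprime n d →
    + 2 ℤ.* + n ℤ.- + (n ∸ 1) ℤ.* + d ℤ.≤ + 2 ℤ.* r → r ℤ.≤ + n →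
    (+ d) ℤ∣.∣ (+ n ℤ.- r) →
    lhs n d r ≡f rhs n d r [mod modulus n ]
theorem1p3 n d r 1<n ¬2∣n coprime lower upper (∣.divides m N≡) =
  ≡.subst (λ Y → lhs n d r ≡f Y [mod modulus n ]) (≡.sym rhs≡)
    (Represent.congruent-fractions n (proj₁ odd) (proj₂ odd) d r m (ℕ.>-nonZero⁻¹ d) 2m<n coprime r≡)
  where
  open ℤ-Solver
  odd = odd-form n ¬2∣n
  n-r≡ : + n ℤ.- r ≡ + m ℤ.* + d
  n-r≡ = ≡.trans (≡.sym (ℤₚ.0≤i⇒+∣i∣≡i (ℤₚ.i≤j⇒0≤j-i upper))) (≡.trans (cong +_ N≡) (ℤₚ.pos-* m d))
  r≡ : r ≡ + n ℤ.- + d ℤ.* + m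
  r≡ = ≡.trans (solve 2 (λ n r → r := n :- (n :- r)) ≡.refl (+ n) r) (cong (λ z → + n ℤ.- z) (≡.trans n-r≡ (ℤₚ.*-comm (+ m) (+ d))))
  -- The lower bound on `r`, rewritten through `r = n - d m`; cancelling `d` then gives
  -- `2m ≤ n - 1`.
  2md≤ : + (m ℕ.+ m) ℤ.* + d ℤ.≤ + (n ∸ 1) ℤ.* + d
  2md≤ = ℤₚ.neg-cancel-≤ (≡.subst₂ ℤ._≤_
    (solve 2 (λ n k → :- n :+ (n :- k) := :- k) ≡.refl (+ 2 ℤ.* + n) (+ (n ∸ 1) ℤ.* + d))
    (≡.trans (cong (λ r → ℤ.- (+ 2 ℤ.* + n) ℤ.+ + 2 ℤ.* r) r≡)
      (solve 3 (λ n d m → :- (con (+ 2) :* n) :+ con (+ 2) :* (n :- d :* m) := :- ((m :+ m) :* d)) ≡.refl (+ n) (+ d) (+ m)))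
    (ℤₚ.+-monoʳ-≤ (ℤ.- (+ 2 ℤ.* + n)) lower))
  2m<n : m ℕ.+ m < n
  2m<n = ℕₚ.≤-trans (s≤s (ℕₚ.*-cancelʳ-≤ (m ℕ.+ m) (n ∸ 1) d (ℤₚ.drop‿+≤+ (≡.subst₂ ℤ._≤_ (≡.sym (ℤₚ.pos-* (m ℕ.+ m) d)) (≡.sym (ℤₚ.pos-* (n ∸ 1) d)) 2md≤))))
    (ℕₚ.≤-reflexive (ℕₚ.m+[n∸m]≡n (ℕₚ.<⇒≤ 1<n)))
  -- With `n - r = m d` both divisions by `d` are exact, in the exponent of `q` and in the length of
  -- the sum.
  rhs≡ : rhs n d r ≡ (sq (qint2 (+ n)) /f sq (qint2 r)) *f qpow (+ 2 ℤ.* + m ℤ.* (+ n ℤ.+ r ℤ.- + d)) *f sq (sumf (suc m) (rterm d r))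
  rhs≡ = cong₂ (λ e k → (sq (qint2 (+ n)) /f sq (qint2 r)) *f qpow e *f sq (sumf (suc k) (rterm d r)))
    (≡.trans (cong (ℤ._/ℕ d) (≡.trans (cong (λ z → + 2 ℤ.* z ℤ.* (+ n ℤ.+ r ℤ.- + d)) n-r≡)
      (solve 3 (λ m d w → con (+ 2) :* (m :* d) :* w := con (+ 2) :* m :* w :* d) ≡.refl (+ m) (+ d) (+ n ℤ.+ r ℤ.- + d)))) (/ℕ-exact (+ 2 ℤ.* + m ℤ.* (+ n ℤ.+ r ℤ.- + d)) d))
    (cong ℤ.∣_∣ (≡.trans (cong (ℤ._/ℕ d) n-r≡) (/ℕ-exact (+ m) d)))
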